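{- Let $\sigma$ be a fixed finite vocabulary and let $\mathcal{C}$ be a class of finite ordered $\sigma$-structures. Then $\mathcal{C}$ is decidable by a random-access Turing machine in polylogarithmic time with respect to $\hat n$, where $\hat n = |\mathrm{bin}(\mathbf{A})|$ is the length of the binary encoding of the input structure $\mathbf{A}$, if and only if $\mathcal{C}$ is decidable by a direct-access Turing machine in polylogarithmic time with respect to $n$, where $n=|A|$ is the size of the domain of the input structure $\mathbf{A}$.
   Context: **Structures.** A finite vocabulary $\sigma=\{R_1^{r_1},\dots,R_p^{r_p},c_1,\dots,c_q,f_1^{k_1},\dots,f_s^{k_s}\}$ consists of relation symbols ($R_i$ of arity $r_i$), constant symbols and function symbols ($f_i$ of arity $k_i$, interpreted by total functions). A finite ordered $\sigma$-structure $\mathbf{A}$ is a finite structure of vocabulary $\sigma\cup\{\le\}$, $\le\,\notin\sigma$, with $\le^{\mathbf{A}}$ a linear order on $A$. One assumes the domain is $A=\{0,\dots,n-1\}$ with its natural order. $\log$ is the binary logarithm. **Encoding.** $\mathrm{bin}(\mathbf{A})$ is the concatenation of the following binary strings, for all relations, then all constants, then all functions in $\sigma$: each relation $R_i^{\mathbf{A}}$ is encoded by a string of length $n^{r_i}$ whose $m$-th bit is $1$ iff the $m$-th tuple of $A^{r_i}$ (in lexicographic order) is in $R_i^{\mathbf{A}}$; each constant is encoded by its binary representation of length $\lceil\log n\rceil$; each function $f_i^{\mathbf{A}}$ is encoded by the encodings of $\lceil\log n\rceil$ many $k_i$-ary relations, the $m$-th of which indicates whether the $m$-th bit of the value of the function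 is $1$. (The order $\le^{\mathbf{A}}$ is not encoded explicitly.) **Random-access Turing machine.** A deterministic multi-tape machine $(Q,\Sigma,\delta,q_0,F)$ with $\Sigma=\{0,1,\sqcup\}$, a finite state set $Q$, initial state $q_0$, accepting states $F\subseteq Q$, a read-only random-access input-tape, a sequential-access address-tape (over $\{0,1,\sqcup\}$), and a fixed number $k\ge 1$ of sequential-access work-tapes; all tapes have a leftmost cell and are infinite to the right, and a head on the leftmost cell may not move left. The (partial) transition function is $\delta: Q\times(\Sigma\cup\{\triangleleft\})\times\Sigma^{k+1}\to Q\times(\Sigma\times\{\leftarrow,\rightarrow,-\})^{k+1}$: depending on the state, the scanned input symbol and the symbols scanned on the address-tape and work-tapes, it gives the new state and the symbols written and head moves on the address-tape and work-tapes. The machine halts when $\delta$ is undefined. If the number written in binary (most significant bit leftmost) on the address-tape from its leftmost cell up to the first blank is $i$ (with $i=0$ if the leftmost cell is blank), then the scanned input symbol is the $(i+1)$-th symbol of the input string if $i$ is less than its length, and the end-marker $\triangleleft$ otherwise. Initially the state is $q_0$, the address-tape contains $0$, the work-tapes are blank and all sequential heads are on the leftmost cells. An input is accepted if a configuration with state in $F$ is reached. **Direct-access Turing machine (for $\sigma$).** A deterministic multi-tape machine over the alphabet $\Sigma=\{0,1,\sqcup\}$ taking $\sigma$-structures $\mathbf{A}$ as input, with: $r_1+\dots+r_p+k_1+\dots+k_s$ address-tapes ($r_i$ of them dedicated to $R_i$, and $k_i$ to $f_i$); $s$ read-only value-tapes, one for each function symbol; $q+1$ read-only constant-tapes; and one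 or more ordinary work-tapes. In each step the new state, the head move on each tape, and the symbol written on each address-tape and each ordinary work-tape are determined (by a fixed, possibly partial, transition function; undefined means halt) by the current state, the symbols scanned on all tapes, and, for each $R_i\in\sigma$, the answer bit ($0$ or $1$) to the query $(n_1,\dots,n_{r_i})\in R_i^{\mathbf{A}}$, where $n_j$ is the number written in binary on the $j$-th address-tape of $R_i$. After that, the content of the value-tape of each $f_i$ is updated to $f_i^{\mathbf{A}}(n_1,\dots,n_{k_i})$ written in binary, where $n_j$ is the number now written in binary on the $j$-th address-tape of $f_i$; if some $n_j$ is too large (i.e. $\geq n$), the value-tape is updated to contain only blanks. Initially the constant-tapes hold $c_1^{\mathbf{A}},\dots,c_q^{\mathbf{A}}$ in binary and one further constant-tape holds $n=|A|$ in binary; all other tapes are blank. Acceptance is by reaching a state in $F$. **Deciding in polylogarithmic time.** A random-access machine $M$ decides $\mathcal{C}$ in polylogarithmic time with respect to $\hat n$ if there is $k\in\mathbb{N}$ such that, for every finite ordered $\sigma$-structure $\mathbf{A}$, on input $\mathrm{bin}(\mathbf{A})$ the machine $M$ makes at most $O(\lceil\log\hat n\rceil^k)$ steps before accepting or rejecting, and accepts iff $\mathbf{A}\in\mathcal{C}$. Likewise for a direct-access machine on input $\mathbf{A}$, with $n$ in place of $\hat n$.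
   Formalization: The vocabulary is assumed to contain a relation or function symbol of arity at least 1; otherwise bin(A) does not determine n (sizes 3 and 4 can share an encoding), a direct-access machine can still decide "n is even", and the equivalence fails. -}

module Defs where

open import Level using (0ℓ; _⊔_) renaming (suc to lsuc)
open import Data.Bool.Base using (Bool; true; false; T; if_then_else_)
open import Data.Fin.Base using (Fin; toℕ; fromℕ<)
open import Data.List.Base as List using (List; []; _∷_; _++_; length; concat; concatMap; allFin; cartesianProductWith)
open import Data.List.Relation.Unary.All as All using (All)
open import Data.List.Relation.Unary.Any using (Any)
open import Data.Maybe.Base using (Maybe; just; nothing; maybe′; _>>=_)
open import Data.Nat.Base using (ℕ; zero; suc; pred; _+_; _*_; _^_; _≤_; _<_; _%_; _≡ᵇ_; ⌊_/2⌋; NonZero)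
open import Data.Nat.Logarithm using (⌊log₂_⌋; ⌈log₂_⌉)
open import Data.Nat.Properties using (_<?_)
open import Data.Product.Base using (∃-syntax; _×_; _,_; uncurry)
open import Data.Sum.Base using (_⊎_)
open import Data.Vec.Base as Vec using (Vec; []; _∷_)
open import Function.Base using (const; _∘_)
open import Function.Bundles using (_⇔_; _↔_)
open import Relation.Binary.PropositionalEquality.Core using (_≡_)
open import Relation.Nullary.Decidable.Core using (yes; no)
open import Relation.Unary using (Pred)

------------------------------------------------------------------------
-- Vocabularies and finite ordered structures

record Vocabulary : Set where
  field
    relArities : List ℕ
    #constants : ℕ
    funArities : List ℕ

open Vocabulary public

-- When this fails, |bin(A)| is a + b ⌈log n⌉ with a and b fixed by the
-- vocabulary, so that polylogarithmic in |bin(A)| is only poly-log-log in n,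
-- and bin(A) does not determine n.
HasPositiveArity : Vocabulary → Set
HasPositiveArity σ = Any (0 <_) (relArities σ ++ funArities σ)

-- The domain is Fin size, and ≤ is interpreted as its natural order.
record Structure (σ : Vocabulary) : Set where
  field
    size          : ℕ
    .{{nonEmpty}} : NonZero size
    relations     : All (λ r → Vec (Fin size) r → Bool) (relArities σ)
    constants     : Vec (Fin size) (#constants σ)
    functions     : All (λ k → Vec (Fin size) k → Fin size) (funArities σ)

open Structure public

------------------------------------------------------------------------
-- Binary representations, most significant bit first

testBit : ℕ → ℕ → Bool
testBit zero    m = m % 2 ≡ᵇ 1
testBit (suc i) m = testBit i ⌊ m /2⌋

toBits : (l : ℕ) → ℕ → Vec Bool l
toBits zero    m = []
toBits (suc l) m = testBit l m ∷ toBits l m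

-- No leading zeros, except that 0 is written as "0" (⌊log₂ 0 ⌋ is 0).
numeral : ℕ → List Bool
numeral m = Vec.toList (toBits (suc ⌊log₂ m ⌋) m)

fromBits : List Bool → ℕ
fromBits = List.foldl (λ m b → 2 * m + (if b then 1 else 0)) 0

------------------------------------------------------------------------
-- The encoding bin(A)

-- In lexicographic order.
tuples : (n r : ℕ) → List (Vec (Fin n) r)
tuples n zero    = [] ∷ []
tuples n (suc r) = cartesianProductWith _∷_ (allFin n) (tuples n r)

encodeRelation : ∀ {n r} → (Vec (Fin n) r → Bool) → List Bool
encodeRelation {n} {r} R = List.map R (tuples n r)

encodeElement : ∀ {n} → Fin n → Vec Bool ⌈log₂ n ⌉
encodeElement {n} a = toBits ⌈log₂ n ⌉ (toℕ a)

encodeFunction : ∀ {n k} → (Vec (Fin n) k → Fin n) → List Bool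
encodeFunction {n} f =
  concatMap (λ m → encodeRelation (λ as → Vec.lookup (encodeElement (f as)) m))
            (allFin ⌈log₂ n ⌉)

bin : ∀ {σ} → Structure σ → List Bool
bin A = concat (All.reduce encodeRelation (relations A))
     ++ concatMap (Vec.toList ∘ encodeElement) (Vec.toList (constants A))
     ++ concat (All.reduce encodeFunction (functions A))

------------------------------------------------------------------------
-- Tapes over the alphabet {0, 1, ⊔}

data Symbol : Set where
  bit   : Bool → Symbol
  blank : Symbol

data Move : Set where
  left right stay : Move

-- Cells beyond the end of the list are blank.
record Tape : Set where
  constructor mkTape
  field
    cells : List Symbol
    pos   : ℕ

open Tape public

symbolAt : List Symbol → ℕ → Symbol
symbolAt []       i       = blank
symbolAt (x ∷ xs) zero    = x
symbolAt (x ∷ xs) (suc i) = symbolAt xs i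

writeAt : List Symbol → ℕ → Symbol → List Symbol
writeAt []       zero    s = s ∷ []
writeAt []       (suc i) s = blank ∷ writeAt [] i s
writeAt (x ∷ xs) zero    s = s ∷ xs
writeAt (x ∷ xs) (suc i) s = x ∷ writeAt xs i s

blankTape : Tape
blankTape = mkTape [] 0

tapeOf : List Bool → Tape
tapeOf bs = mkTape (List.map bit bs) 0

scan : Tape → Symbol
scan t = symbolAt (cells t) (pos t)

-- A left move on the leftmost cell has no effect.
moveHead : Move → ℕ → ℕ
moveHead left  = pred
moveHead right = suc
moveHead stay  i = i

moveOn : Tape → Move → Tape
moveOn (mkTape xs i) d = mkTape xs (moveHead d i)

writeMove : Tape → Symbol × Move → Tape
writeMove (mkTape xs i) (s , d) = mkTape (writeAt xs i s) (moveHead d i)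

leadingBits : List Symbol → List Bool
leadingBits (bit b ∷ xs) = b ∷ leadingBits xs
leadingBits (blank ∷ xs) = []
leadingBits []           = []

numberOn : Tape → ℕ
numberOn t = fromBits (leadingBits (cells t))

------------------------------------------------------------------------
-- Deterministic computations

record Computation : Set₁ where
  field
    Config    : Set
    initial   : Config
    step      : Config → Maybe Config
    accepting : Config → Bool

  configAfter : ℕ → Maybe Config
  configAfter zero    = just initial
  configAfter (suc t) = configAfter t >>= step

  AcceptsAt : ℕ → Set
  AcceptsAt t = ∃[ c ] configAfter t ≡ just c × T (accepting c)

  HaltsAt : ℕ → Set
  HaltsAt t = ∃[ c ] configAfter t ≡ just c × step c ≡ nothing

  Accepts : Set
  Accepts = ∃[ t ] AcceptsAt t

-- In the last component, t bounds the number of steps made before accepting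
-- or rejecting (halting without having accepted), and the function taking A
-- to t is O(⌈log (measure A)⌉ ^ k).
DecidesInPolylog : ∀ {ℓ} {σ : Vocabulary} → (Structure σ → Computation) →
                   (measure : Structure σ → ℕ) → Pred (Structure σ) ℓ → Set ℓ
DecidesInPolylog run measure C =
  (∀ A → Accepts (run A) ⇔ C A) ×
  (∃[ k ] ∃[ c ] ∃[ n₀ ] ∀ A → ∃[ t ]
     (n₀ ≤ measure A → t ≤ c * ⌈log₂ measure A ⌉ ^ k) ×
     (AcceptsAt (run A) t ⊎ HaltsAt (run A) t))
  where open Computation

record MachineConfig (State Tapes : Set) : Set where
  constructor mkConfig
  field
    state : State
    tapes : Tapes

open MachineConfig public

------------------------------------------------------------------------
-- Random-access Turing machines

data InputSymbol : Set where
  symbol : Symbol → InputSymbol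
  ◁      : InputSymbol

inputAt : List Bool → ℕ → InputSymbol
inputAt []       i       = ◁
inputAt (b ∷ bs) zero    = symbol (bit b)
inputAt (b ∷ bs) (suc i) = inputAt bs i

record RandomAccessTM : Set₁ where
  field
    State       : Set
    finite      : ∃[ m ] (State ↔ Fin m)
    q₀          : State
    final       : State → Bool
    #work       : ℕ
    .{{work≥1}} : NonZero #work
    -- The address-tape comes first, followed by the work-tapes.
    δ           : State → InputSymbol → Vec Symbol (suc #work) →
                  Maybe (State × Vec (Symbol × Move) (suc #work))

  Config : Set
  Config = MachineConfig State (Vec Tape (suc #work))

  module _ (input : List Bool) where

    step : Config → Maybe Config
    step (mkConfig q ts) = δ q (inputAt input (numberOn (Vec.head ts))) (Vec.map scan ts) >>=
      λ (q′ , acts) → just (mkConfig q′ (Vec.zipWith writeMove ts acts))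

    computation : Computation
    computation = record
      { Config    = Config
      ; initial   = mkConfig q₀ (tapeOf (false ∷ []) ∷ Vec.replicate #work blankTape)
      ; step      = step
      ; accepting = final ∘ state
      }

------------------------------------------------------------------------
-- Direct-access Turing machines

elements : ∀ n {r} → Vec ℕ r → Maybe (Vec (Fin n) r)
elements n []       = just []
elements n (m ∷ ms) with m <? n
... | yes m<n = elements n ms >>= λ as → just (fromℕ< m<n ∷ as)
... | no  _   = nothing

-- Queries about numbers outside the domain are answered negatively.
query : ∀ {n r} → (Vec (Fin n) r → Bool) → Vec Tape r → Bool
query {n} R addr = maybe′ R false (elements n (Vec.map numberOn addr))

value : ∀ {n k} → (Vec (Fin n) k → Fin n) → Vec Tape k → List Symbol
value {n} f addr =
  maybe′ (λ as → List.map bit (numeral (toℕ (f as)))) [] (elements n (Vec.map numberOn addr))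

module _ (σ : Vocabulary) where

  -- An Address for each address-tape, a Value for each value-tape, etc. The
  -- first constant-tape is that of the size of the domain.
  record Tapes (#work : ℕ) (Address Value Constant Work : Set) : Set where
    constructor mkTapes
    field
      relAddress : All (Vec Address) (relArities σ)
      funAddress : All (Vec Address) (funArities σ)
      values     : All (const Value) (funArities σ)
      consts     : Vec Constant (suc (#constants σ))
      work       : Vec Work #work

  Contents Scanned Action : ℕ → Set
  Contents w = Tapes w Tape Tape Tape Tape
  Scanned w  = Tapes w Symbol Symbol Symbol Symbol
  -- Only moves are specified for the read-only tapes.
  Action w   = Tapes w (Symbol × Move) Move Move (Symbol × Move)

  record DirectAccessTM : Set₁ where
    field
      State       : Set
      finite      : ∃[ m ] (State ↔ Fin m)
      q₀          : State
      final       : State → Bool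
      #work       : ℕ
      .{{work≥1}} : NonZero #work
      δ           : State → Scanned #work → (answers : All (const Bool) (relArities σ)) →
                    Maybe (State × Action #work)

    Config : Set
    Config = MachineConfig State (Contents #work)

    scanAll : Contents #work → Scanned #work
    scanAll (mkTapes ras fas vs cs ws) =
      mkTapes (All.map (Vec.map scan) ras) (All.map (Vec.map scan) fas)
              (All.map scan vs) (Vec.map scan cs) (Vec.map scan ws)

    actAll : Contents #work → Action #work → Contents #work
    actAll (mkTapes ras fas vs cs ws) (mkTapes ras′ fas′ vs′ cs′ ws′) =
      mkTapes (All.zipWith (uncurry (Vec.zipWith writeMove)) (ras , ras′))
              (All.zipWith (uncurry (Vec.zipWith writeMove)) (fas , fas′))
              (All.zipWith (uncurry moveOn) (vs , vs′))
              (Vec.zipWith moveOn cs cs′)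
              (Vec.zipWith writeMove ws ws′)

    module _ (A : Structure σ) where

      answerQueries : All (Vec Tape) (relArities σ) → All (const Bool) (relArities σ)
      answerQueries ras = All.zipWith (uncurry query) (relations A , ras)

      -- Replaces the contents of the value-tapes, leaving the heads in place.
      updateValues : Contents #work → Contents #work
      updateValues ts = record ts
        { values = All.zipWith (λ (v , xs) → mkTape xs (pos v))
                     (Tapes.values ts ,
                      All.zipWith (uncurry value) (functions A , Tapes.funAddress ts)) }

      step : Config → Maybe Config
      step (mkConfig q ts) = δ q (scanAll ts) (answerQueries (Tapes.relAddress ts)) >>=
        λ (q′ , acts) → just (mkConfig q′ (updateValues (actAll ts acts)))

      initialTapes : Contents #work
      initialTapes = mkTapes
        (All.universal (λ r → Vec.replicate r blankTape) _)
        (All.universal (λ k → Vec.replicate k blankTape) _)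
        (All.universal (λ _ → blankTape) _)
        (Vec.map (tapeOf ∘ numeral) (size A ∷ Vec.map toℕ (constants A)))
        (Vec.replicate #work blankTape)

      computation : Computation
      computation = record
        { Config    = Config
        ; initial   = mkConfig q₀ initialTapes
        ; step      = step
        ; accepting = final ∘ state
        }

------------------------------------------------------------------------
-- Decidability in polylogarithmic time

RandomAccessPolylog : ∀ {ℓ} (σ : Vocabulary) → Pred (Structure σ) ℓ → Set (lsuc 0ℓ ⊔ ℓ)
RandomAccessPolylog σ C = ∃[ M ]
  DecidesInPolylog (λ A → RandomAccessTM.computation M (bin A)) (λ A → length (bin A)) C

DirectAccessPolylog : ∀ {ℓ} (σ : Vocabulary) → Pred (Structure σ) ℓ → Set (lsuc 0ℓ ⊔ ℓ)
DirectAccessPolylog σ C = ∃[ M ]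
  DecidesInPolylog (DirectAccessTM.computation {σ} M) size C

{-# OPTIONS --safe #-}

-- Both simulations are written in a small language of expressions over bit
-- lists whose loops run along a list and may lengthen their state by a constant
-- per pass only. Values then have length polynomial in that of the data, and
-- an expression compiles to a multi-tape program whose running time is
-- polynomial in the length of the data, hence polylogarithmic in the size of
-- the structure. Every list lives on a tape used as a stack. The compiler is
-- parametrised by the queries that the machine can make, so that it applies to
-- random-access and to direct-access machines.
--
-- A direct-access machine finds the i-th bit of bin(A) by locating the segment
-- that contains i and decomposing i minus the offset of the segment in base n.
-- A random-access machine answers a query by computing the address of the bits
-- of the answer. It first finds ⌈log n⌉ as the least l for which the encoding
-- of a structure of size 2 ^ l would be no shorter than the input, and then n
-- by binary search. This works because |bin(A)| is strictly monotone in n, as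
-- some symbol of the vocabulary has positive arity.

module Submission where

open import Defs
open import Data.Bool.Base using (Bool; true; false; T; if_then_else_; not; _∧_; _∨_; _xor_)
open import Data.Empty using (⊥; ⊥-elim)
open import Data.Fin.Base using (Fin; zero; suc; toℕ; fromℕ<; _↑ˡ_; _↑ʳ_; splitAt)
open import Data.Fin.Properties as Fin using (any?; toℕ-injective; toℕ<n; toℕ-fromℕ<; fromℕ<-toℕ; +↔⊎; *↔×; 1↔⊤; 0↔⊥)
open import Data.List.Base as List using (List; []; _∷_; _++_; length; concat; concatMap; cartesianProductWith; reverse; _ʳ++_; replicate)
open import Data.List.Properties using (length-++; length-drop; length-map; length-replicate; length-reverse; ʳ++-defn; reverse-involutive; unfold-reverse; ++-identityʳ; ++-assoc; reverse-++; length-ʳ++; ʳ++-ʳ++; foldl-++; map-tabulate; map-++; map-∘; concat-++)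
open import Data.List.Relation.Unary.All as All using (All; []; _∷_)
open import Data.List.Relation.Unary.Any using (Any; here; there)
open import Data.List.Relation.Unary.Any.Properties using (++⁻; ++⁺ʳ)
open import Data.Maybe.Base as Maybe using (Maybe; just; nothing; maybe′; _>>=_; is-just)
open import Data.Nat.Base
open import Data.Nat.DivMod using ([m+kn]%n≡m%n; m≡m%n+[m/n]*n; m%n<n; m<n*o⇒m/o<n)
open import Data.Nat.Induction using (<-rec)
open import Data.Nat.Logarithm
open import Data.Nat.Properties
open import Data.Nat.Tactic.RingSolver using (solve-∀)
open import Data.Product.Base using (Σ; ∃-syntax; _×_; _,_; proj₁; proj₂; uncurry)
open import Data.Product.Function.NonDependent.Propositional using (_×-↔_)
open import Data.Sum.Base using (_⊎_; inj₁; inj₂; [_,_]′)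
open import Data.Sum.Function.Propositional using (_⊎-↔_)
open import Data.Sum.Properties using (inj₁-injective; inj₂-injective)
open import Data.Unit.Base using (⊤; tt)
open import Data.Vec.Base as Vec using (Vec; []; _∷_)
open import Data.Vec.Properties as Vec using (lookup-replicate; tabulate-cong; lookup∘tabulate; lookup-map; lookup-zipWith)
open import Function.Base using (const; _∘_; id; case_of_)
open import Function.Bundles using (_⇔_; _↔_; Inverse; Equivalence; mk⇔; mk↔ₛ′)
open import Function.Properties.Inverse using (↔-refl; ↔-sym; ↔-trans)
open import Relation.Binary.Definitions using (DecidableEquality)
open import Relation.Binary.PropositionalEquality using (_≡_; _≢_; refl; sym; trans; cong; cong₂; subst; _≗_; module ≡-Reasoning)
open import Relation.Nullary.Decidable using (yes; no; does)
open import Relation.Nullary.Negation using (contradiction)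
open import Relation.Unary using (Pred)

-- The simulation is therefore a `Program`: an outer iteration, outside the language, whose test and
-- update are expressions. There is no clock; the time bound of the simulated machine enters the
-- analysis only. An update adds at most a constant to the maximal length, so after `T` iterations
-- the data have length linear in `T`, and each iteration costs a power of this length with an
-- exponent read off the syntax. The search for ⌈log n⌉ on a random-access machine is the first
-- phase of the same outer iteration, since at the start there is no list of that length to loop
-- along.
--
-- Stacks decide the order of bits. The bottom of an address stack is the leftmost cell of its tape,
-- hence the most significant bit; so lists have the least significant bit first, as addition wants
-- it. Numerals in replies come with the most significant bit first and are pushed as they arrive,
-- which reverses them into the same order.

-- A calculus of polynomial bounds

-- A record, so that `x` and `a` can be inferred from the type, which is not possible for an
-- inequality whose sides reduce.
record Pow≤ (N x a : ℕ) : Set where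
  constructor pow
  field unpow : x ≤ N ^ a
open Pow≤ public

module Powers (N : ℕ) (2≤N : 2 ≤ N) where

  private instance
    N≢0 : NonZero N
    N≢0 = >-nonZero (≤-trans (s≤s z≤n) 2≤N)

  infix 4 _⊑_
  _⊑_ : ℕ → ℕ → Set
  _⊑_ = Pow≤ N

  ≤⊑ : ∀ {x y a} → x ≤ y → y ⊑ a → x ⊑ a
  ≤⊑ x≤y (pow y≤) = pow (≤-trans x≤y y≤)

  -- Every further factor `N` at least doubles the power. Like all exponents here, this one is
  -- crude; what matters is that it does not depend on `N`.
  const⊑ : ∀ c → c ⊑ c
  const⊑ zero    = pow z≤n
  const⊑ (suc c) = pow (begin
    suc c           ≤⟨ +-mono-≤ (m^n>0 N c) (unpow (const⊑ c)) ⟩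
    N ^ c + N ^ c   ≡⟨ cong (N ^ c +_) (+-identityʳ _) ⟨
    2 * N ^ c       ≤⟨ *-monoˡ-≤ (N ^ c) 2≤N ⟩
    N * N ^ c       ∎)
    where open ≤-Reasoning

  raise⊑ : ∀ {x a b} → a ≤ b → x ⊑ a → x ⊑ b
  raise⊑ a≤b (pow x≤) = pow (≤-trans x≤ (^-monoʳ-≤ N a≤b))

  +⊑ : ∀ {x y a b} → x ⊑ a → y ⊑ b → x + y ⊑ suc (a + b)
  +⊑ {x} {y} {a} {b} x⊑a y⊑b = pow (begin
    x + y                       ≤⟨ +-mono-≤ (unpow (raise⊑ (m≤m+n a b) x⊑a)) (unpow (raise⊑ (m≤n+m b a) y⊑b)) ⟩
    N ^ (a + b) + N ^ (a + b)   ≡⟨ cong (N ^ (a + b) +_) (+-identityʳ _) ⟨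
    2 * N ^ (a + b)             ≤⟨ *-monoˡ-≤ (N ^ (a + b)) 2≤N ⟩
    N ^ suc (a + b)             ∎)
    where open ≤-Reasoning

  *⊑ : ∀ {x y a b} → x ⊑ a → y ⊑ b → x * y ⊑ a + b
  *⊑ {a = a} {b} (pow x≤) (pow y≤) = pow (≤-trans (*-mono-≤ x≤ y≤) (≤-reflexive (sym (^-distribˡ-+-* N a b))))

  suc⊑ : ∀ {x a} → x ⊑ a → suc x ⊑ suc (suc a)
  suc⊑ = +⊑ (const⊑ 1)

  base⊑ : N ⊑ 1
  base⊑ = pow (≤-reflexive (sym (^-identityʳ N)))

  ^⊑ : ∀ {x a b} → Pow≤ (N ^ a) x b → x ⊑ a * b
  ^⊑ {a = a} {b} (pow x≤) = pow (≤-trans x≤ (≤-reflexive (^-*-assoc N a b)))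

  N≤N^ : ∀ a → N ≤ N ^ suc a
  N≤N^ a = ≤-trans (≤-reflexive (sym (*-identityʳ N))) (*-monoʳ-≤ N (m^n>0 N a))

  2≤N^ : ∀ a → 2 ≤ N ^ suc a
  2≤N^ a = ≤-trans 2≤N (N≤N^ a)

total : ∀ {j} → (Fin j → ℕ) → ℕ
total {zero}  f = 0
total {suc j} f = f zero + total (f ∘ suc)

≤total : ∀ {j} (f : Fin j → ℕ) i → f i ≤ total f
≤total f zero    = m≤m+n _ _
≤total f (suc i) = ≤-trans (≤total (f ∘ suc) i) (m≤n+m _ (f zero))

-- Expressions over bit lists and the size of their values

iterate : ∀ {X : Set} → (Bool → X → X) → List Bool → X → X
iterate f []       x = x
iterate f (b ∷ bs) x = iterate f bs (f b x)

Env : ℕ → Set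
Env k = Fin k → List Bool

Bounded : ∀ {k} → ℕ → Env k → Set
Bounded N ρ = ∀ i → length (ρ i) ≤ N

module Language (Op : Set) (arity : Op → ℕ) where

  Semantics : Set
  Semantics = (o : Op) → Vec (List Bool) (arity o) → List Bool

  -- Mutual with `eval`, because a loop carries a proof about the values of its own body.
  data Exp : ℕ → Set
  eval : Semantics → ∀ {k} → Exp k → Env k → List Bool

  -- The state of a loop is private to its body. The last-but-one argument
  -- ensures that values grow polynomially only: one pass through the body
  -- adds at most a constant to the maximal length.
  data Exp where
    var  : ∀ {k} → Fin k → Exp k
    nil  : ∀ {k} → Exp k
    cons : ∀ {k} → Bool → Exp k → Exp k
    tail : ∀ {k} → Exp k → Exp k
    test : ∀ {k} → Exp k → (Maybe Bool → Exp k) → Exp k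
    ask  : ∀ {k} (o : Op) → (Fin (arity o) → Exp k) → Exp k
    loop : ∀ {k j} → Exp k → (Fin j → Exp k) → (body : Bool → Fin j → Exp j) →
           (∃[ c ] ∀ (S : Semantics) b (ρ : Env j) N → Bounded N ρ →
              ∀ i → length (eval S (body b i) ρ) ≤ c + N) →
           Exp j → Exp k

  eval S (var i)    ρ = ρ i
  eval S nil        ρ = []
  eval S (cons b e) ρ = b ∷ eval S e ρ
  eval S (tail e)   ρ = List.drop 1 (eval S e ρ)
  eval S (test e k) ρ = eval S (k (List.head (eval S e ρ))) ρ
  eval S (ask o es) ρ = S o (Vec.tabulate (λ i → eval S (es i) ρ))
  eval S (loop e is body _ r) ρ =
    eval S r (iterate (λ b st i → eval S (body b i) st) (eval S e ρ) (λ i → eval S (is i) ρ))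

  evals : Semantics → ∀ {k j} → (Fin j → Exp k) → Env k → Env j
  evals S es ρ i = eval S (es i) ρ

  Growth : ∀ {j k} → (Fin j → Exp k) → Set
  Growth {j} {k} es = ∃[ c ] ∀ (S : Semantics) (ρ : Env k) N → Bounded N ρ → Bounded (c + N) (evals S es ρ)

  -- Additive growth per pass sums up to a multiple of the number of passes; growth by a constant
  -- factor would be exponential.
  iterate-bounded : ∀ {j} (body : Bool → Fin j → Exp j) (S : Semantics) c →
    (∀ b (ρ : Env j) N → Bounded N ρ → ∀ i → length (eval S (body b i) ρ) ≤ c + N) →
    ∀ xs st N → Bounded N st → Bounded (length xs * c + N) (iterate (λ b st → evals S (body b) st) xs st)
  iterate-bounded body S c g []       st N h = h
  iterate-bounded body S c g (x ∷ xs) st N h i = begin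
    length (iterate (λ b st → evals S (body b) st) xs (evals S (body x) st) i)
      ≤⟨ iterate-bounded body S c g xs _ (c + N) (g x st N h) i ⟩
    length xs * c + (c + N)  ≡⟨ solve-∀′ (length xs * c) c N ⟩
    c + length xs * c + N    ∎
    where
    open ≤-Reasoning
    solve-∀′ : ∀ a b c → a + (b + c) ≡ b + a + c
    solve-∀′ = solve-∀

  -- Exponents x such that the value has length at most N ^ x whenever N ≥ 2
  -- bounds the lengths in the environment and of all oracle answers.
  deg : ∀ {k} → Exp k → ℕ
  stateDeg : ∀ {k j} → Exp k → (Fin j → Exp k) → ℕ → ℕ
  deg (var i)    = 1
  deg nil        = 0
  deg (cons b e) = 2 + deg e
  deg (tail e)   = deg e
  deg (test e k) = deg (k nothing) + (deg (k (just false)) + deg (k (just true)))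
  deg (ask o es) = 1
  deg (loop e is body (c , _) r) = stateDeg e is c * deg r
  stateDeg e is c = suc ((deg e + c) + total (λ i → deg (is i)))

  record Bounding (S : Semantics) (N : ℕ) : Set where
    field
      2≤N     : 2 ≤ N
      answers : ∀ o xs → length (S o xs) ≤ N
  open Bounding public

  raise : ∀ {S N} a → Bounding S N → Bounding S (N ^ suc a)
  raise {N = N} a B .2≤N = Powers.2≤N^ N (B .2≤N) a
  raise {N = N} a B .answers o xs = ≤-trans (B .answers o xs) (Powers.N≤N^ N (B .2≤N) a)

  drop1≤ : ∀ (xs : List Bool) → length (List.drop 1 xs) ≤ length xs
  drop1≤ []       = z≤n
  drop1≤ (_ ∷ xs) = n≤1+n _

  -- The result of a loop is evaluated in the final state alone, whose lists have length at most
  -- `N ^ stateDeg`. This power becomes the new base, so exponents multiply. As `stateDeg` is a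
  -- successor, `raise` applies: the new base is at least `N` and still bounds the oracle answers.
  size≤ : ∀ {S N} (B : Bounding S N) {k} (e : Exp k) (ρ : Env k) → Bounded N ρ → Pow≤ N (length (eval S e ρ)) (deg e)
  -- Stated for every list no longer than the value of `e`, because the analysis of running time
  -- needs the bound after each pass and not only after the last.
  state≤ : ∀ {S N} (B : Bounding S N) {k j} (e : Exp k) (is : Fin j → Exp k) (body : Bool → Fin j → Exp j) c →
    (∀ b (ρ : Env j) N → Bounded N ρ → ∀ i → length (eval S (body b i) ρ) ≤ c + N) →
    ∀ xs (ρ : Env k) → length xs ≤ length (eval S e ρ) → Bounded N ρ →
    Bounded (N ^ stateDeg e is c) (iterate (λ b st → evals S (body b) st) xs (evals S is ρ))
  size≤ {S} {N} B e₀ ρ h = go e₀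
    where
    open Powers N (B .2≤N)
    go : ∀ e → length (eval S e ρ) ⊑ deg e
    go (var i)    = ≤⊑ (h i) base⊑
    go nil        = pow z≤n
    go (cons b e) = suc⊑ (size≤ B e ρ h)
    go (tail e)   = ≤⊑ (drop1≤ (eval S e ρ)) (size≤ B e ρ h)
    go (test e k) with List.head (eval S e ρ)
    ... | nothing    = raise⊑ (m≤m+n _ _) (size≤ B (k nothing) ρ h)
    ... | just false = raise⊑ (≤-trans (m≤m+n _ _) (m≤n+m _ (deg (k nothing)))) (size≤ B (k (just false)) ρ h)
    ... | just true  = raise⊑ (≤-trans (m≤n+m _ (deg (k (just false)))) (m≤n+m _ (deg (k nothing)))) (size≤ B (k (just true)) ρ h)
    go (ask o es) = ≤⊑ (B .answers o _) base⊑
    go (loop e is body (c , g) r) =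
      ^⊑ {a = stateDeg e is c} (size≤ (raise ((deg e + c) + total (λ i → deg (is i))) B) r _ (state≤ B e is body c (g S) (eval S e ρ) ρ ≤-refl h))
  state≤ {S} {N} B e is body c g xs ρ xs≤ h i =
    unpow (≤⊑ (iterate-bounded body S c g xs _ (N ^ total (λ i → deg (is i)))
                (λ i → unpow (raise⊑ (≤total (λ i → deg (is i)) i) (size≤ B (is i) ρ h))) i)
              (+⊑ (*⊑ (≤⊑ xs≤ (size≤ B e ρ h)) (const⊑ c)) (pow ≤-refl)))
    where open Powers N (B .2≤N)

-- Oracles that can be queried about the contents of special stacks: addr o i
-- holds the i-th argument of o, and the size of mirror o (if it exists) is the
-- position of a head that reads the reply sequentially.
record Signature : Set₁ where
  field
    Special        : Set
    _≟ˢ_           : DecidableEquality Special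
    Op             : Set
    arity          : Op → ℕ
    addr           : ∀ o → Fin (arity o) → Special
    addr-injective : ∀ o {i j} → addr o i ≡ addr o j → i ≡ j
    mirror         : Op → Maybe Special
    mirror≢addr    : ∀ o {a} → mirror o ≡ just a → ∀ i → a ≢ addr o i

-- Commands on stacks and their running time

module Commands (Sig : Signature) where

  open Signature Sig
  open Language Op arity

  data Reg : Set where
    special : Special → Reg
    local   : ℕ → Reg

  special-injective : ∀ {a b} → special a ≡ special b → a ≡ b
  special-injective refl = refl

  local-injective : ∀ {m n} → local m ≡ local n → m ≡ n
  local-injective refl = refl

  infix 4 _≟ᴿ_
  _≟ᴿ_ : DecidableEquality Reg
  special a ≟ᴿ special b with a ≟ˢ b
  ... | yes refl = yes refl
  ... | no a≢b   = no (a≢b ∘ special-injective)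
  special a ≟ᴿ local n   = no λ ()
  local m   ≟ᴿ special b = no λ ()
  local m   ≟ᴿ local n with m ≟ n
  ... | yes refl = yes refl
  ... | no m≢n   = no (m≢n ∘ local-injective)

  Store : Set
  Store = Reg → List Bool

  infixl 9 _[_≔_]
  _[_≔_] : Store → Reg → List Bool → Store
  (s [ r ≔ x ]) r′ = if does (r ≟ᴿ r′) then x else s r′

  upd-same : ∀ s r {x} → (s [ r ≔ x ]) r ≡ x
  upd-same s r with r ≟ᴿ r
  ... | yes _  = refl
  ... | no r≢r = contradiction refl r≢r

  upd-other : ∀ s {r r′ x} → r ≢ r′ → (s [ r ≔ x ]) r′ ≡ s r′
  upd-other s {r} {r′} r≢r′ with r ≟ᴿ r′
  ... | yes r≡r′ = contradiction r≡r′ r≢r′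
  ... | no _     = refl

  upd-elim : ∀ s r {x} (u : Store) → x ≡ u r → (∀ r′ → r ≢ r′ → s r′ ≡ u r′) → s [ r ≔ x ] ≗ u
  upd-elim s r u same other r′ with r ≟ᴿ r′
  ... | yes refl = same
  ... | no r≢r′  = other r′ r≢r′

  upd-cong : ∀ {s u} r {x y} → x ≡ y → s ≗ u → s [ r ≔ x ] ≗ u [ r ≔ y ]
  upd-cong r refl h r′ with r ≟ᴿ r′
  ... | yes _ = refl
  ... | no _  = h r′

  data Source : Set where
    popped : Reg → Source
    asked  : Op → Source

  infixr 5 _⨾_
  data Cmd : Set where
    skip   : Cmd
    push   : Reg → Bool → Cmd
    _⨾_    : Cmd → Cmd → Cmd
    -- Continues with the response-dependent command and then, depending on
    -- the response, either exits or repeats the whole command.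
    branch : Source → (Maybe Bool → Cmd) → (Maybe Bool → Bool) → Cmd

  Streams : Set
  Streams = Semantics

  addresses : Store → ∀ o → Vec (List Bool) (arity o)
  addresses s o = Vec.tabulate (λ i → s (special (addr o i)))

  position : Store → Op → ℕ
  position s o = maybe′ (λ a → length (s (special a))) 0 (mirror o)

  answer : Streams → Store → Op → Maybe Bool
  answer R s o = List.head (List.drop (position s o) (R o (addresses s o)))

  data Pull (R : Streams) (s : Store) : Source → Maybe Bool → Store → Set where
    empty : ∀ {r} → s r ≡ [] → Pull R s (popped r) nothing s
    top   : ∀ {r b xs} → s r ≡ b ∷ xs → Pull R s (popped r) (just b) (s [ r ≔ xs ])
    reply : ∀ {o} → Pull R s (asked o) (answer R s o) s

  -- Stores are functions, for which only pointwise equality can be proved; `conv` closes the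
  -- relation under it and lets times be increased. A branch is charged two steps: one moves the
  -- head to the top of the stack, the other reacts to the scanned symbol.
  data Exec (R : Streams) : Cmd → Store → Store → ℕ → Set where
    skip : ∀ {s} → Exec R skip s s 1
    push : ∀ {s r b} → Exec R (push r b) s (s [ r ≔ b ∷ s r ]) 1
    _⨾_  : ∀ {c d s u v t t′} → Exec R c s u t → Exec R d u v t′ → Exec R (c ⨾ d) s v (t + t′)
    exit : ∀ {src k again h s u v t} → Pull R s src h u → again h ≡ false → Exec R (k h) u v t →
           Exec R (branch src k again) s v (2 + t)
    next : ∀ {src k again h s u v w t t′} → Pull R s src h u → again h ≡ true → Exec R (k h) u v t →
           Exec R (branch src k again) v w t′ → Exec R (branch src k again) s w (2 + t + t′)
    conv : ∀ {c s s′ u u′ t t′} → s ≗ s′ → u ≗ u′ → t ≤ t′ → Exec R c s′ u t → Exec R c s u′ t′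

  convˡ : ∀ {R c s s′ u t} → s ≗ s′ → Exec R c s′ u t → Exec R c s u t
  convˡ h = conv h (λ _ → refl) ≤-refl

  convʳ : ∀ {R c s u u′ t} → u ≗ u′ → Exec R c s u t → Exec R c s u′ t
  convʳ h = conv (λ _ → refl) h ≤-refl

  slower : ∀ {R c s u t t′} → t ≤ t′ → Exec R c s u t → Exec R c s u t′
  slower = conv (λ _ → refl) (λ _ → refl)

  pour : Reg → (Bool → Cmd) → Cmd
  pour r f = branch (popped r) (maybe′ f skip) is-just

  clear : Reg → Cmd
  clear r = pour r (λ _ → skip)

  -- A stack can be read only by emptying it, which reverses it. The second transfer restores the
  -- order and the stack `a` itself.
  copy : Reg → Reg → Reg → Cmd
  copy a b t = pour a (push t) ⨾ pour t (λ x → push a x ⨾ push b x)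

  clear-exec : ∀ {R} a xs s → s a ≡ xs → Exec R (clear a) s (s [ a ≔ [] ]) (3 * length xs + 3)
  clear-exec a [] s eq = convʳ final (exit (empty eq) refl skip)
    where
    final : s ≗ s [ a ≔ [] ]
    final r with a ≟ᴿ r
    ... | yes refl = eq
    ... | no _     = refl
  clear-exec a (x ∷ xs) s eq =
    conv (λ _ → refl) final (≤-reflexive (time (length xs)))
      (next (top eq) refl skip (clear-exec a xs (s [ a ≔ xs ]) (upd-same s a)))
    where
    final : (s [ a ≔ xs ]) [ a ≔ [] ] ≗ s [ a ≔ [] ]
    final r with a ≟ᴿ r
    ... | yes _ = refl
    ... | no _  = refl
    time : ∀ n → 2 + 1 + (3 * n + 3) ≡ 3 * suc n + 3
    time = solve-∀

  move-exec : ∀ {R} a t → a ≢ t → ∀ xs s → s a ≡ xs →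
    Exec R (pour a (push t)) s ((s [ a ≔ [] ]) [ t ≔ xs ʳ++ s t ]) (3 * length xs + 3)
  move-exec a t a≢t [] s eq = convʳ final (exit (empty eq) refl skip)
    where
    final : s ≗ (s [ a ≔ [] ]) [ t ≔ s t ]
    final r with t ≟ᴿ r | a ≟ᴿ r
    ... | yes refl | _        = refl
    ... | no _     | yes refl = eq
    ... | no _     | no _     = refl
  move-exec a t a≢t (x ∷ xs) s eq =
    conv (λ _ → refl) final (≤-reflexive (time (length xs)))
      (next (top eq) refl push (move-exec a t a≢t xs s₂ (trans (upd-other s₁ (a≢t ∘ sym)) (upd-same s a))))
    where
    s₁ = s [ a ≔ xs ]
    s₂ = s₁ [ t ≔ x ∷ s₁ t ]
    time : ∀ n → 2 + 1 + (3 * n + 3) ≡ 3 * suc n + 3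
    time = solve-∀
    final : (s₂ [ a ≔ [] ]) [ t ≔ xs ʳ++ s₂ t ] ≗ (s [ a ≔ [] ]) [ t ≔ xs ʳ++ (x ∷ s t) ]
    -- All tests on which the nested updates depend are abstracted together; the first two clauses
    -- discard the impossible outcomes.
    final r with a ≟ᴿ r | t ≟ᴿ r | t ≟ᴿ t | a ≟ᴿ t
    ... | _     | _     | _      | yes a≡t = contradiction a≡t a≢t
    ... | _     | _     | no t≢t | _       = contradiction refl t≢t
    ... | _     | yes _ | yes _  | no _    = refl
    ... | yes _ | no _  | yes _  | no _    = refl
    ... | no _  | no _  | yes _  | no _    = refl

  unload-exec : ∀ {R} t a b → t ≢ a → t ≢ b → a ≢ b → ∀ xs s → s t ≡ xs →
    Exec R (pour t (λ x → push a x ⨾ push b x)) s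
      (((s [ t ≔ [] ]) [ a ≔ xs ʳ++ s a ]) [ b ≔ xs ʳ++ s b ]) (4 * length xs + 3)
  unload-exec t a b t≢a t≢b a≢b [] s eq = convʳ final (exit (empty eq) refl skip)
    where
    final : s ≗ ((s [ t ≔ [] ]) [ a ≔ s a ]) [ b ≔ s b ]
    final r with b ≟ᴿ r | a ≟ᴿ r | t ≟ᴿ r
    ... | yes refl | _        | _        = refl
    ... | no _     | yes refl | _        = refl
    ... | no _     | no _     | yes refl = eq
    ... | no _     | no _     | no _     = refl
  unload-exec t a b t≢a t≢b a≢b (x ∷ xs) s eq =
    conv (λ _ → refl) final (≤-reflexive (time (length xs)))
      (next (top eq) refl (push ⨾ push) (unload-exec t a b t≢a t≢b a≢b xs s₃
        (trans (upd-other s₂ (t≢b ∘ sym)) (trans (upd-other s₁ (t≢a ∘ sym)) (upd-same s t)))))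
    where
    s₁ = s [ t ≔ xs ]
    s₂ = s₁ [ a ≔ x ∷ s₁ a ]
    s₃ = s₂ [ b ≔ x ∷ s₂ b ]
    time : ∀ n → 2 + (1 + 1) + (4 * n + 3) ≡ 4 * suc n + 3
    time = solve-∀
    final : ((s₃ [ t ≔ [] ]) [ a ≔ xs ʳ++ s₃ a ]) [ b ≔ xs ʳ++ s₃ b ]
          ≗ ((s [ t ≔ [] ]) [ a ≔ xs ʳ++ (x ∷ s a) ]) [ b ≔ xs ʳ++ (x ∷ s b) ]
    final r with b ≟ᴿ r | a ≟ᴿ r | t ≟ᴿ r | b ≟ᴿ b | a ≟ᴿ a | b ≟ᴿ a | a ≟ᴿ b | t ≟ᴿ a | t ≟ᴿ b
    ... | _ | _ | _ | no ¬eq | _ | _ | _ | _ | _ = contradiction refl ¬eq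
    ... | _ | _ | _ | _ | no ¬eq | _ | _ | _ | _ = contradiction refl ¬eq
    ... | _ | _ | _ | _ | _ | yes eq | _ | _ | _ = contradiction (sym eq) a≢b
    ... | _ | _ | _ | _ | _ | _ | yes eq | _ | _ = contradiction eq a≢b
    ... | _ | _ | _ | _ | _ | _ | _ | yes eq | _ = contradiction eq t≢a
    ... | _ | _ | _ | _ | _ | _ | _ | _ | yes eq = contradiction eq t≢b
    ... | yes _ | _     | _     | yes _ | yes _ | no _ | no _ | no _ | no _ = refl
    ... | no _  | yes _ | _     | yes _ | yes _ | no _ | no _ | no _ | no _ = refl
    ... | no _  | no _  | yes _ | yes _ | yes _ | no _ | no _ | no _ | no _ = refl
    ... | no _  | no _  | no _  | yes _ | yes _ | no _ | no _ | no _ | no _ = refl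

  ʳ++-[] : ∀ (xs : List Bool) → (xs ʳ++ []) ʳ++ [] ≡ xs
  ʳ++-[] xs = trans (ʳ++-ʳ++ xs) (++-identityʳ xs)

  length-ʳ++-[] : ∀ (xs : List Bool) → length (xs ʳ++ []) ≡ length xs
  length-ʳ++-[] xs = trans (length-ʳ++ xs) (+-identityʳ _)

  copy-exec : ∀ {R} a b t → a ≢ b → a ≢ t → b ≢ t → ∀ s → s b ≡ [] → s t ≡ [] →
    Exec R (copy a b t) s (s [ b ≔ s a ]) (7 * length (s a) + 6)
  copy-exec {R} a b t a≢b a≢t b≢t s sb st =
    conv (λ _ → refl) final (≤-reflexive time)
      (move-exec a t a≢t (s a) s refl ⨾
       unload-exec t a b (a≢t ∘ sym) (b≢t ∘ sym) a≢b (s a ʳ++ []) s₁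
         (trans (upd-same (s [ a ≔ [] ]) t) (cong (s a ʳ++_) st)))
    where
    s₁ = (s [ a ≔ [] ]) [ t ≔ s a ʳ++ s t ]
    time : 3 * length (s a) + 3 + (4 * length (s a ʳ++ []) + 3) ≡ 7 * length (s a) + 6
    time rewrite length-ʳ++-[] (s a) = arith (length (s a))
      where
      arith : ∀ n → 3 * n + 3 + (4 * n + 3) ≡ 7 * n + 6
      arith = solve-∀
    final : ((s₁ [ t ≔ [] ]) [ a ≔ (s a ʳ++ []) ʳ++ s₁ a ]) [ b ≔ (s a ʳ++ []) ʳ++ s₁ b ] ≗ s [ b ≔ s a ]
    final r with b ≟ᴿ r | a ≟ᴿ r | t ≟ᴿ r | a ≟ᴿ a | t ≟ᴿ a | a ≟ᴿ b | t ≟ᴿ b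
    ... | _ | _ | _ | no ¬eq | _ | _ | _ = contradiction refl ¬eq
    ... | _ | _ | _ | _ | yes eq | _ | _ = contradiction (sym eq) a≢t
    ... | _ | _ | _ | _ | _ | yes eq | _ = contradiction eq a≢b
    ... | _ | _ | _ | _ | _ | _ | yes eq = contradiction (sym eq) b≢t
    ... | yes _ | _        | _        | yes _ | no _ | no _ | no _ rewrite sb = ʳ++-[] (s a)
    ... | no _  | yes refl | _        | yes _ | no _ | no _ | no _ = ʳ++-[] (s a)
    ... | no _  | no _     | yes refl | yes _ | no _ | no _ | no _ = sym st
    ... | no _  | no _     | no _     | yes _ | no _ | no _ | no _ = refl

  copy-exec′ : ∀ {R} a b t → a ≢ b → a ≢ t → b ≢ t → ∀ s x → s a ≡ x → s b ≡ [] → s t ≡ [] →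
    Exec R (copy a b t) s (s [ b ≔ x ]) (7 * length x + 6)
  copy-exec′ a b t a≢b a≢t b≢t s x refl = copy-exec a b t a≢b a≢t b≢t s

  each : ∀ {j} → (Fin j → Cmd) → Cmd
  each {zero}  f = skip
  each {suc j} f = f zero ⨾ each (f ∘ suc)

  fill : ∀ {j} → Store → (Fin j → Reg) → (Fin j → List Bool) → Store
  fill {zero}  s rs v = s
  fill {suc j} s rs v = fill (s [ rs zero ≔ v zero ]) (rs ∘ suc) (v ∘ suc)

  Distinct : ∀ {j} → (Fin j → Reg) → Set
  Distinct rs = ∀ {i i′} → rs i ≡ rs i′ → i ≡ i′

  fill-out : ∀ {j} s (rs : Fin j → Reg) v r → (∀ i → rs i ≢ r) → fill s rs v r ≡ s r
  fill-out {zero}  s rs v r h = refl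
  fill-out {suc j} s rs v r h = trans (fill-out _ (rs ∘ suc) (v ∘ suc) r (h ∘ suc)) (upd-other s (h zero))

  fill-at : ∀ {j} s (rs : Fin j → Reg) v → Distinct rs → ∀ i → fill s rs v (rs i) ≡ v i
  fill-at {suc j} s rs v d zero    =
    trans (fill-out _ (rs ∘ suc) (v ∘ suc) (rs zero) (λ i eq → case d eq of λ ())) (upd-same s (rs zero))
  fill-at {suc j} s rs v d (suc i) = fill-at _ (rs ∘ suc) (v ∘ suc) (λ eq → Fin.suc-injective (d eq)) i

  -- The standard way below to identify the final store of a block operation: the filled registers
  -- and all others are compared separately.
  fill-unique : ∀ {j} s (rs : Fin j → Reg) v (u : Store) → Distinct rs →
    (∀ i → v i ≡ u (rs i)) → (∀ r → (∀ i → rs i ≢ r) → s r ≡ u r) → fill s rs v ≗ u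
  fill-unique s rs v u d same other r with any? (λ i → rs i ≟ᴿ r)
  ... | yes (i , refl) = trans (fill-at s rs v d i) (same i)
  ... | no ∄           = trans (fill-out s rs v r (λ i eq → ∄ (i , eq))) (other r (λ i eq → ∄ (i , eq)))

  -- When the i-th command starts, earlier targets have changed already. So it has to work in every
  -- store that agrees with `s` off the targets and at its own target.
  each-exec : ∀ {R j} (f : Fin j → Cmd) (rs : Fin j → Reg) v t s → Distinct rs →
    (∀ i u → (∀ r → (∀ i → rs i ≢ r) → u r ≡ s r) → u (rs i) ≡ s (rs i) →
      Exec R (f i) u (u [ rs i ≔ v i ]) t) →
    Exec R (each f) s (fill s rs v) (j * t + 1)
  each-exec {j = zero}  f rs v t s d h = skip
  each-exec {j = suc j} f rs v t s d h =
    slower (≤-reflexive (sym (+-assoc t (j * t) 1)))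
      (h zero s (λ _ _ → refl) refl ⨾
       each-exec (f ∘ suc) (rs ∘ suc) (v ∘ suc) t (s [ rs zero ≔ v zero ])
         (λ eq → Fin.suc-injective (d eq))
         (λ i u out at → h (suc i) u
           (λ r r∉ → trans (out r (r∉ ∘ suc)) (upd-other s (r∉ zero)))
           (trans at (upd-other s (λ eq → case d eq of λ ())))))

  block : ∀ {j} → ℕ → Fin j → Reg
  block a i = local (a + toℕ i)

  block-distinct : ∀ {j} a → Distinct (block {j} a)
  block-distinct a eq = toℕ-injective (+-cancelˡ-≡ a _ _ (local-injective eq))

  block-outside : ∀ {j} a m → (m < a ⊎ a + j ≤ m) → ∀ (i : Fin j) → block a i ≢ local m
  block-outside a m (inj₁ m<a) i refl = <⇒≱ m<a (m≤m+n a _)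
  block-outside a m (inj₂ a+j≤m) i refl = <⇒≱ (+-monoʳ-< a (toℕ<n i)) a+j≤m

  local≢ : ∀ {m n} → m ≢ n → local m ≢ local n
  local≢ m≢n = m≢n ∘ local-injective

  -- Compilation of expressions into commands

  -- A reply without mirror has at most one bit, so one query reads it. Otherwise each push onto the
  -- mirror advances the reading head by one cell, and clearing the mirror takes the head back to
  -- the start.
  readWith : Maybe Special → Op → ℕ → Cmd
  readWith nothing  o out = branch (asked o) (maybe′ (push (local out)) skip) (λ _ → false)
  readWith (just a) o out =
    branch (asked o) (maybe′ (λ b → push (local out) b ⨾ push (special a) true) skip) is-just ⨾ clear (special a)

  read : Op → ℕ → Cmd
  read o = readWith (mirror o) o

  -- The registers from the last argument on are available as scratch space.
  comp   : ∀ {k} → Exp k → (Fin k → ℕ) → ℕ → ℕ → Cmd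
  assign : ∀ {j} → (Fin j → Exp j) → ℕ → Cmd
  comp (var i)    env out n = copy (local (env i)) (local out) (local n)
  comp nil        env out n = skip
  comp (cons b e) env out n = comp e env out n ⨾ push (local out) b
  comp (tail e)   env out n = comp e env out n ⨾ branch (popped (local out)) (λ _ → skip) (λ _ → false)
  comp (test e k) env out n =
    comp e env n (suc n) ⨾
    branch (popped (local n)) (λ h → clear (local n) ⨾ comp (k h) env out n) (λ _ → false)
  -- All arguments are computed in local registers before any is copied to its address: an argument
  -- may itself contain queries, which rely on empty special registers.
  comp (ask o es) env out n =
    each (λ i → comp (es i) env (n + toℕ i) (n + arity o)) ⨾
    each (λ i → copy (block n i) (special (addr o i)) (local (n + arity o))) ⨾
    read o out ⨾
    each (λ i → clear (special (addr o i))) ⨾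
    each {arity o} (λ i → clear (block n i))
  comp (loop {j = j} e is body _ r) env out n =
    comp e env n (suc n) ⨾
    each (λ i → comp (is i) env (suc n + toℕ i) (suc n + j)) ⨾
    pour (local n) (λ b → assign (body b) (suc n)) ⨾
    comp r (λ i → suc n + toℕ i) out (suc n + j) ⨾
    each {j} (λ i → clear (block (suc n) i))
  -- The assignment is simultaneous: each new value may depend on all old ones, so the new values go
  -- to a second block first.
  assign {j} es a =
    each (λ i → comp (es i) (λ i → a + toℕ i) (a + j + toℕ i) (a + j + j)) ⨾
    each {j} (λ i → clear (block a i)) ⨾
    each {j} (λ i → copy (block (a + j) i) (block a i) (local (a + j + j))) ⨾
    each {j} (λ i → clear (block (a + j) i))

  infixr 6 _⊞_
  -- The exponent that `+⊑` yields for a sum; exponents of products are added, those of nested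
  -- powers multiplied.
  _⊞_ : ℕ → ℕ → ℕ
  a ⊞ b = suc (a + b)

  clearDeg copyDeg readDeg : ℕ → ℕ
  clearDeg a = (3 + a) ⊞ 3
  copyDeg a = (7 + a) ⊞ 6
  readDeg a = ((4 + a) ⊞ 3) ⊞ clearDeg a

  eachDeg : ℕ → ℕ → ℕ
  eachDeg j a = (j + a) ⊞ 1

  -- Follows the shape of `comp` piece by piece, so that the exponents obtained in `comp-exec` match
  -- definitionally. In a loop the state is bounded by `N ^ z`, which is the base in which the times
  -- of the body and of the result are measured; hence the factors `z`.
  timeDeg   : ∀ {k} → Exp k → ℕ
  assignDeg : ∀ {j k} → (Fin j → Exp k) → ℕ
  timeDeg (var i)    = copyDeg 1
  timeDeg nil        = 1
  timeDeg (cons b e) = timeDeg e ⊞ 1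
  timeDeg (tail e)   = timeDeg e ⊞ 3
  timeDeg (test e k) =
    timeDeg e ⊞ 2 ⊞ clearDeg (deg e) ⊞
    (timeDeg (k nothing) + (timeDeg (k (just false)) + timeDeg (k (just true))))
  timeDeg (ask o es) =
    let a = arity o
        d = total (λ i → deg (es i))
    in eachDeg a (total (λ i → timeDeg (es i))) ⊞ eachDeg a (copyDeg d) ⊞ readDeg 1 ⊞
       eachDeg a (clearDeg d) ⊞ eachDeg a (clearDeg d)
  timeDeg (loop {j = j} e is body (c , _) r) =
    let z = stateDeg e is c
    in timeDeg e ⊞ eachDeg j (total (λ i → timeDeg (is i))) ⊞
       ((deg e + (2 ⊞ (z * (assignDeg (body false) + assignDeg (body true))))) ⊞ 3) ⊞
       (z * timeDeg r) ⊞ eachDeg j (clearDeg z)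
  assignDeg {j} es =
    let d = total (λ i → deg (es i))
    in eachDeg j (total (λ i → timeDeg (es i))) ⊞ eachDeg j (clearDeg 1) ⊞
       eachDeg j (copyDeg d) ⊞ eachDeg j (clearDeg d)

  record Clean (n : ℕ) (s : Store) : Set where
    constructor clean
    field
      locals   : ∀ m → n ≤ m → s (local m) ≡ []
      specials : ∀ a → s (special a) ≡ []
  open Clean

  clean-≤ : ∀ {n m s} → n ≤ m → Clean n s → Clean m s
  clean-≤ n≤m (clean l sp) = clean (λ k m≤k → l k (≤-trans n≤m m≤k)) sp

  clean-below : ∀ {n} s u → Clean n s → (∀ m → n ≤ m → u (local m) ≡ s (local m)) →
                (∀ a → u (special a) ≡ s (special a)) → Clean n u
  clean-below s u (clean l sp) h h′ = clean (λ m n≤m → trans (h m n≤m) (l m n≤m)) (λ a → trans (h′ a) (sp a))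

  clean-upd : ∀ {n s} m x → m < n → Clean n s → Clean n (s [ local m ≔ x ])
  clean-upd {n} {s} m x m<n c = clean-below s _ c
    (λ k n≤k → upd-other s {local m} {local k} (local≢ (<⇒≢ (≤-trans m<n n≤k))))
    (λ a → refl)

  clean-fill : ∀ {n s j} a (v : Fin j → List Bool) → a + j ≤ n → Clean n s → Clean n (fill s (block a) v)
  clean-fill {s = s} a v a+j≤n c = clean-below s _ c
    (λ k n≤k → fill-out s (block a) v (local k) (block-outside a k (inj₂ (≤-trans a+j≤n n≤k))))
    (λ b → fill-out s (block a) v (special b) (λ i ()))

  pull-head : ∀ {R} x s r → s r ≡ x →
    ∃[ u ] Pull R s (popped r) (List.head x) u × u r ≡ List.drop 1 x × (∀ r′ → r ≢ r′ → u r′ ≡ s r′)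
  pull-head []       s r eq = s , empty eq , eq , λ _ _ → refl
  pull-head (b ∷ xs) s r eq = s [ r ≔ xs ] , top eq , upd-same s r , λ _ → upd-other s

  reply′ : ∀ {R s o h} → answer R s o ≡ h → Pull R s (asked o) h s
  reply′ refl = reply

  grow : ℕ → List Bool → List Bool
  grow zero    xs = xs
  grow (suc k) xs = grow k (true ∷ xs)

  length-grow : ∀ k xs → length (grow k xs) ≡ k + length xs
  length-grow zero    xs = refl
  length-grow (suc k) xs = trans (length-grow k (true ∷ xs)) (+-suc k (length xs))

  drop-suc : ∀ p (xs : List Bool) {y ys} → List.drop p xs ≡ y ∷ ys → List.drop (suc p) xs ≡ ys
  drop-suc zero    (x ∷ xs) refl = refl
  drop-suc (suc p) (x ∷ xs) eq   = drop-suc p xs eq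

  position-just : ∀ {o a} → mirror o ≡ just a → ∀ s → position s o ≡ length (s (special a))
  position-just eq s rewrite eq = refl

  position-nothing : ∀ {o} → mirror o ≡ nothing → ∀ s → position s o ≡ 0
  position-nothing eq s rewrite eq = refl

  -- By induction on the unread part `ys` of the reply. The pushes touch `out` and the mirror, which
  -- is not an address of `o`, so the reply stays the same while it is read.
  stream-exec : ∀ {R o a} → mirror o ≡ just a → ∀ out xs ys s →
    R o (addresses s o) ≡ xs → List.drop (length (s (special a))) xs ≡ ys →
    Exec R (branch (asked o) (maybe′ (λ b → push (local out) b ⨾ push (special a) true) skip) is-just) s
      (s [ local out ≔ ys ʳ++ s (local out) ] [ special a ≔ grow (length ys) (s (special a)) ])
      (4 * length ys + 3)
  stream-exec {R} {o} {a} m out xs [] s Rxs eq =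
    convʳ final (exit (reply′ h≡) refl skip)
    where
    h≡ : answer R s o ≡ nothing
    h≡ rewrite position-just m s | Rxs | eq = refl
    final : s ≗ s [ local out ≔ s (local out) ] [ special a ≔ s (special a) ]
    final r with special a ≟ᴿ r | local out ≟ᴿ r
    ... | yes refl | _        = refl
    ... | no _     | yes refl = refl
    ... | no _     | no _     = refl
  stream-exec {R} {o} {a} m out xs (y ∷ ys) s Rxs eq =
    conv (λ _ → refl) final (≤-reflexive (time (length ys)))
      (next (reply′ h≡) refl (push ⨾ push)
        (stream-exec m out xs ys s₂ (trans (cong (R o) addresses≡) Rxs)
          (trans (cong (λ z → List.drop (length z) xs) s₂a)
                 (drop-suc (length (s (special a))) xs eq))))
    where
    s₁ = s [ local out ≔ y ∷ s (local out) ]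
    s₂ = s₁ [ special a ≔ true ∷ s₁ (special a) ]
    s₂a : s₂ (special a) ≡ true ∷ s (special a)
    s₂a = upd-same s₁ (special a)
    h≡ : answer R s o ≡ just y
    h≡ rewrite position-just m s | Rxs | eq = refl
    addresses≡ : addresses s₂ o ≡ addresses s o
    addresses≡ = tabulate-cong (λ i →
      upd-other s₁ (mirror≢addr o m i ∘ special-injective))
    time : ∀ n → 2 + (1 + 1) + (4 * n + 3) ≡ 4 * suc n + 3
    time = solve-∀
    final : s₂ [ local out ≔ ys ʳ++ s₂ (local out) ] [ special a ≔ grow (length ys) (s₂ (special a)) ]
          ≗ s [ local out ≔ ys ʳ++ (y ∷ s (local out)) ] [ special a ≔ grow (length ys) (true ∷ s (special a)) ]
    final r with special a ≟ᴿ r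
    ... | yes refl = cong (grow (length ys)) s₂a
    ... | no _ with local out ≟ᴿ r
    ...   | yes refl = cong (ys ʳ++_) (upd-same s (local out))
    ...   | no _     = refl

  -- Correctness and running time of compiled expressions

  module Correct
    (R : Streams) (single : ∀ o → mirror o ≡ nothing → ∀ xs → length (R o xs) ≤ 1)
    where

    -- The bits of a reply are pushed in the order in which they arrive, so the expression receives
    -- the reply reversed.
    S : Semantics
    S o xs = reverse (R o xs)

    read-exec : ∀ o out s xs → R o (addresses s o) ≡ xs → s (local out) ≡ [] →
      (∀ a → mirror o ≡ just a → s (special a) ≡ []) →
      Exec R (read o out) s (s [ local out ≔ reverse xs ]) ((4 * length xs + 3) + (3 * length xs + 3))
    read-exec o out s xs Rxs s-out s-m = go (mirror o) refl
      where
      go : ∀ m → mirror o ≡ m →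
        Exec R (readWith m o out) s (s [ local out ≔ reverse xs ]) ((4 * length xs + 3) + (3 * length xs + 3))
      go nothing eq = lone xs Rxs (subst (λ z → length z ≤ 1) Rxs (single o eq _))
        where
        lone : ∀ xs → R o (addresses s o) ≡ xs → length xs ≤ 1 →
          Exec R (readWith nothing o out) s (s [ local out ≔ reverse xs ]) ((4 * length xs + 3) + (3 * length xs + 3))
        lone [] R[] _ = conv (λ _ → refl) final (m≤m+n 3 3) (exit (reply′ h≡) refl skip)
          where
          h≡ : answer R s o ≡ nothing
          h≡ rewrite position-nothing eq s | R[] = refl
          final : s ≗ s [ local out ≔ [] ]
          final r with local out ≟ᴿ r
          ... | yes refl = s-out
          ... | no _     = refl
        lone (x ∷ []) Rx _ = conv (λ _ → refl) (upd-cong {s} {s} (local out) (cong (x ∷_) s-out) (λ _ → refl))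
          (m≤m+n 3 10) (exit (reply′ h≡) refl push)
          where
          h≡ : answer R s o ≡ just x
          h≡ rewrite position-nothing eq s | Rx = refl
        lone (x ∷ y ∷ xs) _ (s≤s ())
      go (just a) eq = conv (λ _ → refl) final (≤-reflexive (cong (λ z → 4 * length xs + 3 + (3 * z + 3)) len))
          (stream-exec eq out xs xs s Rxs (cong (λ z → List.drop (length z) xs) (s-m a eq)) ⨾
           clear-exec (special a) _ _ (upd-same (s [ local out ≔ xs ʳ++ s (local out) ]) (special a)))
        where
        len : length (grow (length xs) (s (special a))) ≡ length xs
        len = trans (length-grow (length xs) _)
          (trans (cong (λ z → length xs + length z) (s-m a eq)) (+-identityʳ _))
        final : s [ local out ≔ xs ʳ++ s (local out) ] [ special a ≔ grow (length xs) (s (special a)) ] [ special a ≔ [] ]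
              ≗ s [ local out ≔ reverse xs ]
        final r with special a ≟ᴿ r
        ... | yes refl = sym (s-m a eq)
        ... | no _ with local out ≟ᴿ r
        ...   | no _  = refl
        ...   | yes _ = trans (cong (xs ʳ++_) s-out) refl

    record Scope {k} (env : Fin k → ℕ) (n : ℕ) (s : Store) (ρ : Env k) : Set where
      constructor scope
      field
        below : ∀ i → env i < n
        tidy  : Clean n s
        holds : ∀ i → s (local (env i)) ≡ ρ i
    open Scope

    scope-block : ∀ {k} {env : Fin k → ℕ} {n s ρ} a j {m} u → Scope env n s ρ → n ≤ a → a + j ≤ m →
      (∀ r → (∀ (i : Fin j) → block a i ≢ r) → u r ≡ s r) → Scope env m u ρ
    scope-block {s = s} a j u (scope be ti ho) n≤a a+j≤m out = scope
      (λ i → ≤-trans (be i) (≤-trans n≤a (≤-trans (m≤m+n a j) a+j≤m)))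
      (clean (λ k m≤k → trans (out _ (block-outside a k (inj₂ (≤-trans a+j≤m m≤k))))
                              (ti .locals k (≤-trans n≤a (≤-trans (m≤m+n a j) (≤-trans a+j≤m m≤k)))))
             (λ b → trans (out (special b) (λ i ())) (ti .specials b)))
      (λ i → trans (out _ (block-outside a _ (inj₁ (≤-trans (be i) n≤a)))) (ho i))

    scope-upd : ∀ {k} {env : Fin k → ℕ} {n s ρ} {m x} → Scope env n s ρ → (∀ i → env i ≢ m) → m < n →
      Scope env n (s [ local m ≔ x ]) ρ
    scope-upd {s = s} {m = m} {x} (scope be ti ho) env≢m m<n = scope be (clean-upd m x m<n ti)
      (λ i → trans (upd-other s (local≢ (env≢m i ∘ sym))) (ho i))

    record Within (N : ℕ) (c : Cmd) (s u : Store) (a : ℕ) : Set where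
      constructor within
      field runs : Exec R c s u (N ^ a)
    open Within

    within-≗ : ∀ {N c s u u′ a} → u ≗ u′ → Within N c s u a → Within N c s u′ a
    within-≗ h (within x) = within (convʳ h x)

    module Timed {N} (B : Bounding S N) where
      open Powers N (B .2≤N) public

      slow : ∀ {t a c s u} → t ⊑ a → Exec R c s u t → Within N c s u a
      slow t⊑a x = within (slower (unpow t⊑a) x)

      exact : ∀ {a} → N ^ a ⊑ a
      exact = pow ≤-refl

      faster : ∀ {a b c s u} → a ≤ b → Within N c s u a → Within N c s u b
      faster a≤b (within x) = slow (raise⊑ a≤b exact) x

      infixr 5 _▷_
      _▷_ : ∀ {c d s u v a b} → Within N c s u a → Within N d u v b → Within N (c ⨾ d) s v (a ⊞ b)
      _▷_ {a = a} {b} (within x) (within y) = slow (+⊑ {a = a} {b} exact exact) (x ⨾ y)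

      each-exec⊑ : ∀ {j} (f : Fin j → Cmd) (rs : Fin j → Reg) v a s → Distinct rs →
        (∀ i u → (∀ r → (∀ i → rs i ≢ r) → u r ≡ s r) → u (rs i) ≡ s (rs i) →
          Within N (f i) u (u [ rs i ≔ v i ]) a) →
        Within N (each f) s (fill s rs v) (eachDeg j a)
      each-exec⊑ {j} f rs v a s d h = slow (+⊑ (*⊑ (const⊑ j) exact) (const⊑ 1)) (each-exec f rs v (N ^ a) s d (λ i u x y → runs (h i u x y)))

      clear-time : ∀ {x d} → x ⊑ d → 3 * x + 3 ⊑ clearDeg d
      clear-time x⊑d = +⊑ (*⊑ (const⊑ 3) x⊑d) (const⊑ 3)

      copy-time : ∀ {x d} → x ⊑ d → 7 * x + 6 ⊑ copyDeg d
      copy-time x⊑d = +⊑ (*⊑ (const⊑ 7) x⊑d) (const⊑ 6)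

      clears-exec : ∀ {j} (rs : Fin j → Reg) d s → Distinct rs → (∀ i → length (s (rs i)) ⊑ d) →
        Within N (each (λ i → clear (rs i))) s (fill s rs (const [])) (eachDeg j (clearDeg d))
      clears-exec rs d s dis h = each-exec⊑ _ rs _ _ s dis λ i u _ at →
        slow (clear-time (h i)) (slower (≤-reflexive (cong (λ z → 3 * length z + 3) at)) (clear-exec (rs i) _ u refl))

      copies-exec : ∀ {j} (as bs : Fin j → Reg) t (v : Fin j → List Bool) d s → Distinct bs →
        (∀ i i′ → bs i′ ≢ as i) → (∀ i → as i ≢ t) → (∀ i → bs i ≢ t) →
        (∀ i → s (as i) ≡ v i) → (∀ i → s (bs i) ≡ []) → s t ≡ [] → (∀ i → length (v i) ⊑ d) →
        Within N (each (λ i → copy (as i) (bs i) t)) s (fill s bs v) (eachDeg j (copyDeg d))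
      copies-exec as bs t v d s dis b≢a a≢t b≢t as≡ bs≡ t≡ h = each-exec⊑ _ bs v _ s dis λ i u out at →
        slow (copy-time (h i)) (copy-exec′ (as i) (bs i) t (λ eq → b≢a i i (sym eq)) (a≢t i) (b≢t i) u (v i)
          (trans (out _ (b≢a i)) (as≡ i)) (trans at (bs≡ i)) (trans (out t b≢t) t≡))

    -- Only `out` has changed at the end: all scratch registers are empty again, which allows the
    -- compiled pieces to share them. `N` bounds the variables and the replies; intermediate values
    -- are bounded by powers of `N` through `size≤`.
    comp-exec : ∀ {N} (B : Bounding S N) {k} (e : Exp k) env out n s ρ → Scope env n s ρ → out < n →
      (∀ i → env i ≢ out) → s (local out) ≡ [] → Bounded N ρ →
      Within N (comp e env out n) s (s [ local out ≔ eval S e ρ ]) (timeDeg e)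
    comps-exec : ∀ {N} (B : Bounding S N) {k j} (es : Fin j → Exp k) env n a s ρ → Scope env n s ρ → n ≤ a →
      Bounded N ρ →
      Within N (each (λ i → comp (es i) env (a + toℕ i) (a + j))) s (fill s (block a) (evals S es ρ))
        (eachDeg j (total (λ i → timeDeg (es i))))
    assign-exec : ∀ {N} (B : Bounding S N) {j} (es : Fin j → Exp j) a s ρ → Clean (a + j) s →
      (∀ i → s (block a i) ≡ ρ i) → Bounded N ρ →
      Within N (assign es a) s (fill s (block a) (evals S es ρ)) (assignDeg es)

    comps-exec {N} B {j = j} es env n a s ρ sc n≤a bd =
      each-exec⊑ _ (block a) _ _ s (block-distinct a) λ i u out at →
        faster (≤total (λ i → timeDeg (es i)) i)
          (comp-exec B (es i) env (a + toℕ i) (a + j) u ρ (scope-block a j u sc n≤a ≤-refl out)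
            (+-monoʳ-< a (toℕ<n i))
            (λ i′ → <⇒≢ (≤-trans (sc .below i′) (≤-trans n≤a (m≤m+n a _))))
            (trans at (sc .tidy .locals _ (≤-trans n≤a (m≤m+n a _))))
            bd)
      where open Timed B

    assign-exec {N} B {j} es a s ρ cl hold bd =
      within-≗ final
        (comps-exec B es (λ i → a + toℕ i) (a + j) (a + j) s ρ sc ≤-refl bd ▷
         clears-exec as 1 s₁ (block-distinct a) (λ i → ≤⊑ (≤-trans (≤-reflexive (cong length (s₁a i))) (bd i)) base⊑) ▷
         copies-exec bs as t v d s₂ (block-distinct a) a≢b (λ i → block-outside (a + j) (a + j + j) (inj₂ ≤-refl) i)
           (λ i → block-outside a (a + j + j) (inj₂ (m≤m+n _ j)) i) s₂b (fill-at s₁ as _ (block-distinct a)) s₂t len ▷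
         clears-exec bs d s₃ (block-distinct (a + j)) (λ i → ≤⊑ (≤-reflexive (cong length (s₃b i))) (len i)))
      where
      open Timed B
      as bs : Fin j → Reg
      as = block a
      bs = block (a + j)
      t = local (a + j + j)
      v = evals S es ρ
      d = total (λ i → deg (es i))
      s₁ = fill s bs v
      s₂ = fill s₁ as (const [])
      s₃ = fill s₂ as v
      sc : Scope (λ i → a + toℕ i) (a + j) s ρ
      sc = scope (λ i → +-monoʳ-< a (toℕ<n i)) cl hold
      len : ∀ i → length (v i) ⊑ d
      len i = raise⊑ (≤total (λ i → deg (es i)) i) (size≤ B (es i) ρ bd)
      a≢b : ∀ i i′ → as i′ ≢ bs i
      a≢b i i′ = block-outside a (a + j + toℕ i) (inj₂ (m≤m+n _ _)) i′
      s₁a : ∀ i → s₁ (as i) ≡ ρ i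
      s₁a i = trans (fill-out s bs v (as i) (λ i′ eq → a≢b i′ i (sym eq))) (hold i)
      s₂b : ∀ i → s₂ (bs i) ≡ v i
      s₂b i = trans (fill-out s₁ as _ (bs i) (λ i′ → a≢b i i′)) (fill-at s bs v (block-distinct (a + j)) i)
      s₃b : ∀ i → s₃ (bs i) ≡ v i
      s₃b i = trans (fill-out s₂ as _ (bs i) (λ i′ → a≢b i i′)) (s₂b i)
      s₂t : s₂ t ≡ []
      s₂t = trans (fill-out s₁ as _ t (block-outside a _ (inj₂ (m≤m+n _ j))))
        (trans (fill-out s bs v t (block-outside (a + j) _ (inj₂ ≤-refl))) (cl .locals _ (m≤m+n _ j)))
      final : fill s₃ bs (const []) ≗ fill s as v
      final = fill-unique s₃ bs _ _ (block-distinct (a + j))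
        (λ i → sym (trans (fill-out s as v (bs i) (λ i′ → a≢b i i′)) (cl .locals _ (m≤m+n (a + j) _))))
        (λ r r∉b → case any? (λ i → as i ≟ᴿ r) of λ where
          (yes (i , refl)) → trans (fill-at s₂ as v (block-distinct a) i) (sym (fill-at s as v (block-distinct a) i))
          (no ∄) → let r∉a = λ i eq → ∄ (i , eq) in
            trans (fill-out s₂ as v r r∉a) (trans (fill-out s₁ as _ r r∉a)
              (trans (fill-out s bs v r r∉b) (sym (fill-out s as v r r∉a)))))

    -- The bound is assumed for all lists of at most the remaining length, because after one pass it
    -- is needed for the states reached along `x ∷ ys`. The sum of the exponents of the two bodies
    -- serves for either.
    pour-exec : ∀ {N} (B : Bounding S N) {j} (body : Bool → Fin j → Exp j) n xs s (st : Env j) → Clean (suc n + j) s →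
      s (local n) ≡ xs → (∀ i → s (block (suc n) i) ≡ st i) →
      (∀ ys → length ys ≤ length xs → Bounded N (iterate (λ b st → evals S (body b) st) ys st)) →
      Exec R (pour (local n) (λ b → assign (body b) (suc n))) s
        (fill (s [ local n ≔ [] ]) (block (suc n)) (iterate (λ b st → evals S (body b) st) xs st))
        (length xs * (2 + N ^ (assignDeg (body false) + assignDeg (body true))) + 3)
    pour-exec B {j} body n [] s st cl n≡ st≡ bd = convʳ final (exit (empty n≡) refl skip)
      where
      final : s ≗ fill (s [ local n ≔ [] ]) (block (suc n)) st
      final r = sym (fill-unique (s [ local n ≔ [] ]) (block (suc n)) st s (block-distinct (suc n)) (λ i → sym (st≡ i))
        (λ r _ → upd-elim s (local n) s (sym n≡) (λ _ _ → refl) r) r)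
    pour-exec {N} B {j} body n (x ∷ xs) s st cl n≡ st≡ bd =
      conv (λ _ → refl) final time
        (next (top n≡) refl
          (runs (faster {b = D} (deg≤ x) (assign-exec B (body x) (suc n) s₁ st (clean-upd n xs (m≤m+n (suc n) j) cl) s₁≡ (bd [] z≤n))))
          (pour-exec B body n xs s₂ st₂ (clean-fill (suc n) st₂ ≤-refl (clean-upd n xs (m≤m+n (suc n) j) cl))
            (trans (fill-out s₁ _ st₂ _ (block-outside (suc n) n (inj₁ ≤-refl))) (upd-same s (local n)))
            (fill-at s₁ _ st₂ (block-distinct (suc n)))
            (λ ys ys≤ → bd (x ∷ ys) (s≤s ys≤))))
      where
      open Timed B
      st₂ = evals S (body x) st
      s₁ = s [ local n ≔ xs ]
      s₂ = fill s₁ (block (suc n)) st₂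
      result = iterate (λ b st → evals S (body b) st) xs st₂
      deg≤ : ∀ x → assignDeg (body x) ≤ assignDeg (body false) + assignDeg (body true)
      deg≤ false = m≤m+n _ _
      deg≤ true  = m≤n+m _ (assignDeg (body false))
      s₁≡ : ∀ i → s₁ (block (suc n) i) ≡ st i
      s₁≡ i = trans (upd-other s (block-outside (suc n) n (inj₁ ≤-refl) i ∘ sym)) (st≡ i)
      D = assignDeg (body false) + assignDeg (body true)
      time : 2 + N ^ D + (length xs * (2 + N ^ D) + 3) ≤ suc (length xs) * (2 + N ^ D) + 3
      time = ≤-reflexive (sym (+-assoc (2 + N ^ D) (length xs * (2 + N ^ D)) 3))
      final : fill (s₂ [ local n ≔ [] ]) (block (suc n)) result ≗ fill (s [ local n ≔ [] ]) (block (suc n)) result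
      final = fill-unique _ _ _ _ (block-distinct (suc n))
        (λ i → sym (fill-at _ _ result (block-distinct (suc n)) i))
        (λ r r∉ → trans (case-n r r∉) (sym (fill-out (s [ local n ≔ [] ]) _ result r r∉)))
        where
        case-n : ∀ r → (∀ i → block (suc n) i ≢ r) → (s₂ [ local n ≔ [] ]) r ≡ (s [ local n ≔ [] ]) r
        case-n r r∉ with local n ≟ᴿ r
        ... | yes _  = refl
        ... | no n≢r = trans (fill-out s₁ _ st₂ r r∉) (upd-other s n≢r)

    comp-exec {N} B {k} e₀ env out n s ρ sc out<n env≢out out[] bd = go e₀
      where
      open Timed B
      n[] : s (local n) ≡ []
      n[] = sc .tidy .locals n ≤-refl
      go : ∀ e → Within N (comp e env out n) s (s [ local out ≔ eval S e ρ ]) (timeDeg e)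
      go (var i) = slow (copy-time (≤⊑ (bd i) base⊑))
        (copy-exec′ _ _ _ (local≢ (env≢out i)) (local≢ (<⇒≢ (sc .below i))) (local≢ (<⇒≢ out<n)) s (ρ i)
          (sc .holds i) out[] n[])
      go nil = slow (const⊑ 1) (convʳ final skip)
        where
        final : s ≗ s [ local out ≔ [] ]
        final r = sym (upd-elim s (local out) s (sym out[]) (λ _ _ → refl) r)
      go (cons b e) = within-≗ final (comp-exec B e env out n s ρ sc out<n env≢out out[] bd ▷ slow (const⊑ 1) push)
        where
        s₁ = s [ local out ≔ eval S e ρ ]
        final : s₁ [ local out ≔ b ∷ s₁ (local out) ] ≗ s [ local out ≔ b ∷ eval S e ρ ]
        final r with local out ≟ᴿ r
        ... | yes _ = cong (b ∷_) (upd-same s (local out))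
        ... | no _  = refl
      go (tail e) with pull-head (eval S e ρ) (s [ local out ≔ eval S e ρ ]) (local out) (upd-same s (local out))
      ... | u , p , u-out , u-other =
        within-≗ final (comp-exec B e env out n s ρ sc out<n env≢out out[] bd ▷ slow (const⊑ 3) (exit p refl skip))
        where
        final : u ≗ s [ local out ≔ List.drop 1 (eval S e ρ) ]
        final r with local out ≟ᴿ r
        ... | yes refl = u-out
        ... | no out≢r = trans (u-other r out≢r) (upd-other s out≢r)
      go (test e k) with pull-head (eval S e ρ) (s [ local n ≔ eval S e ρ ]) (local n) (upd-same s (local n))
      ... | u , p , u-n , u-other =
        comp-exec B e env n (suc n) s ρ
          (scope (λ i → m≤n⇒m≤1+n (sc .below i)) (clean-≤ (n≤1+n n) (sc .tidy)) (sc .holds))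
          ≤-refl (λ i → <⇒≢ (sc .below i)) n[] bd ▷
        slow (+⊑ (const⊑ 2) (+⊑ (clear-time (≤⊑ (≤-trans (≤-reflexive (cong length u-n)) (drop1≤ (eval S e ρ))) (size≤ B e ρ bd)))
                                exact))
          (exit p refl (clear-exec (local n) _ u refl ⨾ convˡ restored (runs (faster (sum≤ (List.head (eval S e ρ)))
            (comp-exec B (k (List.head (eval S e ρ))) env out n s ρ sc out<n env≢out out[] bd)))))
        where
        restored : u [ local n ≔ [] ] ≗ s
        restored r with local n ≟ᴿ r
        ... | yes refl = sym n[]
        ... | no n≢r   = trans (u-other r n≢r) (upd-other s n≢r)
        sum≤ : ∀ h → timeDeg (k h) ≤ timeDeg (k nothing) + (timeDeg (k (just false)) + timeDeg (k (just true)))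
        sum≤ nothing      = m≤m+n _ _
        sum≤ (just false) = ≤-trans (m≤m+n _ _) (m≤n+m _ (timeDeg (k nothing)))
        sum≤ (just true)  = ≤-trans (m≤n+m _ (timeDeg (k (just false)))) (m≤n+m _ (timeDeg (k nothing)))
      go (ask o es) = within-≗ final
        (comps-exec B es env n n s ρ sc ≤-refl bd ▷
         copies-exec ls sp t v d s₁ sp-distinct (λ _ _ ()) (block-outside n (n + arity o) (inj₂ ≤-refl)) (λ _ ())
           (fill-at s ls v (block-distinct n)) s₁sp s₁t len ▷
         slow (+⊑ (+⊑ (*⊑ (const⊑ 4) xs⊑) (const⊑ 3)) (clear-time xs⊑))
           (read-exec o out s₂ xs (cong (R o) addresses≡) s₂out s₂m) ▷
         clears-exec sp d s₃ sp-distinct (λ i → ≤⊑ (≤-reflexive (cong length (s₂sp i))) (len i)) ▷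
         clears-exec ls d s₄ (block-distinct n) (λ i → ≤⊑ (≤-reflexive (cong length (s₄ls i))) (len i)))
        where
        ls sp : Fin (arity o) → Reg
        ls = block n
        sp i = special (addr o i)
        sp-distinct : Distinct sp
        sp-distinct = addr-injective o ∘ special-injective
        t = local (n + arity o)
        v = evals S es ρ
        d = total (λ i → deg (es i))
        xs = R o (Vec.tabulate v)
        s₁ = fill s ls v
        s₂ = fill s₁ sp v
        s₃ = s₂ [ local out ≔ reverse xs ]
        s₄ = fill s₃ sp (const [])
        len : ∀ i → length (v i) ⊑ d
        len i = raise⊑ (≤total (λ i → deg (es i)) i) (size≤ B (es i) ρ bd)
        xs⊑ : length xs ⊑ 1
        xs⊑ = ≤⊑ (≤-trans (≤-reflexive (sym (length-reverse xs))) (B .answers o (Vec.tabulate v))) base⊑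
        s₁sp : ∀ i → s₁ (sp i) ≡ []
        s₁sp i = trans (fill-out s ls v (sp i) (λ _ ())) (sc .tidy .specials _)
        s₁t : s₁ t ≡ []
        s₁t = trans (fill-out s ls v t (block-outside n _ (inj₂ ≤-refl))) (sc .tidy .locals _ (m≤m+n n _))
        s₂sp : ∀ i → s₂ (sp i) ≡ v i
        s₂sp = fill-at s₁ sp v sp-distinct
        addresses≡ : addresses s₂ o ≡ Vec.tabulate v
        addresses≡ = tabulate-cong s₂sp
        s₂out : s₂ (local out) ≡ []
        s₂out = trans (fill-out s₁ sp v _ (λ _ ())) (trans (fill-out s ls v _ (block-outside n out (inj₁ out<n))) out[])
        s₂m : ∀ a → mirror o ≡ just a → s₂ (special a) ≡ []
        s₂m a eq = trans (fill-out s₁ sp v _ (λ i → mirror≢addr o eq i ∘ sym ∘ special-injective))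
          (trans (fill-out s ls v (special a) (λ _ ())) (sc .tidy .specials a))
        s₄ls : ∀ i → s₄ (ls i) ≡ v i
        s₄ls i = trans (fill-out s₃ sp _ (ls i) (λ _ ()))
          (trans (upd-other s₂ (block-outside n out (inj₁ out<n) i ∘ sym))
            (trans (fill-out s₁ sp v (ls i) (λ _ ())) (fill-at s ls v (block-distinct n) i)))
        final : fill s₄ ls (const []) ≗ s [ local out ≔ reverse xs ]
        final = fill-unique s₄ ls _ _ (block-distinct n)
          (λ i → sym (trans (upd-other s (block-outside n out (inj₁ out<n) i ∘ sym)) (sc .tidy .locals _ (m≤m+n n _))))
          step₂
          where
          step₂ : ∀ r → (∀ i → ls i ≢ r) → s₄ r ≡ (s [ local out ≔ reverse xs ]) r
          step₂ r r∉l with any? (λ i → sp i ≟ᴿ r)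
          ... | yes (i , refl) = trans (fill-at s₃ sp (const []) sp-distinct i) (sym (sc .tidy .specials _))
          ... | no ∄ = trans (fill-out s₃ sp _ r r∉s) step₃
            where
            r∉s : ∀ i → sp i ≢ r
            r∉s i eq = ∄ (i , eq)
            step₃ : s₃ r ≡ (s [ local out ≔ reverse xs ]) r
            step₃ with local out ≟ᴿ r
            ... | yes _ = refl
            ... | no _  = trans (fill-out s₁ sp v r r∉s) (fill-out s ls v r r∉l)
      go (loop {j = j} e is body (c , g) r) = within-≗ final
        (comp-exec B e env n (suc n) s ρ sc′ ≤-refl (λ i → <⇒≢ (sc .below i)) n[] bd ▷
         comps-exec B is env (suc n) (suc n) s₁ ρ sc₁ ≤-refl bd ▷
         slow (+⊑ (*⊑ (size≤ B e ρ bd) (+⊑ (const⊑ 2) (^⊑ {a = z} {b = D} (pow ≤-refl)))) (const⊑ 3))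
           (pour-exec B′ body n x s₂ st₀ (clean-fill (suc n) st₀ ≤-refl (clean-≤ (m≤m+n (suc n) j) (sc₁ .tidy)))
             (trans (fill-out s₁ blk st₀ _ (block-outside (suc n) n (inj₁ ≤-refl))) (upd-same s (local n)))
             (fill-at s₁ blk st₀ (block-distinct (suc n)))
             (λ ys ys≤ → state≤ B e is body c (g S) ys ρ ys≤ bd)) ▷
         slow (^⊑ {a = z} {b = timeDeg r} (pow ≤-refl))
           (runs (comp-exec B′ r (λ i → suc n + toℕ i) out (suc n + j) s₃ st sc₃
             (≤-trans out<n (≤-trans (n≤1+n n) (m≤m+n (suc n) j)))
             (λ i → <⇒≢ (≤-trans out<n (≤-trans (n≤1+n n) (m≤m+n (suc n) (toℕ i)))) ∘ sym) s₃out stBd)) ▷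
         clears-exec blk z s₄ (block-distinct (suc n)) (λ i → ≤⊑ (≤-reflexive (cong length (s₄blk i))) (pow (stBd i))))
        where
        blk : Fin j → Reg
        blk = block (suc n)
        z = stateDeg e is c
        D = assignDeg (body false) + assignDeg (body true)
        B′ = raise ((deg e + c) + total (λ i → deg (is i))) B
        x = eval S e ρ
        st₀ = evals S is ρ
        st = iterate (λ b st → evals S (body b) st) x st₀
        v = eval S r st
        s₁ = s [ local n ≔ x ]
        s₂ = fill s₁ blk st₀
        s₃ = fill (s₂ [ local n ≔ [] ]) blk st
        s₄ = s₃ [ local out ≔ v ]
        out≢n : local out ≢ local n
        out≢n = local≢ (<⇒≢ out<n)
        out∉blk : ∀ i → blk i ≢ local out
        out∉blk = block-outside (suc n) out (inj₁ (m≤n⇒m≤1+n out<n))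
        stBd : Bounded (N ^ z) st
        stBd = state≤ B e is body c (g S) x ρ ≤-refl bd
        sc′ : Scope env (suc n) s ρ
        sc′ = scope (λ i → m≤n⇒m≤1+n (sc .below i)) (clean-≤ (n≤1+n n) (sc .tidy)) (sc .holds)
        sc₁ : Scope env (suc n) s₁ ρ
        sc₁ = scope-upd sc′ (λ i → <⇒≢ (sc .below i)) ≤-refl
        sc₃ : Scope (λ i → suc n + toℕ i) (suc n + j) s₃ st
        sc₃ = scope (λ i → +-monoʳ-< (suc n) (toℕ<n i))
          (clean-fill (suc n) st ≤-refl (clean-upd n [] (m≤m+n (suc n) j)
            (clean-fill (suc n) st₀ ≤-refl (clean-≤ (m≤m+n (suc n) j) (sc₁ .tidy)))))
          (fill-at _ blk st (block-distinct (suc n)))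
        s₃out : s₃ (local out) ≡ []
        s₃out = trans (fill-out _ blk st _ out∉blk) (trans (upd-other s₂ (out≢n ∘ sym))
          (trans (fill-out s₁ blk st₀ _ out∉blk) (trans (upd-other s (out≢n ∘ sym)) out[])))
        s₄blk : ∀ i → s₄ (blk i) ≡ st i
        s₄blk i = trans (upd-other s₃ (out∉blk i ∘ sym)) (fill-at _ blk st (block-distinct (suc n)) i)
        final : fill s₄ blk (const []) ≗ s [ local out ≔ v ]
        final = fill-unique s₄ blk _ _ (block-distinct (suc n))
          (λ i → sym (trans (upd-other s (out∉blk i ∘ sym)) (sc′ .tidy .locals _ (m≤m+n (suc n) _))))
          rest
          where
          rest : ∀ r → (∀ i → blk i ≢ r) → s₄ r ≡ (s [ local out ≔ v ]) r
          rest r r∉ with local out ≟ᴿ r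
          ... | yes _ = refl
          ... | no _  = trans (fill-out _ blk st r r∉) rest′
            where
            rest′ : (s₂ [ local n ≔ [] ]) r ≡ s r
            rest′ with local n ≟ᴿ r
            ... | yes refl = sym n[]
            ... | no n≢r   = trans (fill-out s₁ blk st₀ r r∉) (upd-other s n≢r)

  -- Programs iterate a simultaneous assignment

  record Program : Set where
    field
      {#vars}  : ℕ
      init     : Fin #vars → Exp 0
      update   : Fin #vars → Exp #vars
      growth   : Growth update
      continue : Exp #vars
      verdict  : Exp #vars

  module _ (P : Program) where
    open Program P

    flag result : ℕ
    flag = 0
    result = 1

    var-reg : Fin #vars → ℕ
    var-reg i = 2 + toℕ i

    runProgram : Cmd
    runProgram =
      each (λ i → comp (init i) (λ ()) (2 + toℕ i) (2 + #vars)) ⨾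
      comp continue var-reg flag (2 + #vars) ⨾
      -- The body empties the flag and computes it afresh, which turns `pour` into a while-loop that
      -- ends as soon as `continue` yields the empty list.
      pour (local flag) (λ _ → clear (local flag) ⨾ assign update 2 ⨾ comp continue var-reg flag (2 + #vars)) ⨾
      comp verdict var-reg result (2 + #vars)

    data Runs (S : Semantics) : Env #vars → ℕ → Env #vars → Set where
      done : ∀ {ρ} → eval S continue ρ ≡ [] → Runs S ρ 0 ρ
      more : ∀ {ρ T ρ′ b bs} → eval S continue ρ ≡ b ∷ bs → Runs S (evals S update ρ) T ρ′ → Runs S ρ (suc T) ρ′

    iterationDeg programDeg : ℕ
    iterationDeg = 2 ⊞ clearDeg (deg continue) ⊞ assignDeg update ⊞ timeDeg continue
    programDeg = eachDeg #vars (total (λ i → timeDeg (init i))) ⊞ timeDeg continue ⊞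
                 ((1 + iterationDeg) ⊞ 3) ⊞ timeDeg verdict

    module _ (R : Streams) (single : ∀ o → mirror o ≡ nothing → ∀ xs → length (R o xs) ≤ 1) where
      open Correct R single
      open Scope

      record Holds (s : Store) (ρ : Env #vars) : Set where
        constructor holding
        field
          inScope : Scope var-reg (2 + #vars) s ρ
          noResult : s (local result) ≡ []

      flag-upd : ∀ {s ρ x} → Holds s ρ → Holds (s [ local flag ≔ x ]) ρ
      flag-upd (holding sc nr) = holding (scope-upd sc (λ i ()) (s≤s z≤n)) nr

      -- `N₀` bounds the current data. It grows by the growth constant in each iteration while `T`
      -- decreases, so `T * proj₁ growth + N₀` is invariant. One `N`, fixed in advance, thus serves
      -- all iterations, and so does the exponent `iterationDeg`.
      iterations-exec : ∀ {N} → Bounding S N → ∀ {ρ T ρ′} → Runs S ρ T ρ′ → ∀ N₀ → Bounded N₀ ρ →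
        T * proj₁ growth + N₀ ≤ N → ∀ s → Holds s ρ → s (local flag) ≡ eval S continue ρ →
        ∃[ u ] Exec R (pour (local flag) (λ _ → clear (local flag) ⨾ assign update 2 ⨾ comp continue var-reg flag (2 + #vars)))
                 s u (T * N ^ iterationDeg + 3) × Holds u ρ′ × u (local flag) ≡ []
      iterations-exec B (done stop) N₀ bd N₀≤ s h fl = s , exit (empty (trans fl stop)) refl skip , h , trans fl stop
      iterations-exec {N} B {ρ} {suc T} {ρ′} (more {b = b} {bs} go runs′) N₀ bd N₀≤ s h fl =
        let bd′ = proj₂ growth S ρ N₀ bd
            u , ex , hu , fu = iterations-exec B runs′ (proj₁ growth + N₀) bd′ bound′ s₃ h₃ (upd-same s₂ (local flag))
        in u , slower time (next (top (trans fl go)) refl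
                 (clear-exec (local flag) bs _ (upd-same s (local flag)) ⨾
                  (Within.runs (assign-exec B update 2 s₁ ρ (h₁ .Holds.inScope .tidy) (h₁ .Holds.inScope .holds) bdN) ⨾
                   Within.runs (comp-exec B continue var-reg flag (2 + #vars) s₂ _ (h₂ .Holds.inScope) (s≤s z≤n) (λ i ()) s₂flag
                     (λ i → ≤-trans (bd′ i) (≤-trans (m≤n+m _ (T * proj₁ growth)) bound′))))) ex) , hu , fu
        where
        open Timed B
        v = evals S update ρ
        bdN : Bounded N ρ
        bdN i = ≤-trans (bd i) (≤-trans (m≤n+m N₀ _) N₀≤)
        bound′ : T * proj₁ growth + (proj₁ growth + N₀) ≤ N
        bound′ = ≤-trans (≤-reflexive (arith (T * proj₁ growth) (proj₁ growth) N₀)) N₀≤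
          where
          arith : ∀ a b c → a + (b + c) ≡ b + a + c
          arith = solve-∀
        s₁ = s [ local flag ≔ bs ] [ local flag ≔ [] ]
        s₂ = fill s₁ (block 2) v
        s₃ = s₂ [ local flag ≔ eval S continue v ]
        s₂flag : s₂ (local flag) ≡ []
        s₂flag = trans (fill-out s₁ (block 2) v _ (block-outside 2 0 (inj₁ (s≤s z≤n)))) (upd-same (s [ local flag ≔ bs ]) (local flag))
        h₁ : Holds s₁ ρ
        h₁ = flag-upd (flag-upd h)
        h₂ : Holds s₂ v
        h₂ = holding
          (scope (λ i → +-monoʳ-< 2 (toℕ<n i)) (clean-fill 2 v ≤-refl (h₁ .Holds.inScope .tidy)) (fill-at s₁ (block 2) v (block-distinct 2)))
          (trans (fill-out s₁ (block 2) v _ (block-outside 2 1 (inj₁ ≤-refl))) (h₁ .Holds.noResult))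
        h₃ : Holds s₃ v
        h₃ = flag-upd h₂
        contLen : length bs ⊑ deg continue
        contLen = ≤⊑ (≤-trans (n≤1+n _) (≤-reflexive (sym (cong length go)))) (size≤ B continue ρ bdN)
        one : 2 + ((3 * length bs + 3) + (N ^ assignDeg update + N ^ timeDeg continue)) ⊑ iterationDeg
        one = +⊑ (const⊑ 2) (+⊑ (clear-time contLen) (+⊑ {a = assignDeg update} {b = timeDeg continue} exact exact))
        time : 2 + ((3 * length bs + 3) + (N ^ assignDeg update + N ^ timeDeg continue)) + (T * N ^ iterationDeg + 3)
             ≤ suc T * N ^ iterationDeg + 3
        time = ≤-trans (+-monoˡ-≤ (T * N ^ iterationDeg + 3) (unpow one)) (≤-reflexive (sym (+-assoc (N ^ iterationDeg) _ 3)))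

      runProgram-exec : ∀ {N} → Bounding S N → ∀ {T ρ} → Runs S (evals S init (λ ())) T ρ →
        ∀ N₀ → Bounded N₀ (evals S init (λ ())) → T * proj₁ growth + N₀ ≤ N → T ≤ N →
        ∃[ u ] Exec R runProgram (λ _ → []) u (N ^ programDeg) × u (local result) ≡ eval S verdict ρ
      runProgram-exec {N} B {T} {ρ} runs′ N₀ bd N₀≤ T≤N =
        let u , ex , hu , fu = iterations-exec B runs′ N₀ bd N₀≤ s₂ h₂ (upd-same s₁ (local flag))
        in u [ local result ≔ eval S verdict ρ ] ,
           Within.runs
            (comps-exec B init (λ ()) 2 2 (λ _ → []) (λ ()) (scope (λ ()) (clean (λ _ _ → refl) (λ _ → refl)) (λ ())) ≤-refl (λ ()) ▷
             comp-exec B continue var-reg flag (2 + #vars) s₁ ρ₀ (h₁ .Holds.inScope) (s≤s z≤n) (λ i ())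
               (fill-out _ (block 2) ρ₀ (local flag) (block-outside 2 0 (inj₁ (s≤s z≤n)))) (bounded {T * proj₁ growth} {ρ₀} N₀≤ bd) ▷
             slow (+⊑ (*⊑ (≤⊑ T≤N base⊑) exact) (const⊑ 3)) ex ▷
             comp-exec B verdict var-reg result (2 + #vars) u ρ (hu .Holds.inScope) (s≤s (s≤s z≤n)) (λ i ()) (hu .Holds.noResult)
               (bounded-end runs′ N₀ bd N₀≤)) ,
           upd-same u (local result)
        where
        open Timed B
        ρ₀ = evals S init (λ ())
        s₁ = fill (λ _ → []) (block 2) ρ₀
        s₂ = s₁ [ local flag ≔ eval S continue ρ₀ ]
        bounded : ∀ {m ρ} → m + N₀ ≤ N → Bounded N₀ ρ → Bounded {#vars} N ρ
        bounded le bd i = ≤-trans (bd i) (≤-trans (m≤n+m N₀ _) le)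
        bounded-end : ∀ {ρ T ρ′} → Runs S ρ T ρ′ → ∀ N₀ → Bounded N₀ ρ → T * proj₁ growth + N₀ ≤ N → Bounded N ρ′
        bounded-end (done _) N₀ bd le i = ≤-trans (bd i) le
        bounded-end {T = suc T} (more _ r) N₀ bd le = bounded-end r (proj₁ growth + N₀) (proj₂ growth S _ N₀ bd)
          (≤-trans (≤-reflexive (arith (T * proj₁ growth) (proj₁ growth) N₀)) le)
          where
          arith : ∀ a b c → a + (b + c) ≡ b + a + c
          arith = solve-∀
        h₁ : Holds s₁ ρ₀
        h₁ = holding (scope (λ i → +-monoʳ-< 2 (toℕ<n i)) (clean-fill 2 ρ₀ ≤-refl (clean (λ _ _ → refl) (λ _ → refl)))
                        (fill-at _ (block 2) ρ₀ (block-distinct 2)))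
          (fill-out _ (block 2) ρ₀ (local result) (block-outside 2 1 (inj₁ ≤-refl)))
        h₂ : Holds s₂ ρ₀
        h₂ = flag-upd h₁

-- Finite types

Finite : Set → Set
Finite X = ∃[ m ] (X ↔ Fin m)

finite-⊎ : ∀ {X Y} → Finite X → Finite Y → Finite (X ⊎ Y)
finite-⊎ (m , f) (n , g) = m + n , ↔-trans (f ⊎-↔ g) (↔-sym +↔⊎)

finite-⊤ : Finite ⊤
finite-⊤ = 1 , ↔-sym 1↔⊤

finite-⊥ : Finite ⊥
finite-⊥ = 0 , ↔-sym 0↔⊥

finite-via : ∀ {X Y} → Y ↔ X → Finite X → Finite Y
finite-via f (m , g) = m , ↔-trans f g

finite-Fin : ∀ n → Finite (Fin n)
finite-Fin n = n , ↔-refl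

finite-Bool : Finite Bool
finite-Bool = finite-via
  (mk↔ₛ′ (λ { false → inj₁ tt ; true → inj₂ tt }) (λ { (inj₁ _) → false ; (inj₂ _) → true })
    (λ { (inj₁ _) → refl ; (inj₂ _) → refl }) (λ { false → refl ; true → refl }))
  (finite-⊎ finite-⊤ finite-⊤)

finite-response : ∀ {F : Maybe Bool → Set} → (∀ h → Finite (F h)) → Finite (Σ (Maybe Bool) F)
finite-response {F} fin = finite-via
  (mk↔ₛ′ (λ { (nothing , x) → inj₁ x ; (just false , x) → inj₂ (inj₁ x) ; (just true , x) → inj₂ (inj₂ x) })
    (λ { (inj₁ x) → nothing , x ; (inj₂ (inj₁ x)) → just false , x ; (inj₂ (inj₂ x)) → just true , x })
    (λ { (inj₁ _) → refl ; (inj₂ (inj₁ _)) → refl ; (inj₂ (inj₂ _)) → refl })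
    (λ { (nothing , _) → refl ; (just false , _) → refl ; (just true , _) → refl }))
  (finite-⊎ (fin nothing) (finite-⊎ (fin (just false)) (fin (just true))))

finite-≟ : ∀ {X} → Finite X → DecidableEquality X
finite-≟ (m , f) x y with Inverse.to f x Fin.≟ Inverse.to f y
... | yes eq = yes (trans (sym (Inverse.strictlyInverseʳ f x)) (trans (cong (Inverse.from f) eq) (Inverse.strictlyInverseʳ f y)))
... | no neq = no (neq ∘ cong (Inverse.to f))

data Path {X : Set} (f : X → Maybe X) : X → ℕ → X → Set where
  []  : ∀ {x} → Path f x 0 x
  _∷_ : ∀ {x y t z} → f x ≡ just y → Path f y t z → Path f x (suc t) z

_+++_ : ∀ {X : Set} {f : X → Maybe X} {x y z t t′} → Path f x t y → Path f y t′ z → Path f x (t + t′) z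
[]       +++ q = q
(e ∷ p) +++ q = e ∷ (p +++ q)

-- A stack is stored bottom up on a tape whose head scans the blank above the top.

symbolAt-writeAt : ∀ cs p s j → symbolAt (writeAt cs p s) j ≡ (if j ≡ᵇ p then s else symbolAt cs j)
symbolAt-writeAt []       zero    s zero    = refl
symbolAt-writeAt []       zero    s (suc j) = refl
symbolAt-writeAt []       (suc p) s zero    = refl
symbolAt-writeAt []       (suc p) s (suc j) = symbolAt-writeAt [] p s j
symbolAt-writeAt (c ∷ cs) zero    s zero    = refl
symbolAt-writeAt (c ∷ cs) zero    s (suc j) = refl
symbolAt-writeAt (c ∷ cs) (suc p) s zero    = refl
symbolAt-writeAt (c ∷ cs) (suc p) s (suc j) = symbolAt-writeAt cs p s j

≡ᵇ-refl : ∀ n → (n ≡ᵇ n) ≡ true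
≡ᵇ-refl zero    = refl
≡ᵇ-refl (suc n) = ≡ᵇ-refl n

≡ᵇ-true : ∀ m n → (m ≡ᵇ n) ≡ true → m ≡ n
≡ᵇ-true m n eq = ≡ᵇ⇒≡ m n (subst T (sym eq) tt)

≡ᵇ-false : ∀ {m n} → m ≢ n → (m ≡ᵇ n) ≡ false
≡ᵇ-false {m} {n} m≢n with m ≡ᵇ n in eq
... | true  = contradiction (≡ᵇ-true m n eq) m≢n
... | false = refl

stackAt : List Bool → ℕ → Symbol
stackAt []       j = blank
stackAt (b ∷ xs) j = if j ≡ᵇ length xs then bit b else stackAt xs j

stackAt-high : ∀ xs j → length xs ≤ j → stackAt xs j ≡ blank
stackAt-high []       j _   = refl
stackAt-high (b ∷ xs) j len rewrite ≡ᵇ-false (<⇒≢ len ∘ sym) = stackAt-high xs j (<⇒≤ len)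

-- Cells are compared through `symbolAt`, because lists of cells may differ in trailing blanks.
record Stack (xs : List Bool) (t : Tape) : Set where
  constructor stack
  field
    at-top : pos t ≡ length xs
    holds  : ∀ j → symbolAt (cells t) j ≡ stackAt xs j

-- The effect of an idle step: a machine writes on each of its writable tapes in every step, so the
-- scanned symbol is written back. This may lengthen the list of cells by blanks.
rest : Tape → Tape
rest t = writeMove t (scan t , stay)

cells-rest : ∀ t j → symbolAt (cells (rest t)) j ≡ symbolAt (cells t) j
cells-rest (mkTape cs p) j rewrite symbolAt-writeAt cs p (symbolAt cs p) j with j ≡ᵇ p in eq
... | true  = cong (symbolAt cs) (sym (≡ᵇ-true j p eq))
... | false = refl

stack-rest : ∀ {xs t} → Stack xs t → Stack xs (rest t)
stack-rest {t = t} (stack p h) = stack p (λ j → trans (cells-rest t j) (h j))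

stack-push : ∀ {xs t} b → Stack xs t → Stack (b ∷ xs) (writeMove t (bit b , right))
stack-push {xs} {mkTape cs p} b (stack refl h) = stack refl λ j →
  trans (symbolAt-writeAt cs p (bit b) j) (cong (λ z → if j ≡ᵇ length xs then bit b else z) (h j))

-- With an empty stack the head is on the leftmost cell, where a left move has no effect. It still
-- scans a blank afterwards, and this is how emptiness is detected.
stack-empty : ∀ {t} → Stack [] t → Stack [] (writeMove t (blank , left)) × scan (writeMove t (blank , left)) ≡ blank
stack-empty {mkTape cs p} (stack refl h) = stack refl blank-at , blank-at 0
  where
  blank-at : ∀ j → symbolAt (writeAt cs 0 blank) j ≡ blank
  blank-at j rewrite symbolAt-writeAt cs 0 blank j with j ≡ᵇ 0
  ... | true  = refl
  ... | false = h j

stack-pop : ∀ {b xs t} → Stack (b ∷ xs) t →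
  scan (writeMove t (blank , left)) ≡ bit b × Stack xs (writeMove (writeMove t (blank , left)) (blank , stay))
stack-pop {b} {xs} {mkTape cs p} (stack refl h) = top , stack refl below
  where
  cells≡ : ∀ j → symbolAt (writeAt cs (suc (length xs)) blank) j ≡ stackAt (b ∷ xs) j
  cells≡ j rewrite symbolAt-writeAt cs (suc (length xs)) blank j with j ≡ᵇ suc (length xs) in eq
  ... | true rewrite ≡ᵇ-true j (suc (length xs)) eq = sym (stackAt-high (b ∷ xs) (suc (length xs)) ≤-refl)
  ... | false = h j
  top : symbolAt (writeAt cs (suc (length xs)) blank) (length xs) ≡ bit b
  top rewrite cells≡ (length xs) | ≡ᵇ-refl (length xs) = refl
  below : ∀ j → symbolAt (writeAt (writeAt cs (suc (length xs)) blank) (length xs) blank) j ≡ stackAt xs j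
  below j rewrite symbolAt-writeAt (writeAt cs (suc (length xs)) blank) (length xs) blank j | cells≡ j with j ≡ᵇ length xs in eq
  ... | true rewrite ≡ᵇ-true j (length xs) eq = sym (stackAt-high xs (length xs) ≤-refl)
  ... | false = refl

nonempty : List Bool → Bool
nonempty []      = false
nonempty (_ ∷ _) = true

-- Computations stopped at acceptance

module _ (M : Computation) where
  open Computation M

  -- The result of a computation that is stopped as soon as it accepts.
  data Outcome : Config → ℕ → Bool → Set where
    accepts : ∀ {c} → accepting c ≡ true → Outcome c 0 true
    rejects : ∀ {c} → accepting c ≡ false → step c ≡ nothing → Outcome c 0 false
    steps   : ∀ {c c′ t b} → accepting c ≡ false → step c ≡ just c′ → Outcome c′ t b → Outcome c (suc t) b

  runFrom : Config → ℕ → Maybe Config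
  runFrom c zero    = just c
  runFrom c (suc t) = step c >>= λ c′ → runFrom c′ t

  runFrom-suc : ∀ c t → runFrom c (suc t) ≡ (runFrom c t >>= step)
  runFrom-suc c zero with step c
  ... | just _  = refl
  ... | nothing = refl
  runFrom-suc c (suc t) with step c
  ... | just c′ = runFrom-suc c′ t
  ... | nothing = refl

  configAfter≡ : ∀ t → configAfter t ≡ runFrom initial t
  configAfter≡ zero    = refl
  configAfter≡ (suc t) = trans (cong (_>>= step) (configAfter≡ t)) (sym (runFrom-suc initial t))

  outcome-stops : ∀ {c t b} → Outcome c t b →
    ∃[ c′ ] runFrom c t ≡ just c′ × (b ≡ true × T (accepting c′) ⊎ b ≡ false × step c′ ≡ nothing)
  outcome-stops (accepts acc) = _ , refl , inj₁ (refl , subst T (sym acc) tt)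
  outcome-stops (rejects _ stuck) = _ , refl , inj₂ (refl , stuck)
  outcome-stops (steps _ eq o) rewrite eq = outcome-stops o

  outcome-unique : ∀ {c t b} → Outcome c t b → ∀ t′ {c′} → runFrom c t′ ≡ just c′ → T (accepting c′) → b ≡ true
  outcome-unique (accepts _) t′ eq acc = refl
  outcome-unique (rejects nacc _) zero refl acc rewrite nacc = ⊥-elim acc
  outcome-unique (rejects _ stuck) (suc t′) eq acc rewrite stuck = case eq of λ ()
  outcome-unique (steps nacc _ _) zero refl acc rewrite nacc = ⊥-elim acc
  outcome-unique (steps _ st o) (suc t′) eq acc rewrite st = outcome-unique o t′ eq acc

  -- A run may continue after accepting, and a halting run may have accepted before. Cutting it at
  -- the first acceptance only shortens it.
  outcome-of : ∀ t c {c′} → runFrom c t ≡ just c′ → T (accepting c′) ⊎ step c′ ≡ nothing →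
    ∃[ t′ ] ∃[ b ] t′ ≤ t × Outcome c t′ b
  outcome-of t c eq end with accepting c in acc
  ... | true = 0 , true , z≤n , accepts acc
  outcome-of zero    c refl (inj₁ acc′)  | false rewrite acc = ⊥-elim acc′
  outcome-of zero    c refl (inj₂ stuck) | false = 0 , false , z≤n , rejects acc stuck
  outcome-of (suc t) c eq end | false with step c in st
  ... | nothing = 0 , false , z≤n , rejects acc st
  ... | just c₁ with outcome-of t c₁ eq end
  ...   | t′ , b , le , o = suc t′ , b , s≤s le , steps acc st o

  accepts⇔ : ∀ {t b} → Outcome initial t b → Accepts ⇔ T b
  accepts⇔ {t} {b} o = mk⇔
    (λ (t′ , c , eq , acc) → subst T (sym (outcome-unique o t′ (trans (sym (configAfter≡ t′)) eq) acc)) tt)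
    (λ Tb → let c , eq , end = outcome-stops o in
      t , c , trans (configAfter≡ t) eq , [ proj₂ , (λ (b≡ , _) → ⊥-elim (subst T b≡ Tb)) ]′ end)

  outcome-end : ∀ {t b} → Outcome initial t b → AcceptsAt t ⊎ HaltsAt t
  outcome-end {t} o with outcome-stops o
  ... | c , eq , inj₁ (_ , acc)   = inj₁ (c , trans (configAfter≡ t) eq , acc)
  ... | c , eq , inj₂ (_ , stuck) = inj₂ (c , trans (configAfter≡ t) eq , stuck)

  outcome-begin : ∀ {t} → AcceptsAt t ⊎ HaltsAt t → ∃[ t′ ] ∃[ b ] t′ ≤ t × Outcome initial t′ b
  outcome-begin {t} (inj₁ (c , eq , acc))   = outcome-of t initial (trans (sym (configAfter≡ t)) eq) (inj₁ acc)
  outcome-begin {t} (inj₂ (c , eq , stuck)) = outcome-of t initial (trans (sym (configAfter≡ t)) eq) (inj₂ stuck)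

-- The finite control that executes a command

module Machine (Sig : Signature) where

  open Signature Sig
  open Language Op arity
  open Commands Sig

  -- In a branch, `false` starts the pull and `true` inspects its effect. After that the response is
  -- part of the state while the chosen command runs.
  St : Cmd → Set
  St skip                   = ⊤
  St (push _ _)             = ⊤
  St (c ⨾ d)                = St c ⊎ St d
  St (branch src k again)   = Bool ⊎ Σ (Maybe Bool) (λ h → St (k h))

  finite-St : ∀ c → Finite (St c)
  finite-St skip                 = finite-⊤
  finite-St (push _ _)           = finite-⊤
  finite-St (c ⨾ d)              = finite-⊎ (finite-St c) (finite-St d)
  finite-St (branch src k again) = finite-⊎ finite-Bool (finite-response (λ h → finite-St (k h)))

  Act : Set
  Act = Maybe (Reg × Symbol × Move)

  entry : ∀ c → St c
  entry skip                 = tt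
  entry (push _ _)           = tt
  entry (c ⨾ d)              = inj₁ (entry c)
  entry (branch src k again) = inj₁ false

  fromSymbol : Symbol → Maybe Bool
  fromSymbol (bit b) = just b
  fromSymbol blank   = nothing

  pullAct : Source → Act
  pullAct (popped r) = just (r , blank , left)
  pullAct (asked o)  = nothing

  observe : Source → (Reg → Symbol) → (Op → Maybe Bool) → Maybe Bool
  observe (popped r) scanned answers = fromSymbol (scanned r)
  observe (asked o)  scanned answers = answers o

  eraseAct : Source → Maybe Bool → Act
  eraseAct (popped r) (just _) = just (r , blank , stay)
  eraseAct (popped r) nothing  = nothing
  eraseAct (asked o)  h        = nothing

  resume : ∀ src k again h → Maybe (St (k h)) → Maybe (St (branch src k again))
  resume src k again h (just x) = just (inj₂ (h , x))
  resume src k again h nothing  = if again h then just (inj₁ false) else nothing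

  exec : ∀ c → St c → (Reg → Symbol) → (Op → Maybe Bool) → Maybe (St c) × Act
  exec skip       x f g = nothing , nothing
  exec (push r b) x f g = nothing , just (r , bit b , right)
  exec (c ⨾ d) (inj₁ x) f g =
    maybe′ (just ∘ inj₁) (just (inj₂ (entry d))) (proj₁ (exec c x f g)) , proj₂ (exec c x f g)
  exec (c ⨾ d) (inj₂ y) f g = Maybe.map inj₂ (proj₁ (exec d y f g)) , proj₂ (exec d y f g)
  exec (branch src k again) (inj₁ false) f g = just (inj₁ true) , pullAct src
  exec (branch src k again) (inj₁ true)  f g =
    just (inj₂ (observe src f g , entry (k (observe src f g)))) , eraseAct src (observe src f g)
  exec (branch src k again) (inj₂ (h , x)) f g =
    resume src k again h (proj₁ (exec (k h) x f g)) , proj₂ (exec (k h) x f g)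

  -- There are infinitely many local registers but finitely many tapes; correctness is claimed for
  -- the registers below `N`.
  Ok : ℕ → Reg → Set
  Ok N (special a) = ⊤
  Ok N (local m)   = m < N

  OkCmd : ℕ → Cmd → Set
  OkCmd N skip       = ⊤
  OkCmd N (push r b) = Ok N r
  OkCmd N (c ⨾ d)    = OkCmd N c × OkCmd N d
  OkCmd N (branch (popped r) k again) = Ok N r × (∀ h → OkCmd N (k h))
  OkCmd N (branch (asked o)  k again) = ∀ h → OkCmd N (k h)

  regWidth : Reg → ℕ
  regWidth (special a) = 0
  regWidth (local m)   = suc m

  sourceWidth : Source → ℕ
  sourceWidth (popped r) = regWidth r
  sourceWidth (asked o)  = 0

  width : Cmd → ℕ
  width skip       = 0
  width (push r b) = regWidth r
  width (c ⨾ d)    = width c + width d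
  width (branch src k again) =
    sourceWidth src + (width (k nothing) + (width (k (just false)) + width (k (just true))))

  ok-reg : ∀ r {N} → regWidth r ≤ N → Ok N r
  ok-reg (special a) _ = tt
  ok-reg (local m)   h = h

  ok-cmd : ∀ c {N} → width c ≤ N → OkCmd N c
  ok-cmd skip       h = tt
  ok-cmd (push r b) h = ok-reg r h
  ok-cmd (c ⨾ d)    h = ok-cmd c (m+n≤o⇒m≤o _ h) , ok-cmd d (m+n≤o⇒n≤o (width c) h)
  ok-cmd (branch src k again) {N} h = go src (m+n≤o⇒m≤o _ h) (responses (m+n≤o⇒n≤o (sourceWidth src) h))
    where
    responses : width (k nothing) + (width (k (just false)) + width (k (just true))) ≤ N → ∀ h → OkCmd N (k h)
    responses le nothing      = ok-cmd (k nothing) (m+n≤o⇒m≤o _ le)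
    responses le (just false) = ok-cmd (k (just false)) (m+n≤o⇒m≤o _ (m+n≤o⇒n≤o (width (k nothing)) le))
    responses le (just true)  = ok-cmd (k (just true)) (m+n≤o⇒n≤o (width (k (just false))) (m+n≤o⇒n≤o (width (k nothing)) le))
    go : ∀ src → sourceWidth src ≤ N → (∀ h → OkCmd N (k h)) → OkCmd N (branch src k again)
    go (popped r) le ks = ok-reg r le , ks
    go (asked o)  le ks = ks

  -- All that the correctness of the control uses of a machine, so that both kinds of machine are
  -- instances. `Coherent` is an invariant on which the answers may depend: it is trivial for random
  -- access, and for direct access it describes the value- and constant-tapes.
  record Realization (N : ℕ) (R : Streams) : Set₁ where
    field
      World     : Set
      tapeIn    : World → Reg → Tape
      scannedIn : World → Reg → Symbol
      answersIn : World → Op → Maybe Bool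
      perform   : Act → World → World
      Coherent  : World → Set
      scanned   : ∀ w r → scannedIn w r ≡ scan (tapeIn w r)
      tape-hit  : ∀ r a w → Ok N r → tapeIn (perform (just (r , a)) w) r ≡ writeMove (tapeIn w r) a
      tape-miss : ∀ r a w r′ → Ok N r → Ok N r′ → r ≢ r′ → tapeIn (perform (just (r , a)) w) r′ ≡ rest (tapeIn w r′)
      tape-none : ∀ w r′ → Ok N r′ → tapeIn (perform nothing w) r′ ≡ rest (tapeIn w r′)
      coherent  : ∀ a w → Coherent w → Coherent (perform a w)
      answer-ok : ∀ s w → Coherent w → (∀ r → Ok N r → Stack (s r) (tapeIn w r)) →
                  ∀ o → answersIn w o ≡ answer R s o

  -- Besides those of the command: 0 prepares the tapes, 1 and 2 test the
  -- result register, 3 accepts and 4 rejects.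
  Control : Set → Set
  Control X = X ⊎ Fin 5

  accept : ∀ {X} → Control X
  accept = inj₂ (suc (suc (suc zero)))

  reject : ∀ {X} → Control X
  reject = inj₂ (suc (suc (suc (suc zero))))

  isAccept : ∀ {X} → Control X → Bool
  isAccept (inj₂ (suc (suc (suc zero)))) = true
  isAccept _                             = false

  leave : ∀ {X} → Maybe X → Control X
  leave (just x) = inj₁ x
  leave nothing  = inj₂ (suc zero)

  verdictState : ∀ {X} → Symbol → Control X
  verdictState (bit _) = accept
  verdictState blank   = reject

  control : ∀ c → ℕ → Act → Control (St c) → (Reg → Symbol) → (Op → Maybe Bool) → Maybe (Control (St c) × Act)
  control c res prep (inj₁ x) f g = just (leave (proj₁ (exec c x f g)) , proj₂ (exec c x f g))
  control c res prep (inj₂ zero) f g = just (inj₁ (entry c) , prep)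
  control c res prep (inj₂ (suc zero)) f g = just (inj₂ (suc (suc zero)) , just (local res , blank , left))
  control c res prep (inj₂ (suc (suc zero))) f g = just (verdictState (f (local res)) , nothing)
  control c res prep (inj₂ (suc (suc (suc _)))) f g = nothing

  module Run {N R} (Real : Realization N R) where
    open Realization Real

    record Inv (s : Store) (w : World) : Set where
      constructor inv
      field
        coh    : Coherent w
        stacks : ∀ r → Ok N r → Stack (s r) (tapeIn w r)
    open Inv

    inv-≗ : ∀ {s u w} → s ≗ u → Inv s w → Inv u w
    inv-≗ h (inv c st) = inv c (λ r ok → subst (λ xs → Stack xs (tapeIn _ r)) (h r) (st r ok))

    inv-none : ∀ {s w} → Inv s w → Inv s (perform nothing w)
    inv-none {w = w} (inv c st) = inv (coherent nothing w c)
      (λ r ok → subst (Stack _) (sym (tape-none w r ok)) (stack-rest (st r ok)))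

    inv-act : ∀ {s w} r a {xs} → Ok N r → Inv s w → Stack xs (writeMove (tapeIn w r) a) →
      Inv (s [ r ≔ xs ]) (perform (just (r , a)) w)
    inv-act {s} {w} r a {xs} okr (inv c st) new = inv (coherent _ w c) st′
      where
      st′ : ∀ r′ → Ok N r′ → Stack ((s [ r ≔ xs ]) r′) (tapeIn (perform (just (r , a)) w) r′)
      st′ r′ ok with r ≟ᴿ r′
      ... | yes refl = subst (Stack xs) (sym (tape-hit r a w okr)) new
      ... | no r≢r′  = subst (Stack (s r′)) (sym (tape-miss r a w r′ okr ok r≢r′)) (stack-rest (st r′ ok))

    -- Popping takes two steps: the first one only moves the head.
    inv-pop : ∀ {s w} r {b xs} → Ok N r → Inv s w → s r ≡ b ∷ xs →
      let w′ = perform (just (r , blank , left)) w in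
      scannedIn w′ r ≡ bit b × Inv (s [ r ≔ xs ]) (perform (just (r , blank , stay)) w′)
    inv-pop {s} {w} r {b} {xs} okr (inv c st) eq =
      trans (scanned _ r) (trans (cong scan (tape-hit r _ w okr)) (proj₁ popped′)) ,
      inv (coherent _ _ (coherent _ w c)) st′
      where
      w′ = perform (just (r , blank , left)) w
      popped′ = stack-pop (subst (λ z → Stack z (tapeIn w r)) eq (st r okr))
      st′ : ∀ r′ → Ok N r′ → Stack ((s [ r ≔ xs ]) r′) (tapeIn (perform (just (r , blank , stay)) w′) r′)
      st′ r′ ok with r ≟ᴿ r′
      ... | yes refl = subst (Stack xs) (sym (trans (tape-hit r _ w′ okr) (cong (λ z → writeMove z (blank , stay)) (tape-hit r _ w okr)))) (proj₂ popped′)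
      ... | no r≢r′  = subst (Stack (s r′)) (sym (trans (tape-miss r _ w′ r′ okr ok r≢r′) (cong rest (tape-miss r _ w r′ okr ok r≢r′))))
                         (stack-rest (stack-rest (st r′ ok)))

    inv-empty : ∀ {s w} r → Ok N r → Inv s w → s r ≡ [] →
      let w′ = perform (just (r , blank , left)) w in scannedIn w′ r ≡ blank × Inv s (perform nothing w′)
    inv-empty {s} {w} r okr i eq =
      trans (scanned _ r) (trans (cong scan (tape-hit r _ w okr)) (proj₂ emptied)) ,
      inv-none (inv-≗ (λ r′ → upd-elim s r s (sym eq) (λ _ _ → refl) r′) (inv-act r (blank , left) okr i (proj₁ emptied)))
      where emptied = stack-empty (subst (λ z → Stack z (tapeIn w r)) eq (i .stacks r okr))

    pulled : ∀ {src k again s w h u} → OkCmd N (branch src k again) → Inv s w → Pull R s src h u →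
      let w′ = perform (pullAct src) w in
      observe src (scannedIn w′) (answersIn w′) ≡ h × Inv u (perform (eraseAct src h) w′)
    pulled {popped r} (okr , _) i (empty eq) = let p , q = inv-empty r okr i eq in cong fromSymbol p , q
    pulled {popped r} (okr , _) i (top eq)   = let p , q = inv-pop r okr i eq in cong fromSymbol p , q
    pulled {asked o} {s = s} ok i reply =
      answer-ok s _ (inv-none i .coh) (inv-none i .stacks) o , inv-none (inv-none i)

    module _ {X : Set} (next′ : X × World → Maybe (X × World)) where

      -- `ι` embeds the states of a subcommand into those of the whole machine, and `ι nothing` is
      -- where control goes when the subcommand has finished. Passing to a part of a command only
      -- changes `ι`, so the induction need not mention the surrounding command.
      Follows : ∀ c → (Maybe (St c) → X) → Set
      Follows c ι = ∀ x w → next′ (ι (just x) , w) ≡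
        just (ι (proj₁ (exec c x (scannedIn w) (answersIn w))) , perform (proj₂ (exec c x (scannedIn w) (answersIn w))) w)

      Reaches : X × World → X → Store → ℕ → Set
      Reaches xw y u t = ∃[ t′ ] ∃[ w′ ] t′ ≤ t × Path next′ xw t′ (y , w′) × Inv u w′

      reach-then : ∀ {xw y u t z v t″} → Reaches xw y u t → (∀ w → Inv u w → Reaches (y , w) z v t″) →
        Reaches xw z v (t + t″)
      reach-then (t₁ , w₁ , le₁ , p₁ , i₁) k with k w₁ i₁
      ... | t₂ , w₂ , le₂ , p₂ , i₂ = t₁ + t₂ , w₂ , +-mono-≤ le₁ le₂ , p₁ +++ p₂ , i₂

      exec-path : ∀ {c s u t} → Exec R c s u t → OkCmd N c → ∀ ι → Follows c ι → ∀ w → Inv s w →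
        Reaches (ι (just (entry c)) , w) (ι nothing) u t
      branch-path : ∀ {src k again s h u v t} → Pull R s src h u → Exec R (k h) u v t →
        OkCmd N (branch src k again) → ∀ ι → Follows (branch src k again) ι → ∀ w → Inv s w →
        Reaches (ι (just (inj₁ false)) , w) (ι (if again h then just (inj₁ false) else nothing)) v (2 + t)

      exec-path skip ok ι fol w i = 1 , _ , ≤-refl , fol tt w ∷ [] , inv-none i
      exec-path (push {r = r} {b}) ok ι fol w i =
        1 , _ , ≤-refl , fol tt w ∷ [] , inv-act r (bit b , right) ok i (stack-push b (i .stacks r ok))
      exec-path (_⨾_ {c} {d} x y) (okc , okd) ι fol w i =
        reach-then (exec-path x okc ι₁ fol₁ w i) (λ w′ i′ → exec-path y okd ι₂ fol₂ w′ i′)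
        where
        ι₁ : Maybe (St c) → X
        ι₁ m = ι (maybe′ (just ∘ inj₁) (just (inj₂ (entry d))) m)
        ι₂ : Maybe (St d) → X
        ι₂ m = ι (Maybe.map inj₂ m)
        fol₁ : Follows c ι₁
        fol₁ x w = fol (inj₁ x) w
        fol₂ : Follows d ι₂
        fol₂ x w = fol (inj₂ x) w
      exec-path (exit {src} {k} {again} {h} p stop x) ok ι fol w i =
        subst (λ z → Reaches _ (ι z) _ _) (cong (λ z → if z then just (inj₁ false) else nothing) stop)
          (branch-path {src} {k} {again} p x ok ι fol w i)
      exec-path (next {src} {k} {again} {h} p go x y) ok ι fol w i =
        reach-then (subst (λ z → Reaches _ (ι z) _ _) (cong (λ z → if z then just (inj₁ false) else nothing) go)
                     (branch-path {src} {k} {again} p x ok ι fol w i))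
          (λ w′ i′ → exec-path y ok ι fol w′ i′)
      exec-path (conv h h′ le x) ok ι fol w i with exec-path x ok ι fol w (inv-≗ h i)
      ... | t′ , w′ , le′ , p , i′ = t′ , w′ , ≤-trans le′ le , p , inv-≗ h′ i′

      branch-path {src} {k} {again} {h = h} p x ok ι fol w i with pulled {src} {k} {again} ok i p
      ... | obs , i₂ =
        reach-then (2 , w₂ , ≤-refl , fol (inj₁ false) w ∷ second ∷ [] , i₂)
          (λ w′ i′ → exec-path x (oks src ok) ι′ (λ y w → fol (inj₂ (h , y)) w) w′ i′)
        where
        w₁ = perform (pullAct src) w
        w₂ = perform (eraseAct src h) w₁
        ι′ : Maybe (St (k h)) → X
        ι′ m = ι (resume src k again h m)
        second : next′ (ι (just (inj₁ true)) , w₁) ≡ just (ι (just (inj₂ (h , entry (k h)))) , w₂)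
        second = trans (fol (inj₁ true) w₁)
          (cong (λ z → just (ι (just (inj₂ (z , entry (k z)))) , perform (eraseAct src z) w₁)) obs)
        oks : ∀ src → OkCmd N (branch src k again) → OkCmd N (k h)
        oks (popped r) (_ , ks) = ks h
        oks (asked o)  ks       = ks h

  module Compiled (command : Cmd) where

    #locals : ℕ
    -- Registers 0 and 1, the flag and the result, get tapes in any case.
    #locals = 2 + width command

    finite-Control : Finite (Control (St command))
    finite-Control = finite-⊎ (finite-St command) (finite-Fin 5)

    module Behaviour {R : Streams} (Real : Realization #locals R) (prep : Act) where
      open Realization Real
      open Run Real
      open Inv

      advance : Control (St command) × World → Maybe (Control (St command) × World)
      advance (q , w) = Maybe.map (λ (q′ , a) → q′ , perform a w) (control command 1 prep q (scannedIn w) (answersIn w))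

      verdictFor : List Bool → Control (St command)
      verdictFor []      = reject
      verdictFor (_ ∷ _) = accept

      -- The three additional steps are one for the preparation of the tapes and two for testing the
      -- result register.
      machine-path : ∀ {w u t} → Inv (λ _ → []) (perform prep w) → Exec R command (λ _ → []) u t →
        ∃[ t′ ] ∃[ w′ ] t′ ≤ 3 + t × Path advance (inj₂ zero , w) t′ (verdictFor (u (local 1)) , w′)
      machine-path {w} {u} {t} i ex with exec-path advance ex (ok-cmd command (m≤n+m (width command) 2)) leave (λ x w → refl) _ i
      ... | t₁ , w₁ , le , p , i₁ with u (local 1) in eq
      ...   | [] = suc (t₁ + 2) , _ , s≤s (≤-trans (+-monoˡ-≤ 2 le) (≤-reflexive (+-comm t 2))) , refl ∷ (p +++ (refl ∷ second ∷ []))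
        where
        w₂ = perform (just (local 1 , blank , left)) w₁
        second : advance (inj₂ (suc (suc zero)) , w₂) ≡ just (reject , perform nothing w₂)
        second rewrite proj₁ (inv-empty (local 1) (s≤s (s≤s z≤n)) i₁ eq) = refl
      ...   | b ∷ bs = suc (t₁ + 2) , _ , s≤s (≤-trans (+-monoˡ-≤ 2 le) (≤-reflexive (+-comm t 2))) , refl ∷ (p +++ (refl ∷ second ∷ []))
        where
        w₂ = perform (just (local 1 , blank , left)) w₁
        second : advance (inj₂ (suc (suc zero)) , w₂) ≡ just (accept , perform nothing w₂)
        second rewrite proj₁ (inv-pop (local 1) (s≤s (s≤s z≤n)) i₁ eq) = refl

      module _ (M : Computation) (conf : Control (St command) × World → Computation.Config M)
        (step≡ : ∀ x → Computation.step M (conf x) ≡ Maybe.map conf (advance x))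
        (acc≡ : ∀ x → Computation.accepting M (conf x) ≡ isAccept (proj₁ x)) where

        path-outcome : ∀ {x t xs w} → Path advance x t (verdictFor xs , w) → Outcome M (conf x) t (nonempty xs)
        path-outcome {xs = []}     [] = rejects (acc≡ _) (step≡ _)
        path-outcome {xs = _ ∷ _}  [] = accepts (acc≡ _)
        path-outcome {x} (eq ∷ p) = steps (trans (acc≡ x) (active x eq)) (trans (step≡ x) (cong (Maybe.map conf) eq)) (path-outcome p)
          where
          active : ∀ x {y} → advance x ≡ just y → isAccept (proj₁ x) ≡ false
          active (inj₁ _ , _) _ = refl
          active (inj₂ zero , _) _ = refl
          active (inj₂ (suc zero) , _) _ = refl
          active (inj₂ (suc (suc zero)) , _) _ = refl
          active (inj₂ (suc (suc (suc _))) , _) ()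

symbolAt-∷ʳ : ∀ cs s j → symbolAt (cs ++ s ∷ []) j ≡ (if j ≡ᵇ length cs then s else symbolAt cs j)
symbolAt-∷ʳ []       s zero    = refl
symbolAt-∷ʳ []       s (suc j) = refl
symbolAt-∷ʳ (c ∷ cs) s zero    = refl
symbolAt-∷ʳ (c ∷ cs) s (suc j) = symbolAt-∷ʳ cs s j

stackAt-reverse : ∀ xs j → stackAt xs j ≡ symbolAt (List.map bit (reverse xs)) j
stackAt-reverse []       j = refl
stackAt-reverse (b ∷ xs) j rewrite unfold-reverse b xs | map-++ bit (reverse xs) (b ∷ [])
  | symbolAt-∷ʳ (List.map bit (reverse xs)) (bit b) j | length-map bit (reverse xs) | length-reverse xs
  | stackAt-reverse xs j = refl

leadingBits-unique : ∀ cs ys → (∀ j → symbolAt cs j ≡ symbolAt (List.map bit ys) j) → leadingBits cs ≡ ys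
leadingBits-unique []             []       h = refl
leadingBits-unique []             (y ∷ ys) h = case h 0 of λ ()
leadingBits-unique (bit b ∷ cs)   []       h = case h 0 of λ ()
leadingBits-unique (bit b ∷ cs)   (y ∷ ys) h with h 0
... | refl = cong (b ∷_) (leadingBits-unique cs ys (h ∘ suc))
leadingBits-unique (blank ∷ cs)   []       h = refl
leadingBits-unique (blank ∷ cs)   (y ∷ ys) h = case h 0 of λ ()

-- The bottom of the stack is the leftmost cell and therefore the most significant bit; the list
-- `xs` starts at the top.
stack-number : ∀ {xs t} → Stack xs t → numberOn t ≡ fromBits (reverse xs)
stack-number {xs} {t} (stack _ h) =
  cong fromBits (leadingBits-unique (cells t) (reverse xs) (λ j → trans (h j) (stackAt-reverse xs j)))

stack-blank : Stack [] blankTape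
stack-blank = stack refl (λ j → refl)

clip : ∀ N → ℕ → Fin (suc N)
clip zero    _       = zero
clip (suc N) zero    = zero
clip (suc N) (suc m) = suc (clip N m)

toℕ-clip : ∀ {N m} → m ≤ N → toℕ (clip N m) ≡ m
toℕ-clip {zero}  z≤n     = refl
toℕ-clip {suc N} z≤n     = refl
toℕ-clip {suc N} (s≤s h) = cong suc (toℕ-clip h)

-- Commands on random-access machines

actionAt : ∀ {k} → Fin k → Symbol × Move → (Fin k → Symbol) → Fin k → Symbol × Move
actionAt i a scanned j = if does (i Fin.≟ j) then a else (scanned j , stay)

inputBits : InputSymbol → List Bool
inputBits (symbol (bit b)) = b ∷ []
inputBits (symbol blank)   = []
inputBits ◁                = []

raSignature : Signature
raSignature = record
  { Special = ⊤ ; _≟ˢ_ = λ _ _ → yes refl ; Op = ⊤ ; arity = λ _ → 1 ; addr = λ _ _ → tt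
  ; addr-injective = λ { _ {zero} {zero} _ → refl } ; mirror = λ _ → nothing ; mirror≢addr = λ _ () }

-- Past the end of the input the reply is empty, so a query also tells whether an address lies
-- within the input.
raStreams : List Bool → Language.Semantics ⊤ (λ _ → 1)
raStreams input _ (x ∷ []) = inputBits (inputAt input (fromBits (reverse x)))

inputBits≤1 : ∀ s → length (inputBits s) ≤ 1
inputBits≤1 (symbol (bit _)) = ≤-refl
inputBits≤1 (symbol blank)   = z≤n
inputBits≤1 ◁                = z≤n

raSingle : ∀ input o → nothing {A = ⊤} ≡ nothing → ∀ xs → length (raStreams input o xs) ≤ 1
raSingle input _ _ (x ∷ []) = inputBits≤1 (inputAt input (fromBits (reverse x)))

module RandomAccess (command : Commands.Cmd raSignature) where

  open Language ⊤ (λ _ → 1)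
  open Commands raSignature
  open Machine raSignature
  open Compiled command

  tapeIndex : Reg → Fin (2 + #locals)
  tapeIndex (special _) = zero
  tapeIndex (local m)   = suc (clip #locals m)

  tapeIndex-injective : ∀ r r′ → Ok #locals r → Ok #locals r′ → tapeIndex r ≡ tapeIndex r′ → r ≡ r′
  tapeIndex-injective (special _) (special _) _ _ _ = refl
  tapeIndex-injective (local m) (local m′) ok ok′ eq = cong local
    (trans (sym (toℕ-clip (<⇒≤ ok))) (trans (cong toℕ (Fin.suc-injective eq)) (toℕ-clip (<⇒≤ ok′))))

  actions : Act → Vec Symbol (2 + #locals) → Vec (Symbol × Move) (2 + #locals)
  actions nothing        syms = Vec.map (_, stay) syms
  actions (just (r , a)) syms = Vec.tabulate (actionAt (tapeIndex r) a (Vec.lookup syms))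

  machine : RandomAccessTM
  machine = record
    { State  = Control (St command)
    ; finite = finite-Control
    ; q₀     = inj₂ zero
    ; final  = isAccept
    ; #work  = suc #locals
    ; δ      = λ q i syms → Maybe.map (λ (q′ , a) → q′ , actions a syms)
        (control command 1 prep q (Vec.lookup syms ∘ tapeIndex) (λ _ → List.head (inputBits i)))
    }
    module machine where
    prep : Act
    -- Erases the 0 that the address-tape holds initially, so that its register starts as the empty
    -- stack.
    prep = just (special tt , blank , stay)

  World′ : Set
  World′ = Vec Tape (2 + #locals)

  lookup-perform : ∀ a (ts : World′) i →
    Vec.lookup (Vec.zipWith writeMove ts (actions a (Vec.map scan ts))) i ≡
    writeMove (Vec.lookup ts i) (Vec.lookup (actions a (Vec.map scan ts)) i)
  lookup-perform a ts i = lookup-zipWith writeMove i ts (actions a (Vec.map scan ts))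

  module _ (input : List Bool) where

    realization : Realization #locals (raStreams input)
    realization = record
      { World     = World′
      ; tapeIn    = λ ts r → Vec.lookup ts (tapeIndex r)
      ; scannedIn = λ ts r → Vec.lookup (Vec.map scan ts) (tapeIndex r)
      ; answersIn = λ ts _ → List.head (inputBits (inputAt input (numberOn (Vec.head ts))))
      ; perform   = λ a ts → Vec.zipWith writeMove ts (actions a (Vec.map scan ts))
      ; Coherent  = λ _ → ⊤
      ; scanned   = λ ts r → lookup-map (tapeIndex r) scan ts
      ; tape-hit  = λ r a ts _ → trans (lookup-perform (just (r , a)) ts (tapeIndex r))
          (cong (writeMove _) (trans (lookup∘tabulate (actionAt (tapeIndex r) a (Vec.lookup (Vec.map scan ts))) (tapeIndex r)) (hit r a ts)))
      ; tape-miss = λ r a ts r′ ok ok′ r≢r′ → trans (lookup-perform (just (r , a)) ts (tapeIndex r′))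
          (cong (writeMove _) (trans (lookup∘tabulate (actionAt (tapeIndex r) a (Vec.lookup (Vec.map scan ts))) (tapeIndex r′)) (miss r a ts r′ (r≢r′ ∘ tapeIndex-injective r r′ ok ok′))))
      ; tape-none = λ ts r′ _ → trans (lookup-perform nothing ts (tapeIndex r′))
          (cong (writeMove _) (trans (lookup-map (tapeIndex r′) (_, stay) (Vec.map scan ts))
            (cong (_, stay) (lookup-map (tapeIndex r′) scan ts))))
      ; coherent  = λ _ _ _ → tt
      ; answer-ok = λ { s (t ∷ ts) _ st _ → cong (λ n → List.head (inputBits (inputAt input n))) (stack-number (st (special tt) tt)) }
      }
      where
      hit : ∀ r a (ts : World′) → actionAt (tapeIndex r) a (Vec.lookup (Vec.map scan ts)) (tapeIndex r) ≡ a
      hit r a ts with tapeIndex r Fin.≟ tapeIndex r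
      ... | yes _ = refl
      ... | no ¬p = contradiction refl ¬p
      miss : ∀ r a (ts : World′) r′ → tapeIndex r ≢ tapeIndex r′ →
        actionAt (tapeIndex r) a (Vec.lookup (Vec.map scan ts)) (tapeIndex r′) ≡ (scan (Vec.lookup ts (tapeIndex r′)) , stay)
      miss r a ts r′ neq with tapeIndex r Fin.≟ tapeIndex r′
      ... | yes eq = contradiction eq neq
      ... | no _   = cong (_, stay) (lookup-map (tapeIndex r′) scan ts)

    open Run realization
    open Behaviour realization machine.prep
    open Realization realization using (perform; tape-hit; tape-miss)

    initialTapes : World′
    initialTapes = tapeOf (false ∷ []) ∷ Vec.replicate (suc #locals) blankTape

    prepared : Inv (λ _ → []) (perform machine.prep initialTapes)
    prepared = inv tt λ where
        (special tt) ok → subst (Stack []) (sym (tape-hit (special tt) (blank , stay) initialTapes tt)) (stack refl blanks)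
        (local m)    ok → subst (Stack []) (sym (tape-miss (special tt) (blank , stay) initialTapes (local m) tt ok (λ ())))
          (stack-rest (subst (Stack []) (sym (lookup-replicate (clip #locals m) blankTape)) stack-blank))
      where
      blanks : ∀ j → symbolAt (blank ∷ []) j ≡ blank
      blanks zero    = refl
      blanks (suc j) = refl

    computation : Computation
    computation = RandomAccessTM.computation machine input

    conf : Control (St command) × World′ → Computation.Config computation
    conf (q , w) = mkConfig q w

    step≡ : ∀ x → Computation.step computation (conf x) ≡ Maybe.map conf (advance x)
    step≡ (q , w) with control command 1 machine.prep q (Vec.lookup (Vec.map scan w) ∘ tapeIndex)
      (λ _ → List.head (inputBits (inputAt input (numberOn (Vec.head w)))))
    ... | just _  = refl
    ... | nothing = refl

    outcome : ∀ {u t} → Exec (raStreams input) command (λ _ → []) u t →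
      ∃[ t′ ] t′ ≤ 3 + t × Outcome computation (Computation.initial computation) t′ (nonempty (u (local 1)))
    outcome ex with machine-path prepared ex
    ... | t′ , w , t′≤ , p = t′ , t′≤ , path-outcome computation conf step≡ (λ _ → refl) p

-- Commands on direct-access machines

infix 4 _∋_
data _∋_ : List ℕ → ℕ → Set where
  here  : ∀ {r rs} → (r ∷ rs) ∋ r
  there : ∀ {r r′ rs} → rs ∋ r → (r′ ∷ rs) ∋ r

-- The disjoint union of `P r` over the positions of a list of arities. `Ix Fin` names the
-- address-tapes of all symbols, and `Ix (const ⊤)` the symbols, hence the value-tapes.
Ix : (ℕ → Set) → List ℕ → Set
Ix P []       = ⊥
Ix P (r ∷ rs) = P r ⊎ Ix P rs

sub : ∀ {P rs r} → rs ∋ r → P r → Ix P rs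
sub here      x = inj₁ x
sub (there p) x = inj₂ (sub p x)

sub-injective : ∀ {P rs r} (p : rs ∋ r) {x y : P r} → sub {P} p x ≡ sub p y → x ≡ y
sub-injective here      refl = refl
sub-injective {P} (there p) eq = sub-injective {P} p (inj₂-injective eq)

finite-Ix : ∀ {P} → (∀ r → Finite (P r)) → ∀ rs → Finite (Ix P rs)
finite-Ix fin []       = finite-⊥
finite-Ix fin (r ∷ rs) = finite-⊎ (fin r) (finite-Ix fin rs)

lookupAll : ∀ {Q : ℕ → Set} {rs r} → All Q rs → rs ∋ r → Q r
lookupAll (x ∷ xs) here      = x
lookupAll (x ∷ xs) (there p) = lookupAll xs p

tabulateAll : ∀ {Q : ℕ → Set} rs → (∀ {r} → rs ∋ r → Q r) → All Q rs
tabulateAll []       f = []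
tabulateAll (r ∷ rs) f = f here ∷ tabulateAll rs (λ p → f (there p))

lookupAll-tabulate : ∀ {Q : ℕ → Set} rs (f : ∀ {r} → rs ∋ r → Q r) {r} (p : rs ∋ r) → lookupAll (tabulateAll {Q} rs f) p ≡ f p
lookupAll-tabulate (r ∷ rs) f here      = refl
lookupAll-tabulate (r ∷ rs) f (there p) = lookupAll-tabulate rs (λ p → f (there p)) p

lookupAll-map : ∀ {P Q : ℕ → Set} (f : ∀ {r} → P r → Q r) {rs} (xs : All P rs) {r} (p : rs ∋ r) →
  lookupAll (All.map f xs) p ≡ f (lookupAll xs p)
lookupAll-map f (x ∷ xs) here      = refl
lookupAll-map f (x ∷ xs) (there p) = lookupAll-map f xs p

lookupAll-zipWith : ∀ {P Q R : ℕ → Set} (f : ∀ {r} → P r × Q r → R r) {rs} (xs : All P rs) (ys : All Q rs) {r} (p : rs ∋ r) →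
  lookupAll (All.zipWith f (xs , ys)) p ≡ f (lookupAll xs p , lookupAll ys p)
lookupAll-zipWith f (x ∷ xs) (y ∷ ys) here      = refl
lookupAll-zipWith f (x ∷ xs) (y ∷ ys) (there p) = lookupAll-zipWith f xs ys p

lookupAll-universal : ∀ {Q : ℕ → Set} (f : ∀ r → Q r) rs {r} (p : rs ∋ r) → lookupAll (All.universal f rs) p ≡ f r
lookupAll-universal f (r ∷ rs) here      = refl
lookupAll-universal f (r ∷ rs) (there p) = lookupAll-universal f rs p

lookupIx : ∀ {X : Set} {rs} → All (Vec X) rs → Ix Fin rs → X
lookupIx (x ∷ xs) (inj₁ i)  = Vec.lookup x i
lookupIx (x ∷ xs) (inj₂ ix) = lookupIx xs ix

tabulateIx : ∀ {X : Set} rs → (Ix Fin rs → X) → All (Vec X) rs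
tabulateIx []       f = []
tabulateIx (r ∷ rs) f = Vec.tabulate (f ∘ inj₁) ∷ tabulateIx rs (f ∘ inj₂)

lookupIx-tabulate : ∀ {X : Set} rs (f : Ix Fin rs → X) ix → lookupIx (tabulateIx rs f) ix ≡ f ix
lookupIx-tabulate (r ∷ rs) f (inj₁ i)  = lookup∘tabulate (f ∘ inj₁) i
lookupIx-tabulate (r ∷ rs) f (inj₂ ix) = lookupIx-tabulate rs (f ∘ inj₂) ix

lookupIx-map : ∀ {X Y : Set} (f : X → Y) {rs} (xs : All (Vec X) rs) ix → lookupIx (All.map (Vec.map f) xs) ix ≡ f (lookupIx xs ix)
lookupIx-map f (x ∷ xs) (inj₁ i)  = lookup-map i f x
lookupIx-map f (x ∷ xs) (inj₂ ix) = lookupIx-map f xs ix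

lookupIx-zipWith : ∀ {X Y Z : Set} (f : X → Y → Z) {rs} (xs : All (Vec X) rs) (ys : All (Vec Y) rs) ix →
  lookupIx (All.zipWith (uncurry (Vec.zipWith f)) (xs , ys)) ix ≡ f (lookupIx xs ix) (lookupIx ys ix)
lookupIx-zipWith f (x ∷ xs) (y ∷ ys) (inj₁ i)  = lookup-zipWith f i x y
lookupIx-zipWith f (x ∷ xs) (y ∷ ys) (inj₂ ix) = lookupIx-zipWith f xs ys ix

lookupIx-sub : ∀ {X : Set} {rs r} (xs : All (Vec X) rs) (p : rs ∋ r) i → lookupIx xs (sub p i) ≡ Vec.lookup (lookupAll xs p) i
lookupIx-sub (x ∷ xs) here      i = refl
lookupIx-sub (x ∷ xs) (there p) i = lookupIx-sub xs p i

lookupIx-blank : ∀ {X : Set} (x : X) rs ix → lookupIx (All.universal (λ r → Vec.replicate r x) rs) ix ≡ x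
lookupIx-blank x (r ∷ rs) (inj₁ i)  = lookup-replicate i x
lookupIx-blank x (r ∷ rs) (inj₂ ix) = lookupIx-blank x rs ix

vec-ext : ∀ {X : Set} {n} {xs ys : Vec X n} → (∀ i → Vec.lookup xs i ≡ Vec.lookup ys i) → xs ≡ ys
vec-ext {xs = []}     {[]}     h = refl
vec-ext {xs = x ∷ xs} {y ∷ ys} h = cong₂ _∷_ (h zero) (vec-ext (h ∘ suc))

module _ (σ : Vocabulary) where

  data Query : Set where
    relationOf : ∀ {r} → relArities σ ∋ r → Query
    functionOf : ∀ {k} → funArities σ ∋ k → Query
    constantOf : Fin (suc (#constants σ)) → Query

  queryArity : Query → ℕ
  queryArity (relationOf {r} _) = r
  queryArity (functionOf {k} _) = k
  queryArity (constantOf _)     = 0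

  Mirror : Set
  Mirror = Ix (const ⊤) (funArities σ) ⊎ Fin (suc (#constants σ))

  DASpecial : Set
  DASpecial = Ix Fin (relArities σ) ⊎ Ix Fin (funArities σ) ⊎ Mirror

  finite-Mirror : Finite Mirror
  finite-Mirror = finite-⊎ (finite-Ix (λ _ → finite-⊤) _) (finite-Fin _)

  finite-DASpecial : Finite DASpecial
  finite-DASpecial = finite-⊎ (finite-Ix finite-Fin _) (finite-⊎ (finite-Ix finite-Fin _) finite-Mirror)

  queryAddr : ∀ o → Fin (queryArity o) → DASpecial
  queryAddr (relationOf p) i = inj₁ (sub p i)
  queryAddr (functionOf p) i = inj₂ (inj₁ (sub p i))

  queryAddr-injective : ∀ o {i j} → queryAddr o i ≡ queryAddr o j → i ≡ j
  queryAddr-injective (relationOf p) eq = sub-injective {Fin} p (inj₁-injective eq)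
  queryAddr-injective (functionOf p) eq = sub-injective {Fin} p (inj₁-injective (inj₂-injective eq))

  queryMirror : Query → Maybe DASpecial
  queryMirror (relationOf p) = nothing
  queryMirror (functionOf p) = just (inj₂ (inj₂ (inj₁ (sub p tt))))
  queryMirror (constantOf c) = just (inj₂ (inj₂ (inj₂ c)))

  queryMirror≢ : ∀ o {a} → queryMirror o ≡ just a → ∀ i → a ≢ queryAddr o i
  queryMirror≢ (functionOf p) refl i ()
  queryMirror≢ (constantOf c) refl ()

  daSignature : Signature
  daSignature = record
    { Special = DASpecial ; _≟ˢ_ = finite-≟ finite-DASpecial ; Op = Query ; arity = queryArity ; addr = queryAddr
    ; addr-injective = queryAddr-injective ; mirror = queryMirror ; mirror≢addr = queryMirror≢ }

  argument : List Bool → ℕ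
  argument xs = fromBits (reverse xs)

  constantValues : Structure σ → Vec ℕ (suc (#constants σ))
  constantValues A = size A ∷ Vec.map toℕ (constants A)

  daStreams : Structure σ → Language.Semantics Query queryArity
  daStreams A (relationOf p) xs = maybe′ (lookupAll (relations A) p) false (elements (size A) (Vec.map argument xs)) ∷ []
  daStreams A (functionOf p) xs =
    maybe′ (λ as → numeral (toℕ (lookupAll (functions A) p as))) [] (elements (size A) (Vec.map argument xs))
  daStreams A (constantOf c) xs = numeral (Vec.lookup (constantValues A) c)

  daSingle : ∀ A o → queryMirror o ≡ nothing → ∀ xs → length (daStreams A o xs) ≤ 1
  daSingle A (relationOf p) _ xs = ≤-refl

module DirectAccess (σ : Vocabulary) (command : Commands.Cmd (daSignature σ)) where

  open Signature (daSignature σ)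
  open Language Op arity
  open Commands (daSignature σ)
  open Machine (daSignature σ)
  open Compiled command

  #mirrors : ℕ
  #mirrors = proj₁ (finite-Mirror σ)

  mirrorFin : Mirror σ → Fin #mirrors
  mirrorFin = Inverse.to (proj₂ (finite-Mirror σ))

  mirrorFin-injective : ∀ {x y} → mirrorFin x ≡ mirrorFin y → x ≡ y
  mirrorFin-injective {x} {y} eq = trans (sym (Inverse.strictlyInverseʳ f x)) (trans (cong (Inverse.from f) eq) (Inverse.strictlyInverseʳ f y))
    where f = proj₂ (finite-Mirror σ)

  #workTapes : ℕ
  #workTapes = suc #locals + #mirrors

  Location : Set
  Location = Ix Fin (relArities σ) ⊎ Ix Fin (funArities σ) ⊎ Fin #workTapes

  _≟ᴸ_ : DecidableEquality Location
  _≟ᴸ_ = finite-≟ (finite-⊎ (finite-Ix finite-Fin _) (finite-⊎ (finite-Ix finite-Fin _) (finite-Fin _)))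

  -- Each read-only tape is paired with a work-tape, and `actions` gives both the same move. So the
  -- position of the read-only head is the height of a stack, which commands can control.
  mirrorAt : Mirror σ → Location
  mirrorAt x = inj₂ (inj₂ (suc #locals ↑ʳ mirrorFin x))

  location : Reg → Location
  location (special (inj₁ ix))        = inj₁ ix
  location (special (inj₂ (inj₁ ix))) = inj₂ (inj₁ ix)
  location (special (inj₂ (inj₂ x)))  = mirrorAt x
  location (local m)                  = inj₂ (inj₂ (clip #locals m ↑ˡ #mirrors))

  ↑ʳ≢↑ˡ : ∀ {m n} (i : Fin m) (j : Fin n) → m ↑ʳ j ≢ i ↑ˡ n
  ↑ʳ≢↑ˡ {m} {n} i j eq = case trans (sym (Fin.splitAt-↑ʳ m n j)) (trans (cong (splitAt m) eq) (Fin.splitAt-↑ˡ m i n)) of λ ()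

  location-injective : ∀ r r′ → Ok #locals r → Ok #locals r′ → location r ≡ location r′ → r ≡ r′
  location-injective (special (inj₁ _)) (special (inj₁ _)) _ _ refl = refl
  location-injective (special (inj₁ _)) (special (inj₂ (inj₁ _))) _ _ ()
  location-injective (special (inj₁ _)) (special (inj₂ (inj₂ _))) _ _ ()
  location-injective (special (inj₁ _)) (local _) _ _ ()
  location-injective (special (inj₂ (inj₁ _))) (special (inj₁ _)) _ _ ()
  location-injective (special (inj₂ (inj₁ _))) (special (inj₂ (inj₁ _))) _ _ refl = refl
  location-injective (special (inj₂ (inj₁ _))) (special (inj₂ (inj₂ _))) _ _ ()
  location-injective (special (inj₂ (inj₁ _))) (local _) _ _ ()
  location-injective (special (inj₂ (inj₂ _))) (special (inj₁ _)) _ _ ()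
  location-injective (special (inj₂ (inj₂ _))) (special (inj₂ (inj₁ _))) _ _ ()
  location-injective (special (inj₂ (inj₂ x))) (special (inj₂ (inj₂ y))) _ _ eq =
    cong (special ∘ inj₂ ∘ inj₂) (mirrorFin-injective (Fin.↑ʳ-injective (suc #locals) _ _ (inj₂-injective (inj₂-injective eq))))
  location-injective (special (inj₂ (inj₂ x))) (local m) _ _ eq = ⊥-elim (↑ʳ≢↑ˡ _ _ (inj₂-injective (inj₂-injective eq)))
  location-injective (local m) (special (inj₁ _)) _ _ ()
  location-injective (local m) (special (inj₂ (inj₁ _))) _ _ ()
  location-injective (local m) (special (inj₂ (inj₂ x))) _ _ eq = ⊥-elim (↑ʳ≢↑ˡ _ _ (sym (inj₂-injective (inj₂-injective eq))))
  location-injective (local m) (local m′) ok ok′ eq = cong local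
    (trans (sym (toℕ-clip (<⇒≤ ok))) (trans (cong toℕ (Fin.↑ˡ-injective #mirrors _ _ (inj₂-injective (inj₂-injective eq)))) (toℕ-clip (<⇒≤ ok′))))

  cellAt : ∀ {X V C : Set} → Tapes σ #workTapes X V C X → Location → X
  cellAt ts (inj₁ ix)        = lookupIx (Tapes.relAddress ts) ix
  cellAt ts (inj₂ (inj₁ ix)) = lookupIx (Tapes.funAddress ts) ix
  cellAt ts (inj₂ (inj₂ i))  = Vec.lookup (Tapes.work ts) i

  localActions : Act → Scanned σ #workTapes → Location → Symbol × Move
  localActions nothing        sc l = cellAt sc l , stay
  localActions (just (r , a)) sc l = if does (location r ≟ᴸ l) then a else (cellAt sc l , stay)

  actions : Act → Scanned σ #workTapes → Action σ #workTapes
  actions a sc = mkTapes (tabulateIx _ (f ∘ inj₁)) (tabulateIx _ (f ∘ inj₂ ∘ inj₁))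
      (tabulateAll _ (λ p → proj₂ (f (mirrorAt (inj₁ (sub p tt))))))
      (Vec.tabulate (λ c → proj₂ (f (mirrorAt (inj₂ c)))))
      (Vec.tabulate (f ∘ inj₂ ∘ inj₂))
    where f = localActions a sc

  replies : Scanned σ #workTapes → All (const Bool) (relArities σ) → Query σ → Maybe Bool
  replies sc as (relationOf p) = just (lookupAll as p)
  replies sc as (functionOf p) = fromSymbol (lookupAll (Tapes.values sc) p)
  replies sc as (constantOf c) = fromSymbol (Vec.lookup (Tapes.consts sc) c)

  machine : DirectAccessTM σ
  machine = record
    { State  = Control (St command)
    ; finite = finite-Control
    ; q₀     = inj₂ zero
    ; final  = isAccept
    ; #work  = #workTapes
    ; δ      = λ q sc as → Maybe.map (λ (q′ , a) → q′ , actions a sc)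
        (control command 1 nothing q (cellAt sc ∘ location) (replies sc as))
    }

  open DirectAccessTM machine using (scanAll; actAll)

  World′ : Set
  World′ = Contents σ #workTapes

  scanAll-at : ∀ (w : World′) l → cellAt (scanAll w) l ≡ scan (cellAt w l)
  scanAll-at w (inj₁ ix)        = lookupIx-map scan (Tapes.relAddress w) ix
  scanAll-at w (inj₂ (inj₁ ix)) = lookupIx-map scan (Tapes.funAddress w) ix
  scanAll-at w (inj₂ (inj₂ i))  = lookup-map i scan (Tapes.work w)

  actAll-at : ∀ (w : World′) a sc l → cellAt (actAll w (actions a sc)) l ≡ writeMove (cellAt w l) (localActions a sc l)
  actAll-at w a sc (inj₁ ix)        = trans (lookupIx-zipWith writeMove (Tapes.relAddress w) _ ix)
    (cong (writeMove _) (lookupIx-tabulate _ (localActions a sc ∘ inj₁) ix))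
  actAll-at w a sc (inj₂ (inj₁ ix)) = trans (lookupIx-zipWith writeMove (Tapes.funAddress w) _ ix)
    (cong (writeMove _) (lookupIx-tabulate _ (localActions a sc ∘ inj₂ ∘ inj₁) ix))
  actAll-at w a sc (inj₂ (inj₂ i))  = trans (lookup-zipWith writeMove i (Tapes.work w) _)
    (cong (writeMove _) (lookup∘tabulate (localActions a sc ∘ inj₂ ∘ inj₂) i))

  localActions-hit : ∀ r a sc → localActions (just (r , a)) sc (location r) ≡ a
  localActions-hit r a sc with location r ≟ᴸ location r
  ... | yes _ = refl
  ... | no ¬p = contradiction refl ¬p

  localActions-miss : ∀ r a sc l → location r ≢ l → localActions (just (r , a)) sc l ≡ (cellAt sc l , stay)
  localActions-miss r a sc l neq with location r ≟ᴸ l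
  ... | yes eq = contradiction eq neq
  ... | no _   = refl

  module _ (A : Structure σ) where

    open DirectAccessTM machine using (answerQueries; updateValues; initialTapes)

    perform′ : Act → World′ → World′
    perform′ a w = updateValues A (actAll w (actions a (scanAll w)))

    perform-at : ∀ a w l → cellAt (perform′ a w) l ≡ writeMove (cellAt w l) (localActions a (scanAll w) l)
    perform-at a w (inj₁ ix)        = actAll-at w a (scanAll w) (inj₁ ix)
    perform-at a w (inj₂ (inj₁ ix)) = actAll-at w a (scanAll w) (inj₂ (inj₁ ix))
    perform-at a w (inj₂ (inj₂ i))  = actAll-at w a (scanAll w) (inj₂ (inj₂ i))

    record Aligned (w : World′) : Set where
      constructor aligned
      field
        valuePos  : ∀ {k} (p : funArities σ ∋ k) → pos (lookupAll (Tapes.values w) p) ≡ pos (cellAt w (mirrorAt (inj₁ (sub p tt))))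
        constTape : ∀ c → Vec.lookup (Tapes.consts w) c ≡
          mkTape (List.map bit (numeral (Vec.lookup (constantValues σ A) c))) (pos (cellAt w (mirrorAt (inj₂ c))))
    open Aligned

    -- This may fail at the start, where the value-tapes are blank whatever the addresses, and holds
    -- after any step. The idle preparatory step establishes it.
    Updated : World′ → Set
    Updated w = ∀ {k} (p : funArities σ ∋ k) →
      cells (lookupAll (Tapes.values w) p) ≡ value (lookupAll (functions A) p) (lookupAll (Tapes.funAddress w) p)

    acted : Act → World′ → World′
    acted a w = actAll w (actions a (scanAll w))

    newValues : Act → World′ → All (const (List Symbol)) (funArities σ)
    newValues a w = All.zipWith (uncurry value) (functions A , Tapes.funAddress (acted a w))

    values-at : ∀ a w {k} (p : funArities σ ∋ k) → lookupAll (Tapes.values (perform′ a w)) p ≡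
      mkTape (lookupAll (newValues a w) p) (pos (lookupAll (Tapes.values (acted a w)) p))
    values-at a w p = lookupAll-zipWith (λ (v , xs) → mkTape xs (pos v)) (Tapes.values (acted a w)) (newValues a w) p

    updated : ∀ a w → Updated (perform′ a w)
    updated a w p = trans (cong cells (values-at a w p))
      (lookupAll-zipWith (uncurry value) (functions A) (Tapes.funAddress (acted a w)) p)

    perform-aligned : ∀ a w → Aligned w → Aligned (perform′ a w)
    perform-aligned a w al .valuePos p =
      trans (cong pos (values-at a w p))
        (trans (cong pos (lookupAll-zipWith (uncurry moveOn) (Tapes.values w) moves p))
          (trans (cong (λ m → pos (moveOn (lookupAll (Tapes.values w) p) m))
                   (lookupAll-tabulate {const Move} _ (λ p → proj₂ (localActions a (scanAll w) (mirrorAt (inj₁ (sub p tt))))) p))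
            (trans (cong (moveHead (proj₂ (localActions a (scanAll w) l))) (al .valuePos p))
              (sym (cong pos (perform-at a w l))))))
      where
      l = mirrorAt (inj₁ (sub p tt))
      moves = Tapes.values (actions a (scanAll w))
    perform-aligned a w al .constTape c =
      trans (lookup-zipWith moveOn c (Tapes.consts w) _)
        (trans (cong₂ moveOn (al .constTape c) (lookup∘tabulate (λ c → proj₂ (localActions a (scanAll w) (mirrorAt (inj₂ c)))) c))
          (cong (mkTape _) (sym (cong pos (perform-at a w l)))))
      where l = mirrorAt (inj₂ c)

    addresses≡ : ∀ {r} (xs : Vec (List Bool) r) (ts : Vec Tape r) → (∀ i → Stack (Vec.lookup xs i) (Vec.lookup ts i)) →
      Vec.map numberOn ts ≡ Vec.map (argument σ) xs
    addresses≡ xs ts h = vec-ext λ i →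
      trans (lookup-map i numberOn ts) (trans (stack-number (h i)) (sym (lookup-map i (argument σ) xs)))

    fromSymbol-at : ∀ ys j → fromSymbol (symbolAt (List.map bit ys) j) ≡ List.head (List.drop j ys)
    fromSymbol-at []       zero    = refl
    fromSymbol-at []       (suc j) = refl
    fromSymbol-at (y ∷ ys) zero    = refl
    fromSymbol-at (y ∷ ys) (suc j) = fromSymbol-at ys j

    answer-ok′ : ∀ s w → Aligned w × Updated w → (∀ r → Ok #locals r → Stack (s r) (cellAt w (location r))) →
      ∀ o → replies (scanAll w) (answerQueries A (Tapes.relAddress w)) o ≡ answer (daStreams σ A) s o
    answer-ok′ s w _ st (relationOf p) =
      cong just (trans (lookupAll-zipWith (uncurry query) (relations A) (Tapes.relAddress w) p)
        (cong (λ ns → maybe′ (lookupAll (relations A) p) false (elements (size A) ns))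
          (addresses≡ (addresses s (relationOf p)) (lookupAll (Tapes.relAddress w) p) (λ i → subst (λ xs → Stack xs (Vec.lookup (lookupAll (Tapes.relAddress w) p) i)) (sym (lookup∘tabulate (λ i → s (special (inj₁ (sub p i)))) i))
            (subst (Stack (s (special (inj₁ (sub p i))))) (lookupIx-sub (Tapes.relAddress w) p i) (st (special (inj₁ (sub p i))) tt))))))
    answer-ok′ s w (al , up) st (functionOf p) =
      trans (cong fromSymbol (trans (lookupAll-map scan (Tapes.values w) p) (cong₂ symbolAt cells≡ pos≡)))
        (fromSymbol-at (daStreams σ A (functionOf p) (addresses s (functionOf p))) (length (s (special (inj₂ (inj₂ (inj₁ (sub p tt)))))))) 
      where
      mirrorReg = special (inj₂ (inj₂ (inj₁ (sub p tt))))
      pos≡ : pos (lookupAll (Tapes.values w) p) ≡ length (s mirrorReg)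
      pos≡ = trans (al .valuePos p) (Stack.at-top (st mirrorReg tt))
      f = lookupAll (functions A) p
      value≡ : ∀ as → maybe′ (λ as → List.map bit (numeral (toℕ (f as)))) [] as ≡
        List.map bit (maybe′ (λ as → numeral (toℕ (f as))) [] as)
      value≡ (just _) = refl
      value≡ nothing  = refl
      cells≡ : cells (lookupAll (Tapes.values w) p) ≡ List.map bit (daStreams σ A (functionOf p) (addresses s (functionOf p)))
      cells≡ = trans (up p) (trans (value≡ (elements (size A) (Vec.map numberOn (lookupAll (Tapes.funAddress w) p)))) (cong (λ ns → List.map bit (maybe′ (λ as → numeral (toℕ (f as))) [] (elements (size A) ns)))
        (addresses≡ (addresses s (functionOf p)) (lookupAll (Tapes.funAddress w) p) (λ i → subst (λ xs → Stack xs (Vec.lookup (lookupAll (Tapes.funAddress w) p) i)) (sym (lookup∘tabulate (λ i → s (special (inj₂ (inj₁ (sub p i))))) i))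
            (subst (Stack (s (special (inj₂ (inj₁ (sub p i)))))) (lookupIx-sub (Tapes.funAddress w) p i) (st (special (inj₂ (inj₁ (sub p i)))) tt))))))
    answer-ok′ s w (al , up) st (constantOf c) =
      trans (cong fromSymbol (trans (lookup-map c scan (Tapes.consts w)) (trans (cong scan (al .constTape c))
          (cong (symbolAt (List.map bit (numeral (Vec.lookup (constantValues σ A) c)))) (Stack.at-top (st mirrorReg tt))))))
        (fromSymbol-at (numeral (Vec.lookup (constantValues σ A) c)) (length (s mirrorReg)))
      where mirrorReg = special (inj₂ (inj₂ (inj₂ c)))

    realization : Realization #locals (daStreams σ A)
    realization = record
      { World     = World′
      ; tapeIn    = λ w r → cellAt w (location r)
      ; scannedIn = λ w r → cellAt (scanAll w) (location r)
      ; answersIn = λ w → replies (scanAll w) (answerQueries A (Tapes.relAddress w))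
      ; perform   = perform′
      ; Coherent  = λ w → Aligned w × Updated w
      ; scanned   = λ w r → scanAll-at w (location r)
      ; tape-hit  = λ r a w _ → trans (perform-at (just (r , a)) w (location r)) (cong (writeMove _) (localActions-hit r a (scanAll w)))
      ; tape-miss = λ r a w r′ ok ok′ r≢r′ → trans (perform-at (just (r , a)) w (location r′))
          (cong (writeMove _) (trans (localActions-miss r a (scanAll w) (location r′) (r≢r′ ∘ location-injective r r′ ok ok′))
            (cong (_, stay) (scanAll-at w (location r′)))))
      ; tape-none = λ w r′ _ → trans (perform-at nothing w (location r′))
          (cong (writeMove _) (cong (_, stay) (scanAll-at w (location r′))))
      ; coherent  = λ a w (al , _) → perform-aligned a w al , updated a w
      ; answer-ok = answer-ok′
      }

    open Run realization
    open Behaviour realization nothing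

    initial-blank : ∀ l → cellAt (initialTapes A) l ≡ blankTape
    initial-blank (inj₁ ix)        = lookupIx-blank blankTape (relArities σ) ix
    initial-blank (inj₂ (inj₁ ix)) = lookupIx-blank blankTape (funArities σ) ix
    initial-blank (inj₂ (inj₂ i))  = lookup-replicate i blankTape

    initial-aligned : Aligned (initialTapes A)
    initial-aligned .valuePos p = trans (cong pos (lookupAll-universal (λ _ → blankTape) (funArities σ) p))
      (sym (cong pos (initial-blank (mirrorAt (inj₁ (sub p tt))))))
    initial-aligned .constTape c = trans (lookup-map c (tapeOf ∘ numeral) (constantValues σ A))
      (cong (mkTape _) (sym (cong pos (initial-blank (mirrorAt (inj₂ c))))))

    prepared : Inv (λ _ → []) (perform′ nothing (initialTapes A))
    prepared = inv (perform-aligned nothing (initialTapes A) initial-aligned , updated nothing (initialTapes A))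
      (λ r ok → subst (Stack []) (sym (trans (perform-at nothing (initialTapes A) (location r))
          (cong (writeMove _) (cong (_, stay) (scanAll-at (initialTapes A) (location r))))))
        (stack-rest (subst (Stack []) (sym (initial-blank (location r))) stack-blank)))

    computation : Computation
    computation = DirectAccessTM.computation machine A

    conf : Control (St command) × World′ → Computation.Config computation
    conf (q , w) = mkConfig q w

    step≡ : ∀ x → Computation.step computation (conf x) ≡ Maybe.map conf (advance x)
    step≡ (q , w) with control command 1 nothing q (cellAt (scanAll w) ∘ location) (replies (scanAll w) (answerQueries A (Tapes.relAddress w)))
    ... | just _  = refl
    ... | nothing = refl

    outcome : ∀ {u t} → Exec (daStreams σ A) command (λ _ → []) u t →
      ∃[ t′ ] t′ ≤ 3 + t × Outcome computation (Computation.initial computation) t′ (nonempty (u (local 1)))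
    outcome ex with machine-path prepared ex
    ... | t′ , w , t′≤ , p = t′ , t′≤ , path-outcome computation conf step≡ (λ _ → refl) p

-- Binary numbers as lists

bitℕ : Bool → ℕ
bitℕ b = if b then 1 else 0

-- Least significant bit first.
val : List Bool → ℕ
val []       = 0
val (b ∷ bs) = bitℕ b + 2 * val bs

val-∷ʳ : ∀ xs b → val (xs ++ b ∷ []) ≡ val xs + bitℕ b * 2 ^ length xs
val-∷ʳ []       b = trans (+-identityʳ _) (sym (*-identityʳ _))
val-∷ʳ (x ∷ xs) b rewrite val-∷ʳ xs b = arith (bitℕ x) (val xs) (bitℕ b) (2 ^ length xs)
  where
  arith : ∀ x v b p → x + 2 * (v + b * p) ≡ x + 2 * v + b * (2 * p)
  arith = solve-∀

fromBits-reverse : ∀ xs → fromBits (reverse xs) ≡ val xs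
fromBits-reverse []       = refl
fromBits-reverse (b ∷ xs) = trans (cong fromBits (unfold-reverse b xs))
  (trans (foldl-++ (λ m b → 2 * m + bitℕ b) 0 (reverse xs) (b ∷ []))
    (trans (cong (λ v → 2 * v + bitℕ b) (fromBits-reverse xs)) (+-comm (2 * val xs) (bitℕ b))))

val< : ∀ xs → val xs < 2 ^ length xs
val< []       = s≤s z≤n
val< (b ∷ xs) = begin-strict
  bitℕ b + 2 * val xs   ≤⟨ +-monoˡ-≤ (2 * val xs) (bit≤1 b) ⟩
  1 + 2 * val xs        <⟨ ≤-reflexive (sym (arith (val xs))) ⟩
  2 * suc (val xs)      ≤⟨ *-monoʳ-≤ 2 (val< xs) ⟩
  2 * 2 ^ length xs     ∎
  where
  open ≤-Reasoning
  bit≤1 : ∀ b → bitℕ b ≤ 1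
  bit≤1 false = z≤n
  bit≤1 true  = ≤-refl
  arith : ∀ v → 2 * suc v ≡ 2 + 2 * v
  arith = solve-∀

-- Most significant bit first.
val← : List Bool → ℕ
val← xs = val (reverse xs)

val←-∷ : ∀ b xs → val← (b ∷ xs) ≡ val← xs + bitℕ b * 2 ^ length xs
val←-∷ b xs rewrite unfold-reverse b xs | val-∷ʳ (reverse xs) b | length-reverse xs = refl

headBit : List Bool → Bool
headBit []      = false
headBit (b ∷ _) = b

val-uncons : ∀ xs → val xs ≡ bitℕ (headBit xs) + 2 * val (List.drop 1 xs)
val-uncons []       = refl
val-uncons (b ∷ xs) = refl

-- a + 2 x < s + 2 y + f, where f is the outcome for less significant bits
borrow : Bool → Bool → Bool → Bool
borrow false false f = f
borrow false true  f = true
borrow true  false f = false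
borrow true  true  f = f

<ᵇ-zero : ∀ n → (n <ᵇ 0) ≡ false
<ᵇ-zero zero    = refl
<ᵇ-zero (suc n) = refl

<ᵇ-double : ∀ x y → (2 * x <ᵇ 2 * y) ≡ (x <ᵇ y)
<ᵇ-double x       zero    = trans (<ᵇ-zero (2 * x)) (sym (<ᵇ-zero x))
<ᵇ-double zero    (suc y) = refl
<ᵇ-double (suc x) (suc y) rewrite +-suc x (x + 0) | +-suc y (y + 0) = <ᵇ-double x y

<ᵇ-odd : ∀ x y → (2 * x <ᵇ suc (2 * y)) ≡ (x <ᵇ suc y)
<ᵇ-odd zero    y       = refl
<ᵇ-odd (suc x) zero    = sym (<ᵇ-zero x)
<ᵇ-odd (suc x) (suc y) rewrite +-suc x (x + 0) | +-suc y (y + 0) = <ᵇ-odd x y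

<ᵇ-even : ∀ x y → (suc (2 * x) <ᵇ 2 * y) ≡ (x <ᵇ y)
<ᵇ-even x       zero    = sym (<ᵇ-zero x)
<ᵇ-even zero    (suc y) rewrite +-suc y (y + 0) = refl
<ᵇ-even (suc x) (suc y) rewrite +-suc x (x + 0) | +-suc y (y + 0) = <ᵇ-even x y

-- The invariant of a comparison that starts at the least significant bits: x < y + f says that x <
-- y, or that x = y and the bits seen so far decide in favour of "less".
<ᵇ-borrow : ∀ a s f x y → (bitℕ a + 2 * x <ᵇ bitℕ s + 2 * y + bitℕ f) ≡ (x <ᵇ y + bitℕ (borrow a s f))
<ᵇ-borrow a s f x y = go a s f
  where
  via : ∀ X {n n′ m m′} → n ≡ n′ → m ≡ m′ → (X <ᵇ n′) ≡ (x <ᵇ m′) → (X <ᵇ n) ≡ (x <ᵇ m)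
  via X refl refl eq = eq
  arith : ∀ y → suc (2 * y + 1) ≡ 2 * suc y
  arith = solve-∀
  go : ∀ a s f → (bitℕ a + 2 * x <ᵇ bitℕ s + 2 * y + bitℕ f) ≡ (x <ᵇ y + bitℕ (borrow a s f))
  go false false false = via (0 + 2 * x) (+-identityʳ (2 * y)) (+-identityʳ y) (<ᵇ-double x y)
  go false false true  = via (0 + 2 * x) (+-comm (2 * y) 1) (+-comm y 1) (<ᵇ-odd x y)
  go false true  false = via (0 + 2 * x) (cong suc (+-identityʳ (2 * y))) (+-comm y 1) (<ᵇ-odd x y)
  go false true  true  = via (0 + 2 * x) (arith y) (+-comm y 1) (<ᵇ-double x (suc y))
  go true  false false = via (1 + 2 * x) (+-identityʳ (2 * y)) (+-identityʳ y) (<ᵇ-even x y)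
  go true  false true  = via (1 + 2 * x) (+-comm (2 * y) 1) (+-identityʳ y) (<ᵇ-double x y)
  go true  true  false = via (1 + 2 * x) (cong suc (+-identityʳ (2 * y))) (+-identityʳ y) (<ᵇ-double x y)
  go true  true  true  = via (1 + 2 * x) (cong suc (+-comm (2 * y) 1)) (+-comm y 1) (<ᵇ-odd x y)

xor₃ maj₃ : Bool → Bool → Bool → Bool
xor₃ a b c = a xor (b xor c)
maj₃ a b c = if a then b ∨ c else b ∧ c

full-adder : ∀ a b c → bitℕ a + bitℕ b + bitℕ c ≡ bitℕ (xor₃ a b c) + 2 * bitℕ (maj₃ a b c)
full-adder false false false = refl
full-adder false false true  = refl
full-adder false true  false = refl
full-adder false true  true  = refl
full-adder true  false false = refl
full-adder true  false true  = refl
full-adder true  true  false = refl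
full-adder true  true  true  = refl

-- Truth values are coded by nonemptiness, which is what a pop can detect.
flagList : Bool → List Bool
flagList true  = true ∷ []
flagList false = []

nonempty-flagList : ∀ b → nonempty (flagList b) ≡ b
nonempty-flagList true  = refl
nonempty-flagList false = refl

fromHead : Maybe Bool → Bool
fromHead = maybe′ id false

fromHead-head : ∀ xs → fromHead (List.head xs) ≡ headBit xs
fromHead-head []       = refl
fromHead-head (x ∷ xs) = refl

is-just-head : ∀ (xs : List Bool) → is-just (List.head xs) ≡ nonempty xs
is-just-head []       = refl
is-just-head (x ∷ xs) = refl

setAt : List Bool → ℕ → Bool → List Bool
setAt []       zero    b = b ∷ []
setAt []       (suc p) b = false ∷ setAt [] p b
setAt (x ∷ xs) zero    b = b ∷ xs
setAt (x ∷ xs) (suc p) b = x ∷ setAt xs p b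

length-setAt : ∀ xs p b → length (setAt xs p b) ≡ length xs ⊔ suc p
length-setAt []       zero    b = refl
length-setAt []       (suc p) b = cong suc (length-setAt [] p b)
length-setAt (x ∷ xs) zero    b = cong suc (sym (⊔-identityʳ _))
length-setAt (x ∷ xs) (suc p) b = cong suc (length-setAt xs p b)

stripped : List Bool → List Bool → List Bool
stripped []        out       = out
stripped (b ∷ xs)  (o ∷ out) = stripped xs (b ∷ o ∷ out)
stripped (true ∷ xs)  []     = stripped xs (true ∷ [])
stripped (false ∷ xs) []     = stripped xs []

-- The numeral of 2 ^ m is `zerosOne (suc m)`; `zerosOne zero` is what is left of the numeral of 1
-- after halving. With this shift, `tail` runs through all powers of two down to the end of a
-- search.
zerosOne : ℕ → List Bool
zerosOne zero          = []
zerosOne (suc zero)    = true ∷ []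
zerosOne (suc (suc m)) = false ∷ zerosOne (suc m)

val-zerosOne : ∀ m → val (zerosOne (suc m)) ≡ 2 ^ m
val-zerosOne zero    = refl
val-zerosOne (suc m) = cong (2 *_) (val-zerosOne m)

drop-zerosOne : ∀ m → List.drop 1 (zerosOne (suc m)) ≡ zerosOne m
drop-zerosOne zero    = refl
drop-zerosOne (suc m) = refl

≤2^⌈log₂⌉ : ∀ n → n ≤ 2 ^ ⌈log₂ n ⌉
≤2^⌈log₂⌉ = <-rec _ λ where
    zero          rec → z≤n
    (suc zero)    rec → s≤s z≤n
    (suc (suc n)) rec → begin
      2 + n                              ≤⟨ double n ⟩
      2 * ⌈ 2 + n /2⌉                    ≤⟨ *-monoʳ-≤ 2 (rec (⌈n/2⌉<n n)) ⟩
      2 * 2 ^ ⌈log₂ ⌈ 2 + n /2⌉ ⌉        ≡⟨ cong (λ l → 2 * 2 ^ l) (⌈log₂⌈n/2⌉⌉≡⌈log₂n⌉∸1 (2 + n)) ⟩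
      2 ^ suc (⌈log₂ 2 + n ⌉ ∸ 1)        ≡⟨ cong (2 ^_) (m+[n∸m]≡n {1} {⌈log₂ 2 + n ⌉} (⌈log₂⌉-mono-≤ {2} {2 + n} (s≤s (s≤s z≤n)))) ⟩
      2 ^ ⌈log₂ 2 + n ⌉                  ∎
  where
  open ≤-Reasoning
  double : ∀ n → 2 + n ≤ 2 * ⌈ 2 + n /2⌉
  double n = ≤-trans (≤-reflexive (sym (⌊n/2⌋+⌈n/2⌉≡n (2 + n))))
    (≤-trans (+-monoˡ-≤ ⌈ 2 + n /2⌉ (⌊n/2⌋≤⌈n/2⌉ (2 + n))) (≤-reflexive (cong (⌈ 2 + n /2⌉ +_) (sym (+-identityʳ _)))))

⌈log₂⌉≤ : ∀ {n l} → n ≤ 2 ^ l → ⌈log₂ n ⌉ ≤ l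
⌈log₂⌉≤ {n} {l} n≤ = ≤-trans (⌈log₂⌉-mono-≤ n≤) (≤-reflexive (⌈log₂2^n⌉≡n l))

<⌈log₂⌉ : ∀ {n l} → 2 ^ l < n → l < ⌈log₂ n ⌉
<⌈log₂⌉ {n} {l} <n = ≰⇒> λ log≤ → <⇒≱ <n (≤-trans (≤2^⌈log₂⌉ n) (^-monoʳ-≤ 2 log≤))

<ᵇ-true : ∀ {m n} → m < n → (m <ᵇ n) ≡ true
<ᵇ-true {m} {n} m<n with m <ᵇ n in eq
... | true  = refl
... | false = ⊥-elim (subst T eq (<⇒<ᵇ m<n))

<ᵇ-false : ∀ {m n} → n ≤ m → (m <ᵇ n) ≡ false
<ᵇ-false {m} {n} n≤m with m <ᵇ n in eq
... | false = refl
... | true  = contradiction (<ᵇ⇒< m n (subst T (sym eq) tt)) (≤⇒≯ n≤m)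

<ᵇ-true⁻¹ : ∀ {m n} → (m <ᵇ n) ≡ true → m < n
<ᵇ-true⁻¹ {m} {n} eq = <ᵇ⇒< m n (subst T (sym eq) tt)

<ᵇ-false⁻¹ : ∀ {m n} → (m <ᵇ n) ≡ false → n ≤ m
<ᵇ-false⁻¹ {m} {n} eq = ≮⇒≥ λ m<n → case trans (sym eq) (<ᵇ-true m<n) of λ ()

isBit bitOf : Symbol → Bool
isBit (bit _) = true
isBit blank   = false
bitOf (bit b) = b
bitOf blank   = false

half-double : ∀ b n → ⌊ bitℕ b + 2 * n /2⌋ ≡ n
half-double false zero    = refl
half-double false (suc n) rewrite +-suc n (n + 0) = cong suc (half-double false n)
half-double true  zero    = refl
half-double true  (suc n) rewrite +-suc n (n + 0) = cong suc (half-double true n)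

lowest-double : ∀ b n → testBit 0 (bitℕ b + 2 * n) ≡ b
lowest-double b n = trans (cong (λ z → (bitℕ b + z) % 2 ≡ᵇ 1) (*-comm 2 n))
  (trans (cong (_≡ᵇ 1) ([m+kn]%n≡m%n (bitℕ b) n 2)) (bit-odd b))
  where
  bit-odd : ∀ b → (bitℕ b % 2 ≡ᵇ 1) ≡ b
  bit-odd false = refl
  bit-odd true  = refl

drop-[] : ∀ l → List.drop l (List.List.[] {A = Bool}) ≡ []
drop-[] zero    = refl
drop-[] (suc l) = refl

drop-drop1 : ∀ n (ys : List Bool) → List.drop n (List.drop 1 ys) ≡ List.drop (suc n) ys
drop-drop1 zero    ys       = refl
drop-drop1 (suc n) []       = refl
drop-drop1 (suc n) (y ∷ ys) = refl

testBit-val : ∀ l xs → testBit l (val xs) ≡ headBit (List.drop l xs)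
testBit-val zero    []       = refl
testBit-val zero    (b ∷ xs) = lowest-double b (val xs)
testBit-val (suc l) []       = trans (testBit-val l []) (cong headBit (drop-[] l))
testBit-val (suc l) (b ∷ xs) = trans (cong (testBit l) (half-double b (val xs))) (testBit-val l xs)

-- Arithmetic within the language

module Arithmetic (Op : Set) (arity : Op → ℕ) where

  open Language Op arity

  pattern 0F = zero
  pattern 1F = suc zero
  pattern 2F = suc (suc zero)

  infixr 5 _∷ᴱ_
  []ᴱ : ∀ {X : Set} → Fin 0 → X
  []ᴱ ()
  _∷ᴱ_ : ∀ {X : Set} {k} → X → (Fin k → X) → Fin (suc k) → X
  (x ∷ᴱ f) zero    = x
  (x ∷ᴱ f) (suc i) = f i

  flagᴱ : ∀ {k} → Bool → Exp k
  flagᴱ true  = cons true nil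
  flagᴱ false = nil

  eval-flag : ∀ S {k} b (ρ : Env k) → eval S (flagᴱ b) ρ ≡ flagList b
  eval-flag S true  ρ = refl
  eval-flag S false ρ = refl

  length-flag : ∀ S {k} b (ρ : Env k) N → length (eval S (flagᴱ b) ρ) ≤ suc N
  length-flag S true  ρ N = s≤s z≤n
  length-flag S false ρ N = z≤n

  -- A loop along the empty list makes no pass and evaluates `e` in the environment of the
  -- arguments. This gives substitution without recursion on `e`.
  call : ∀ {j k} → Exp j → (Fin j → Exp k) → Exp k
  call e args = loop nil args (λ _ i → var i) (0 , λ S b ρ N h i → h i) e

  ifᴱ : ∀ {k} → Exp k → Exp k → Exp k → Exp k
  ifᴱ e t f = test e (maybe′ (λ _ → t) f)

  eval-if : ∀ S {k} (e t f : Exp k) ρ →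
    eval S (ifᴱ e t f) ρ ≡ (if nonempty (eval S e ρ) then eval S t ρ else eval S f ρ)
  eval-if S e t f ρ with eval S e ρ
  ... | []    = refl
  ... | _ ∷ _ = refl

  rev : ∀ {k} → Exp k → Exp k
  rev e = loop e (λ (_ : Fin 1) → nil) (λ b _ → cons b (var 0F)) (1 , λ S b ρ N h i → s≤s (h 0F)) (var 0F)

  eval-rev : ∀ S {k} (e : Exp k) ρ → eval S (rev e) ρ ≡ reverse (eval S e ρ)
  eval-rev S e ρ = go (eval S e ρ) (λ _ → [])
    where
    go : ∀ xs (st : Env 1) → iterate (λ b st i → b ∷ st 0F) xs st 0F ≡ xs ʳ++ st 0F
    go []       st = refl
    go (x ∷ xs) st = go xs (λ i → x ∷ st 0F)

  -- State: carry, second summand, reversed sum.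
  addBody : Bool → Fin 3 → Exp 3
  addBody a 0F = test (var 0F) λ c → test (var 1F) λ s → flagᴱ (maj₃ a (fromHead s) (is-just c))
  addBody a 1F = tail (var 1F)
  addBody a 2F = test (var 0F) λ c → test (var 1F) λ s → cons (xor₃ a (fromHead s) (is-just c)) (var 2F)

  addGrowth : ∃[ c ] ∀ (S : Semantics) b (ρ : Env 3) N → Bounded N ρ → ∀ i → length (eval S (addBody b i) ρ) ≤ c + N
  addGrowth = 1 , λ where
    S b ρ N h 0F → length-flag S (maj₃ b (fromHead (List.head (ρ 1F))) (is-just (List.head (ρ 0F)))) ρ N
    S b ρ N h 1F → ≤-trans (drop1≤ (ρ 1F)) (m≤n⇒m≤1+n (h 1F))
    S b ρ N h 2F → s≤s (h 2F)

  -- A loop returns a single list, so each component of its final state is an expression of its own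
  -- that repeats the loop. The second loop runs along what the first one has left of `y`, to carry
  -- on if `y` is longer.
  add₁ add₂ : ∀ {k} → Exp k → Exp k → Fin 3 → Exp k
  add₁ x y i = loop x (nil ∷ᴱ y ∷ᴱ nil ∷ᴱ []ᴱ) addBody addGrowth (var i)
  add₂ x y i = loop (add₁ x y 1F) (add₁ x y 0F ∷ᴱ nil ∷ᴱ add₁ x y 2F ∷ᴱ []ᴱ) addBody addGrowth (var i)

  add : ∀ {k} → Exp k → Exp k → Exp k
  add x y = rev (ifᴱ (add₂ x y 0F) (cons true (add₂ x y 2F)) (add₂ x y 2F))

  module _ (S : Semantics) where

    addLoop : List Bool → Env 3 → Env 3
    addLoop = iterate (λ b st i → eval S (addBody b i) st)

    carry : Env 3 → ℕ
    carry st = bitℕ (nonempty (st 0F))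

    -- The total represented by the output, the carry and the remaining bits is invariant; carry and
    -- rest are weighted by the position reached.
    addLoop-val : ∀ xs st → let st′ = addLoop xs st in
      val← (st′ 2F) + 2 ^ length (st′ 2F) * (carry st′ + val (st′ 1F)) ≡
      val← (st 2F) + 2 ^ length (st 2F) * (carry st + val (st 1F) + val xs)
    addLoop-val []       st = cong (λ z → val← (st 2F) + 2 ^ length (st 2F) * z) (sym (+-identityʳ _))
    addLoop-val (a ∷ xs) st rewrite addLoop-val xs (λ i → eval S (addBody a i) st)
      | eval-flag S (maj₃ a (fromHead (List.head (st 1F))) (is-just (List.head (st 0F)))) st
      | nonempty-flagList (maj₃ a (fromHead (List.head (st 1F))) (is-just (List.head (st 0F))))
      | val←-∷ (xor₃ a (fromHead (List.head (st 1F))) (is-just (List.head (st 0F)))) (st 2F)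
      | fromHead-head (st 1F) | is-just-head (st 0F) | val-uncons (st 1F)
      = trans (arith₁ (val← (st 2F)) (2 ^ length (st 2F)) (bitℕ (xor₃ a s c)) (bitℕ (maj₃ a s c)) (val (List.drop 1 (st 1F))) (val xs))
          (trans (cong (λ z → val← (st 2F) + 2 ^ length (st 2F) * (z + 2 * val (List.drop 1 (st 1F)) + 2 * val xs)) (sym (full-adder a s c)))
            (arith₂ (val← (st 2F)) (2 ^ length (st 2F)) (bitℕ a) (bitℕ s) (bitℕ c) (val (List.drop 1 (st 1F))) (val xs)))
      where
      s = headBit (st 1F)
      c = nonempty (st 0F)
      arith₁ : ∀ v p o m y x → v + o * p + 2 * p * (m + y + x) ≡ v + p * (o + 2 * m + 2 * y + 2 * x)
      arith₁ = solve-∀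
      arith₂ : ∀ v p a s c y x → v + p * (a + s + c + 2 * y + 2 * x) ≡ v + p * (c + (s + 2 * y) + (a + 2 * x))
      arith₂ = solve-∀

    addLoop-length : ∀ xs st → length (addLoop xs st 2F) ≡ length xs + length (st 2F)
    addLoop-length []       st = refl
    addLoop-length (a ∷ xs) st = trans (addLoop-length xs _) (+-suc (length xs) _)

    addLoop-rest : ∀ xs st → addLoop xs st 1F ≡ List.drop (length xs) (st 1F)
    addLoop-rest []       st = refl
    addLoop-rest (a ∷ xs) st = trans (addLoop-rest xs _) (drop-drop1 (length xs) (st 1F))

    module _ {k} (x y : Exp k) (ρ : Env k) where
      private
        xs = eval S x ρ
        ys = eval S y ρ
        st₁ st₂ : Env 3
        st₁ i = eval S (add₁ x y i) ρ
        st₂ i = eval S (add₂ x y i) ρ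
        sum : List Bool
        sum = eval S (ifᴱ (add₂ x y 0F) (cons true (add₂ x y 2F)) (add₂ x y 2F)) ρ

        rest₂ : st₂ 1F ≡ []
        rest₂ = trans (addLoop-rest (st₁ 1F) _) (drop-[] (length (st₁ 1F)))

        carry-out : ∀ (c out : List Bool) → val← (if nonempty c then true ∷ out else out) ≡ val← out + 2 ^ length out * (bitℕ (nonempty c) + 0)
        carry-out []      out = sym (trans (cong (val← out +_) (*-zeroʳ (2 ^ length out))) (+-identityʳ _))
        carry-out (_ ∷ _) out = trans (val←-∷ true out) (cong (val← out +_) (*-comm 1 (2 ^ length out)))

      val-add : val (eval S (add x y) ρ) ≡ val xs + val ys
      val-add = begin
        val (eval S (add x y) ρ)  ≡⟨ cong val (eval-rev S (ifᴱ (add₂ x y 0F) (cons true (add₂ x y 2F)) (add₂ x y 2F)) ρ) ⟩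
        val← sum                  ≡⟨ cong val← (eval-if S (add₂ x y 0F) (cons true (add₂ x y 2F)) (add₂ x y 2F) ρ) ⟩
        val← (if nonempty (st₂ 0F) then true ∷ st₂ 2F else st₂ 2F)                ≡⟨ carry-out (st₂ 0F) (st₂ 2F) ⟩
        val← (st₂ 2F) + 2 ^ length (st₂ 2F) * (carry st₂ + 0)                     ≡⟨ cong (λ z → val← (st₂ 2F) + 2 ^ length (st₂ 2F) * (carry st₂ + val z)) rest₂ ⟨
        val← (st₂ 2F) + 2 ^ length (st₂ 2F) * (carry st₂ + val (st₂ 1F))          ≡⟨ addLoop-val (st₁ 1F) _ ⟩
        val← (st₁ 2F) + 2 ^ length (st₁ 2F) * (carry st₁ + 0 + val (st₁ 1F))      ≡⟨ cong (λ z → val← (st₁ 2F) + 2 ^ length (st₁ 2F) * (z + val (st₁ 1F))) (+-identityʳ (carry st₁)) ⟩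
        val← (st₁ 2F) + 2 ^ length (st₁ 2F) * (carry st₁ + val (st₁ 1F))          ≡⟨ addLoop-val xs _ ⟩
        0 + 1 * (0 + val ys + val xs)                                             ≡⟨ arith (val xs) (val ys) ⟩
        val xs + val ys ∎
        where
        open ≡-Reasoning
        arith : ∀ x y → 0 + 1 * (0 + y + x) ≡ x + y
        arith = solve-∀

      -- The length is at most the maximum plus one, and not the sum. This admits `add` in the
      -- bodies of loops, on which multiplication and binary search rest.
      length-add : ∀ {N} → length xs ≤ N → length ys ≤ N → length (eval S (add x y) ρ) ≤ suc N
      length-add {N} xs≤ ys≤ = begin
        length (eval S (add x y) ρ)  ≡⟨ cong length (eval-rev S (ifᴱ (add₂ x y 0F) (cons true (add₂ x y 2F)) (add₂ x y 2F)) ρ) ⟩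
        length (reverse sum)         ≡⟨ length-reverse sum ⟩
        length sum                   ≡⟨ cong length (eval-if S (add₂ x y 0F) (cons true (add₂ x y 2F)) (add₂ x y 2F) ρ) ⟩
        length (if nonempty (st₂ 0F) then true ∷ st₂ 2F else st₂ 2F)  ≤⟨ carry≤ (st₂ 0F) ⟩
        suc (length (st₂ 2F))        ≡⟨ cong suc (addLoop-length (st₁ 1F) _) ⟩
        suc (length (st₁ 1F) + length (st₁ 2F))  ≡⟨ cong₂ (λ a b → suc (a + b)) (trans (cong length (addLoop-rest xs _)) (length-drop (length xs) ys)) (trans (addLoop-length xs _) (+-identityʳ _)) ⟩
        suc (length ys ∸ length xs + length xs)  ≡⟨ cong suc (trans (+-comm (length ys ∸ length xs) (length xs)) (sym (m⊔n≡m+n∸m (length xs) (length ys)))) ⟩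
        suc (length xs ⊔ length ys)  ≤⟨ s≤s (⊔-lub xs≤ ys≤) ⟩
        suc N ∎
        where
        open ≤-Reasoning
        m⊔n≡m+n∸m : ∀ m n → m ⊔ n ≡ m + (n ∸ m)
        m⊔n≡m+n∸m zero    n       = refl
        m⊔n≡m+n∸m (suc m) zero    = cong suc (sym (+-identityʳ m))
        m⊔n≡m+n∸m (suc m) (suc n) = cong suc (m⊔n≡m+n∸m m n)
        carry≤ : ∀ c → length (if nonempty c then true ∷ st₂ 2F else st₂ 2F) ≤ suc (length (st₂ 2F))
        carry≤ []      = n≤1+n _
        carry≤ (_ ∷ _) = ≤-refl

  eval-if-true : ∀ S {k} (e t f : Exp k) ρ → nonempty (eval S e ρ) ≡ true → eval S (ifᴱ e t f) ρ ≡ eval S t ρ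
  eval-if-true S e t f ρ eq = trans (eval-if S e t f ρ) (cong (λ z → if z then eval S t ρ else eval S f ρ) eq)

  eval-if-false : ∀ S {k} (e t f : Exp k) ρ → nonempty (eval S e ρ) ≡ false → eval S (ifᴱ e t f) ρ ≡ eval S f ρ
  eval-if-false S e t f ρ eq = trans (eval-if S e t f ρ) (cong (λ z → if z then eval S t ρ else eval S f ρ) eq)

  length-if : ∀ S {k} (e t f : Exp k) ρ {N} → length (eval S t ρ) ≤ N → length (eval S f ρ) ≤ N → length (eval S (ifᴱ e t f) ρ) ≤ N
  length-if S e t f ρ t≤ f≤ with eval S e ρ
  ... | []    = f≤
  ... | _ ∷ _ = t≤

  -- State: comparison of the bits seen so far, remaining bits of the right-hand side.
  ltBody : Bool → Fin 2 → Exp 2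
  ltBody a 0F = test (var 0F) λ f → test (var 1F) λ s → flagᴱ (borrow a (fromHead s) (is-just f))
  ltBody a 1F = tail (var 1F)

  lt₁ : ∀ {k} → Exp k → Exp k → Fin 2 → Exp k
  lt₁ x y i = loop x (nil ∷ᴱ y ∷ᴱ []ᴱ) ltBody
    (1 , λ { S b ρ N h 0F → length-flag S (borrow b (fromHead (List.head (ρ 1F))) (is-just (List.head (ρ 0F)))) ρ N
           ; S b ρ N h 1F → ≤-trans (drop1≤ (ρ 1F)) (m≤n⇒m≤1+n (h 1F)) }) (var i)

  lt : ∀ {k} → Exp k → Exp k → Exp k
  -- What the first loop has left of `y` is compared with zeros.
  lt x y = loop (lt₁ x y 1F) (λ (_ : Fin 1) → lt₁ x y 0F)
    (λ s _ → test (var 0F) λ f → flagᴱ (borrow false s (is-just f)))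
    (1 , λ S b ρ N h _ → length-flag S (borrow false b (is-just (List.head (ρ 0F)))) ρ N) (var 0F)

  module _ (S : Semantics) where

    nonempty-lt : ∀ {k} (x y : Exp k) ρ → nonempty (eval S (lt x y) ρ) ≡ (val (eval S x ρ) <ᵇ val (eval S y ρ))
    nonempty-lt x y ρ = trans (second (st₁ 1F) (λ _ → st₁ 0F)) (trans (first (eval S x ρ) _) (cong (val (eval S x ρ) <ᵇ_) (+-identityʳ (val (eval S y ρ)))))
      where
      st₁ : Env 2
      st₁ i = eval S (lt₁ x y i) ρ
      first : ∀ xs st → let st′ = iterate (λ b st i → eval S (ltBody b i) st) xs st in
        (0 <ᵇ val (st′ 1F) + bitℕ (nonempty (st′ 0F))) ≡ (val xs <ᵇ val (st 1F) + bitℕ (nonempty (st 0F)))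
      first []       st = refl
      first (a ∷ xs) st = trans (first xs (λ i → eval S (ltBody a i) st))
        (trans (cong (λ z → val xs <ᵇ val (List.drop 1 (st 1F)) + bitℕ z) flag≡)
          (trans (sym (<ᵇ-borrow a (headBit (st 1F)) (nonempty (st 0F)) (val xs) (val (List.drop 1 (st 1F)))))
            (cong (λ z → bitℕ a + 2 * val xs <ᵇ z + bitℕ (nonempty (st 0F))) (sym (val-uncons (st 1F))))))
        where
        flag≡ : nonempty (eval S (ltBody a 0F) st) ≡ borrow a (headBit (st 1F)) (nonempty (st 0F))
        flag≡ rewrite eval-flag S (borrow a (fromHead (List.head (st 1F))) (is-just (List.head (st 0F)))) st
          | nonempty-flagList (borrow a (fromHead (List.head (st 1F))) (is-just (List.head (st 0F))))
          | fromHead-head (st 1F) | is-just-head (st 0F) = refl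
      second : ∀ ys (st : Env 1) → nonempty (iterate (λ s st (_ : Fin 1) →
          eval S (test (var 0F) λ f → flagᴱ (borrow false s (is-just f))) st) ys st 0F) ≡ (0 <ᵇ val ys + bitℕ (nonempty (st 0F)))
      second []       st with nonempty (st 0F)
      ... | true  = refl
      ... | false = refl
      second (s ∷ ys) st = trans (second ys _)
        (trans (cong (λ z → 0 <ᵇ val ys + bitℕ z) flag≡) (sym (<ᵇ-borrow false s (nonempty (st 0F)) 0 (val ys))))
        where
        flag≡ : nonempty (eval S (flagᴱ (borrow false s (is-just (List.head (st 0F))))) st) ≡ borrow false s (nonempty (st 0F))
        flag≡ rewrite eval-flag S (borrow false s (is-just (List.head (st 0F)))) st
          | nonempty-flagList (borrow false s (is-just (List.head (st 0F)))) | is-just-head (st 0F) = refl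

  mulBody : Bool → Fin 2 → Exp 2
  mulBody b 0F = if b then add (var 0F) (var 1F) else var 0F
  mulBody b 1F = cons false (var 1F)

  mul : ∀ {k} → Exp k → Exp k → Exp k
  mul x y = loop x (nil ∷ᴱ y ∷ᴱ []ᴱ) mulBody
    (1 , λ { S true ρ N h 0F → length-add S (var 0F) (var 1F) ρ (h 0F) (h 1F)
           ; S false ρ N h 0F → m≤n⇒m≤1+n (h 0F) ; S b ρ N h 1F → s≤s (h 1F) }) (var 0F)

  -- Multiplication by the length of the first argument.
  scale : ∀ {k} → Exp k → Exp k → Exp k
  scale u x = loop u (nil ∷ᴱ x ∷ᴱ []ᴱ) (λ _ → add (var 0F) (var 1F) ∷ᴱ var 1F ∷ᴱ []ᴱ)
    (1 , λ { S b ρ N h 0F → length-add S (var 0F) (var 1F) ρ (h 0F) (h 1F) ; S b ρ N h 1F → m≤n⇒m≤1+n (h 1F) }) (var 0F)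

  power : ∀ {k} → Exp k → ℕ → Exp k
  power x zero    = cons true nil
  power x (suc r) = mul x (power x r)

  -- Two to the length of the argument.
  exp₂ : ∀ {k} → Exp k → Exp k
  exp₂ u = loop u (λ (_ : Fin 1) → cons true nil) (λ _ _ → cons false (var 0F)) (1 , λ S b ρ N h i → s≤s (h 0F)) (var 0F)

  module _ (S : Semantics) where

    val-mul : ∀ {k} (x y : Exp k) ρ → val (eval S (mul x y) ρ) ≡ val (eval S x ρ) * val (eval S y ρ)
    val-mul x y ρ = go (eval S x ρ) _
      where
      go : ∀ xs st → val (iterate (λ b st i → eval S (mulBody b i) st) xs st 0F) ≡ val (st 0F) + val xs * val (st 1F)
      go []           st = sym (+-identityʳ _)
      go (false ∷ xs) st = trans (go xs _) (arith (val (st 0F)) (val xs) (val (st 1F)))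
        where
        arith : ∀ a x y → a + x * (2 * y) ≡ a + (2 * x) * y
        arith = solve-∀
      go (true ∷ xs)  st rewrite go xs (λ i → eval S (mulBody true i) st) | val-add S (var 0F) (var 1F) st =
        arith (val (st 0F)) (val xs) (val (st 1F))
        where
        arith : ∀ a x y → a + y + x * (2 * y) ≡ a + (y + (2 * x) * y)
        arith = solve-∀

    val-scale : ∀ {k} (u x : Exp k) ρ → val (eval S (scale u x) ρ) ≡ length (eval S u ρ) * val (eval S x ρ)
    val-scale u x ρ = go (eval S u ρ) _
      where
      go : ∀ us st → val (iterate (λ b st i → eval S ((add (var 0F) (var 1F) ∷ᴱ var 1F ∷ᴱ []ᴱ) i) st) us st 0F) ≡
        val (st 0F) + length us * val (st 1F)
      go []       st = sym (+-identityʳ _)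
      go (_ ∷ us) st rewrite go us (λ i → eval S ((add (var 0F) (var 1F) ∷ᴱ var 1F ∷ᴱ []ᴱ) i) st) | val-add S (var 0F) (var 1F) st =
        +-assoc (val (st 0F)) _ _

    val-power : ∀ {k} (x : Exp k) r ρ → val (eval S (power x r) ρ) ≡ val (eval S x ρ) ^ r
    val-power x zero    ρ = refl
    val-power x (suc r) ρ = trans (val-mul x (power x r) ρ) (cong (val (eval S x ρ) *_) (val-power x r ρ))

    eval-exp₂ : ∀ {k} (u : Exp k) ρ → eval S (exp₂ u) ρ ≡ zerosOne (suc (length (eval S u ρ)))
    eval-exp₂ u ρ = trans (go (eval S u ρ) 0 (λ _ → true ∷ []) refl) (cong (zerosOne ∘ suc) (+-identityʳ _))
      where
      go : ∀ us m (st : Env 1) → st 0F ≡ zerosOne (suc m) → iterate (λ _ st _ → false ∷ st 0F) us st 0F ≡ zerosOne (suc (length us + m))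
      go []       m st eq = eq
      go (_ ∷ us) m st eq = trans (go us (suc m) _ (cong (false ∷_) eq)) (cong (zerosOne ∘ suc) (+-suc (length us) m))

    val-exp₂ : ∀ {k} (u : Exp k) ρ → val (eval S (exp₂ u) ρ) ≡ 2 ^ length (eval S u ρ)
    val-exp₂ u ρ = trans (cong val (eval-exp₂ u ρ)) (val-zerosOne (length (eval S u ρ)))

  -- Binary search for the largest number satisfying a downward closed
  -- predicate. State: the number found so far, the next power of two, and the
  -- parameters of the predicate.
  module Search {j} (P : Exp (suc j)) where

    candidate : Exp (2 + j)
    candidate = add (var 0F) (var 1F)

    trial : Exp (2 + j)
    trial = call P (candidate ∷ᴱ λ i → var (suc (suc i)))

    body : Bool → Fin (2 + j) → Exp (2 + j)
    body b 0F            = ifᴱ trial candidate (var 0F)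
    body b 1F            = tail (var 1F)
    body b (suc (suc i)) = var (suc (suc i))

    search : ∀ {k} → Exp k → (Fin j → Exp k) → Exp k
    -- One pass for each of the powers 2 ^ length u, ..., 2, 1; hence the element added to `u`.
    search u params = loop (cons true u) (nil ∷ᴱ exp₂ u ∷ᴱ params) body
      (1 , λ { S b ρ N h 0F → length-if S trial candidate (var 0F) ρ (length-add S (var 0F) (var 1F) ρ (h 0F) (h 1F)) (m≤n⇒m≤1+n (h 0F))
             ; S b ρ N h 1F → ≤-trans (drop1≤ (ρ 1F)) (m≤n⇒m≤1+n (h 1F)) ; S b ρ N h (suc (suc i)) → m≤n⇒m≤1+n (h (suc (suc i))) }) (var 0F)

    module _ (S : Semantics) (π : Env j) (D : ℕ)
      -- Every candidate contains a power of two and is thus positive, so the predicate has to be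
      -- right for positive numbers only.
      (holds : ∀ (ρ : Env (suc j)) → (∀ i → ρ (suc i) ≡ π i) → 1 ≤ val (ρ 0F) → nonempty (eval S P ρ) ≡ (val (ρ 0F) <ᵇ suc D)) where

      -- The number sought stays in the interval of length 2 ^ m above the number found so far,
      -- where m passes are left.
      search-loop : ∀ ts st → st 1F ≡ zerosOne (length ts) → (∀ i → st (suc (suc i)) ≡ π i) →
        val (st 0F) ≤ D → D < val (st 0F) + 2 ^ length ts →
        val (iterate (λ b st i → eval S (body b i) st) ts st 0F) ≡ D
      search-loop [] st pow≡ par lo hi = ≤-antisym lo (s≤s⁻¹ (≤-trans hi (≤-reflexive (+-comm (val (st 0F)) 1))))
      search-loop (t ∷ ts) st pow≡ par lo hi =
        search-loop ts st′ (trans (cong (List.drop 1) pow≡) (drop-zerosOne (length ts))) par (proj₁ bounds) (proj₂ bounds)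
        where
        st′ : Env (2 + j)
        st′ i = eval S (body t i) st
        m = length ts
        cand≡ : val (eval S candidate st) ≡ val (st 0F) + 2 ^ m
        cand≡ = trans (val-add S (var 0F) (var 1F) st) (cong (val (st 0F) +_) (trans (cong val pow≡) (val-zerosOne m)))
        trial≡ : nonempty (eval S trial st) ≡ (val (st 0F) + 2 ^ m <ᵇ suc D)
        trial≡ = trans (holds _ par (≤-trans (≤-trans (m^n>0 2 m) (m≤n+m (2 ^ m) (val (st 0F)))) (≤-reflexive (sym cand≡)))) (cong (_<ᵇ suc D) cand≡)
        bounds : val (st′ 0F) ≤ D × D < val (st′ 0F) + 2 ^ m
        bounds with val (st 0F) + 2 ^ m <ᵇ suc D in eq
        ... | true  rewrite eval-if-true S trial candidate (var 0F) st (trans trial≡ eq) | cand≡ =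
          s≤s⁻¹ (<ᵇ-true⁻¹ eq) , ≤-trans hi (≤-reflexive (arith (val (st 0F)) (2 ^ m)))
          where
          arith : ∀ v p → v + 2 * p ≡ v + p + p
          arith = solve-∀
        ... | false rewrite eval-if-false S trial candidate (var 0F) st (trans trial≡ eq) = lo , <ᵇ-false⁻¹ eq

      val-search : ∀ {k} (u : Exp k) (params : Fin j → Exp k) ρ → (∀ i → eval S (params i) ρ ≡ π i) →
        D < 2 ^ suc (length (eval S u ρ)) → val (eval S (search u params) ρ) ≡ D
      val-search u params ρ par D< = search-loop (true ∷ eval S u ρ) _ (eval-exp₂ S u ρ) par z≤n D<

  dropᴱ : ∀ {k} → Exp k → Exp k → Exp k
  dropᴱ u x = loop u (λ (_ : Fin 1) → x) (λ _ _ → tail (var 0F)) (1 , λ S b ρ N h i → ≤-trans (drop1≤ (ρ 0F)) (m≤n⇒m≤1+n (h 0F))) (var 0F)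

  eval-drop : ∀ S {k} (u x : Exp k) ρ → eval S (dropᴱ u x) ρ ≡ List.drop (length (eval S u ρ)) (eval S x ρ)
  eval-drop S u x ρ = go (eval S u ρ) _
    where
    go : ∀ us (st : Env 1) → iterate (λ _ st _ → List.drop 1 (st 0F)) us st 0F ≡ List.drop (length us) (st 0F)
    go []       st = refl
    go (_ ∷ us) st = trans (go us _) (drop-drop1 (length us) (st 0F))

  splitBody : Bool → Fin 2 → Exp 2
  splitBody _ 0F = tail (var 0F)
  splitBody _ 1F = test (var 0F) λ h → cons (fromHead h) (var 1F)

  splitAtᴱ : ∀ {k} → Exp k → Exp k → Fin 2 → Exp k
  splitAtᴱ x p i = loop p (x ∷ᴱ nil ∷ᴱ []ᴱ) splitBody
    (1 , λ { S b ρ N h 0F → ≤-trans (drop1≤ (ρ 0F)) (m≤n⇒m≤1+n (h 0F)) ; S b ρ N h 1F → s≤s (h 1F) }) (var i)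

  -- A zipper: the first loop moves the prefix onto a second list, padding it if necessary, and the
  -- second loop moves it back.
  set : ∀ {k} → Exp k → Exp k → Bool → Exp k
  set x p b = loop (splitAtᴱ x p 1F) (λ (_ : Fin 1) → cons b (tail (splitAtᴱ x p 0F))) (λ c _ → cons c (var 0F))
    (1 , λ S b ρ N h i → s≤s (h 0F)) (var 0F)

  eval-set : ∀ S {k} (x p : Exp k) b ρ → eval S (set x p b) ρ ≡ setAt (eval S x ρ) (length (eval S p ρ)) b
  eval-set S x p b ρ = trans (back (eval S (splitAtᴱ x p 1F) ρ) _) (go (eval S p ρ) _)
    where
    back : ∀ ds (st : Env 1) → iterate (λ c st _ → c ∷ st 0F) ds st 0F ≡ ds ʳ++ st 0F
    back []       st = refl
    back (d ∷ ds) st = back ds _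
    setAt-zero : ∀ xs → b ∷ List.drop 1 xs ≡ setAt xs 0 b
    setAt-zero []       = refl
    setAt-zero (x ∷ xs) = refl
    setAt-suc : ∀ xs p → headBit xs ∷ setAt (List.drop 1 xs) p b ≡ setAt xs (suc p) b
    setAt-suc []       p = refl
    setAt-suc (x ∷ xs) p = refl
    go : ∀ ps st → let st′ = iterate (λ b st i → eval S (splitBody b i) st) ps st in
      st′ 1F ʳ++ (b ∷ List.drop 1 (st′ 0F)) ≡ st 1F ʳ++ setAt (st 0F) (length ps) b
    go []       st = cong (st 1F ʳ++_) (setAt-zero (st 0F))
    go (_ ∷ ps) st = trans (go ps _) (cong (st 1F ʳ++_)
      (trans (cong (_∷ setAt (List.drop 1 (st 0F)) (length ps) b) (fromHead-head (st 0F))) (setAt-suc (st 0F) (length ps))))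

  stripBody : Bool → Fin 1 → Exp 1
  stripBody b _ = test (var 0F) λ o → if b ∨ is-just o then cons b (var 0F) else nil

  -- Zeros are ignored as long as the output is empty. If nothing is left, a single zero is
  -- produced, in accordance with `numeral`.
  strip : ∀ {k} → Exp k → Exp k
  strip x = ifᴱ w (rev w) (cons false nil)
    where
    w = loop x (λ _ → nil) stripBody (1 , growth) (var 0F)
      where
      growth : ∀ (S : Semantics) b (ρ : Env 1) N → Bounded N ρ → ∀ i → length (eval S (stripBody b i) ρ) ≤ 1 + N
      growth S b ρ N h i with b ∨ is-just (List.head (ρ 0F))
      ... | true  = s≤s (h 0F)
      ... | false = z≤n

  eval-strip : ∀ S {k} (x : Exp k) ρ → eval S (strip x) ρ ≡
    (let w = stripped (eval S x ρ) [] in if nonempty w then reverse w else false ∷ [])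
  eval-strip S x ρ = trans (eval-if S w (rev w) (cons false nil) ρ)
      (trans (cong (λ z → if nonempty (eval S w ρ) then z else false ∷ []) (eval-rev S w ρ))
        (cong (λ z → if nonempty z then reverse z else false ∷ []) (go (eval S x ρ) _)))
    where
    w = loop x (λ _ → nil) stripBody _ (var 0F)
    go : ∀ xs (st : Env 1) → iterate (λ b st i → eval S (stripBody b i) st) xs st 0F ≡ stripped xs (st 0F)
    go []       st = refl
    go (b ∷ xs) st = trans (go xs _) (trans (cong (stripped xs) (step≡ b)) (stripped-step b (st 0F)))
      where
      step≡ : ∀ b → eval S (stripBody b 0F) st ≡ (if b ∨ nonempty (st 0F) then b ∷ st 0F else [])
      step≡ b rewrite is-just-head (st 0F) with b ∨ nonempty (st 0F)
      ... | true  = refl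
      ... | false = refl
      stripped-step : ∀ b out → stripped xs (if b ∨ nonempty out then b ∷ out else []) ≡ stripped (b ∷ xs) out
      stripped-step true  []      = refl
      stripped-step false []      = refl
      stripped-step true  (_ ∷ _) = refl
      stripped-step false (_ ∷ _) = refl

  -- State: remaining bits, reversed leading bits, whether a blank was met.
  numberBody : Bool → Fin 3 → Exp 3
  numberBody f 0F = tail (var 0F)
  numberBody f 1F = test (var 2F) λ s → if f ∧ not (is-just s) then (test (var 0F) λ h → cons (fromHead h) (var 1F)) else var 1F
  numberBody f 2F = if f then var 2F else cons true nil

  number : ∀ {k} → Exp k → Exp k → Exp k
  number flags bits = loop flags (bits ∷ᴱ nil ∷ᴱ nil ∷ᴱ []ᴱ) numberBody (1 , growth) (var 1F)
    where
    growth : ∀ (S : Semantics) b (ρ : Env 3) N → Bounded N ρ → ∀ i → length (eval S (numberBody b i) ρ) ≤ 1 + N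
    growth S b ρ N h 0F = ≤-trans (drop1≤ (ρ 0F)) (m≤n⇒m≤1+n (h 0F))
    growth S b ρ N h 1F with b ∧ not (is-just (List.head (ρ 2F)))
    ... | true  = s≤s (h 1F)
    ... | false = m≤n⇒m≤1+n (h 1F)
    growth S true ρ N h 2F = m≤n⇒m≤1+n (h 2F)
    growth S false ρ N h 2F = s≤s z≤n

  eval-number : ∀ S {k} (flags bits : Exp k) ρ cs → eval S flags ρ ≡ List.map isBit cs → eval S bits ρ ≡ List.map bitOf cs →
    val (eval S (number flags bits) ρ) ≡ fromBits (leadingBits cs)
  eval-number S flags bits ρ cs F≡ V≡ =
    trans (cong val (trans (cong (λ F → iterate step F _ 1F) F≡) (go cs _ V≡ refl)))
      (trans (sym (fromBits-reverse (reverse (leadingBits cs)))) (cong fromBits (reverse-involutive (leadingBits cs))))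
    where
    step : Bool → Env 3 → Env 3
    step b st i = eval S (numberBody b i) st
    stopped : ∀ fs st {x xs} → st 2F ≡ x ∷ xs → iterate step fs st 1F ≡ st 1F
    stopped []           st eq = refl
    stopped (true ∷ fs)  st eq = trans (stopped fs (step true st) eq) out≡
      where
      out≡ : step true st 1F ≡ st 1F
      out≡ rewrite eq = refl
    stopped (false ∷ fs) st eq = trans (stopped fs (step false st) refl) refl
    go : ∀ cs st → st 0F ≡ List.map bitOf cs → st 2F ≡ [] → iterate step (List.map isBit cs) st 1F ≡ leadingBits cs ʳ++ st 1F
    go []            st V≡ s≡ = refl
    go (bit b ∷ cs)  st V≡ s≡ = trans (go cs (step true st) (cong (List.drop 1) V≡) s≡) (cong (leadingBits cs ʳ++_) out≡)
      where
      out≡ : step true st 1F ≡ b ∷ st 1F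
      out≡ rewrite s≡ | V≡ = refl
    go (blank ∷ cs) st V≡ s≡ = trans (stopped (List.map isBit cs) (step false st) refl) refl

  -- As many bits of the second argument as the first one is long, most
  -- significant bit first.
  bits : ∀ {k} → Exp k → Exp k → Exp k
  bits u x = loop u (x ∷ᴱ nil ∷ᴱ []ᴱ) splitBody
    (1 , λ { S b ρ N h 0F → ≤-trans (drop1≤ (ρ 0F)) (m≤n⇒m≤1+n (h 0F)) ; S b ρ N h 1F → s≤s (h 1F) }) (var 1F)

  eval-bits : ∀ S {k} (u x : Exp k) ρ → eval S (bits u x) ρ ≡ Vec.toList (toBits (length (eval S u ρ)) (val (eval S x ρ)))
  eval-bits S u x ρ = trans (go (eval S u ρ) 0 _ refl refl) (cong (λ l → Vec.toList (toBits l (val (eval S x ρ)))) (+-identityʳ _))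
    where
    xs = eval S x ρ
    go : ∀ us p st → st 0F ≡ List.drop p xs → st 1F ≡ Vec.toList (toBits p (val xs)) →
      iterate (λ b st i → eval S (splitBody b i) st) us st 1F ≡ Vec.toList (toBits (length us + p) (val xs))
    go []       p st eq₀ eq₁ = eq₁
    go (_ ∷ us) p st eq₀ eq₁ = trans (go us (suc p) _ (trans (cong (List.drop 1) eq₀) (drop1-drop p xs))
        (cong₂ _∷_ (trans (fromHead-head (st 0F)) (trans (cong headBit eq₀) (sym (testBit-val p xs)))) eq₁))
      (cong (λ l → Vec.toList (toBits l (val xs))) (+-suc (length us) p))
      where
      drop1-drop : ∀ n (ys : List Bool) → List.drop 1 (List.drop n ys) ≡ List.drop (suc n) ys
      drop1-drop zero    ys       = refl
      drop1-drop (suc n) []       = refl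
      drop1-drop (suc n) (y ∷ ys) = drop1-drop n ys

  -- State: a power of two, its logarithm in unary, the argument.
  logBody : Bool → Fin 3 → Exp 3
  logBody _ 0F = ifᴱ (lt (var 0F) (var 2F)) (cons false (var 0F)) (var 0F)
  logBody _ 1F = ifᴱ (lt (var 0F) (var 2F)) (cons true (var 1F)) (var 1F)
  logBody _ 2F = var 2F

  log : ∀ {k} → Exp k → Exp k
  log x = loop x (cons true nil ∷ᴱ nil ∷ᴱ x ∷ᴱ []ᴱ) logBody
    (1 , λ { S b ρ N h 0F → length-if S (lt (var 0F) (var 2F)) (cons false (var 0F)) (var 0F) ρ (s≤s (h 0F)) (m≤n⇒m≤1+n (h 0F))
           ; S b ρ N h 1F → length-if S (lt (var 0F) (var 2F)) (cons true (var 1F)) (var 1F) ρ (s≤s (h 1F)) (m≤n⇒m≤1+n (h 1F))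
           ; S b ρ N h 2F → m≤n⇒m≤1+n (h 2F) }) (var 1F)

  -- After m passes the unary counter has length min(m, L). The length of `x` is a sufficient number
  -- of passes, since its value is below 2 ^ length.
  length-log : ∀ S {k} (x : Exp k) ρ → length (eval S (log x) ρ) ≡ ⌈log₂ val (eval S x ρ) ⌉
  length-log S x ρ = trans (go xs _ refl z≤n refl) (m≥n⇒m⊓n≡n (≤-trans (⌈log₂⌉≤ (<⇒≤ (val< xs))) (m≤m+n (length xs) 0)))
    where
    xs = eval S x ρ
    L = ⌈log₂ val xs ⌉
    go : ∀ ts st → val (st 0F) ≡ 2 ^ length (st 1F) → length (st 1F) ≤ L → st 2F ≡ xs →
      length (iterate (λ b st i → eval S (logBody b i) st) ts st 1F) ≡ (length ts + length (st 1F)) ⊓ L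
    go []       st pow≡ le x≡ = sym (m≤n⇒m⊓n≡m le)
    go (t ∷ ts) st pow≡ le x≡ with 2 ^ length (st 1F) <ᵇ val xs in eq
    ... | true  = trans (go ts st′ pow′ le′ x≡) (cong (_⊓ L) (trans (cong (length ts +_) (cong length u≡)) (+-suc (length ts) _)))
      where
      st′ : Env 3
      st′ i = eval S (logBody t i) st
      lt≡ : nonempty (eval S (lt (var 0F) (var 2F)) st) ≡ true
      lt≡ = trans (nonempty-lt S (var 0F) (var 2F) st) (trans (cong₂ _<ᵇ_ pow≡ (cong val x≡)) eq)
      u≡ : st′ 1F ≡ true ∷ st 1F
      u≡ = eval-if-true S (lt (var 0F) (var 2F)) (cons true (var 1F)) (var 1F) st lt≡
      pow′ : val (st′ 0F) ≡ 2 ^ length (st′ 1F)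
      pow′ rewrite u≡ | eval-if-true S (lt (var 0F) (var 2F)) (cons false (var 0F)) (var 0F) st lt≡ = cong (2 *_) pow≡
      le′ : length (st′ 1F) ≤ L
      le′ rewrite u≡ = <⌈log₂⌉ {val xs} (<ᵇ-true⁻¹ {n = val xs} eq)
    ... | false = trans (go ts st′ pow′ le′ x≡)
        (trans (cong (λ u → (length ts + length u) ⊓ L) u≡) (trans (m≥n⇒m⊓n≡n (high (length ts))) (sym (m≥n⇒m⊓n≡n (m≤n⇒m≤1+n (high (length ts)))))))
      where
      st′ : Env 3
      st′ i = eval S (logBody t i) st
      lt≡ : nonempty (eval S (lt (var 0F) (var 2F)) st) ≡ false
      lt≡ = trans (nonempty-lt S (var 0F) (var 2F) st) (trans (cong₂ _<ᵇ_ pow≡ (cong val x≡)) eq)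
      u≡ : st′ 1F ≡ st 1F
      u≡ = eval-if-false S (lt (var 0F) (var 2F)) (cons true (var 1F)) (var 1F) st lt≡
      pow′ : val (st′ 0F) ≡ 2 ^ length (st′ 1F)
      pow′ rewrite u≡ | eval-if-false S (lt (var 0F) (var 2F)) (cons false (var 0F)) (var 0F) st lt≡ = pow≡
      le′ : length (st′ 1F) ≤ L
      le′ rewrite u≡ = le
      full : length (st 1F) ≡ L
      full = ≤-antisym le (⌈log₂⌉≤ {val xs} (<ᵇ-false⁻¹ {n = val xs} eq))
      high : ∀ m → L ≤ m + length (st 1F)
      high m = ≤-trans (≤-reflexive (sym full)) (m≤n+m _ m)

-- Positions in the encoding of a structure

bitAt : List Bool → ℕ → List Bool
bitAt []       i       = []
bitAt (b ∷ bs) zero    = b ∷ []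
bitAt (b ∷ bs) (suc i) = bitAt bs i

inputBits-inputAt : ∀ xs i → inputBits (inputAt xs i) ≡ bitAt xs i
inputBits-inputAt []       i       = refl
inputBits-inputAt (b ∷ bs) zero    = refl
inputBits-inputAt (b ∷ bs) (suc i) = inputBits-inputAt bs i

bitAt-++ˡ : ∀ xs ys {i} → i < length xs → bitAt (xs ++ ys) i ≡ bitAt xs i
bitAt-++ˡ (x ∷ xs) ys {zero}  _       = refl
bitAt-++ˡ (x ∷ xs) ys {suc i} (s≤s h) = bitAt-++ˡ xs ys h

bitAt-++ʳ : ∀ xs ys i → bitAt (xs ++ ys) (length xs + i) ≡ bitAt ys i
bitAt-++ʳ []       ys i = refl
bitAt-++ʳ (x ∷ xs) ys i = bitAt-++ʳ xs ys i

nonempty-bitAt : ∀ xs i → nonempty (bitAt xs i) ≡ (i <ᵇ length xs)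
nonempty-bitAt []       zero    = refl
nonempty-bitAt []       (suc i) = refl
nonempty-bitAt (x ∷ xs) zero    = refl
nonempty-bitAt (x ∷ xs) (suc i) = nonempty-bitAt xs i

bitAt-single : ∀ xs i {b} → bitAt xs i ≡ b ∷ [] → i < length xs
bitAt-single xs i eq = <ᵇ-true⁻¹ (trans (sym (nonempty-bitAt xs i)) (cong nonempty eq))

bitAt-blocks : ∀ {m} (f : Fin m → List Bool) L → (∀ i → length (f i) ≡ L) → ∀ i j → j < L →
  bitAt (concat (List.tabulate f)) (toℕ i * L + j) ≡ bitAt (f i) j
bitAt-blocks f L len zero    j j<L = bitAt-++ˡ (f zero) _ (subst (j <_) (sym (len zero)) j<L)
bitAt-blocks f L len (suc i) j j<L =
  trans (cong (bitAt (f zero ++ concat (List.tabulate (f ∘ suc)))) (trans (+-assoc L (toℕ i * L) j) (cong (_+ (toℕ i * L + j)) (sym (len zero)))))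
    (trans (bitAt-++ʳ (f zero) _ (toℕ i * L + j)) (bitAt-blocks (f ∘ suc) L (len ∘ suc) i j j<L))

length-blocks : ∀ {m} (f : Fin m → List Bool) L → (∀ i → length (f i) ≡ L) → length (concat (List.tabulate f)) ≡ m * L
length-blocks {zero}  f L len = refl
length-blocks {suc m} f L len = trans (length-++ (f zero)) (cong₂ _+_ (len zero) (length-blocks (f ∘ suc) L (len ∘ suc)))

cartesian-blocks : ∀ {X Y Z : Set} {m} (f : X → Y → Z) (R : Z → Bool) (g : Fin m → X) ys →
  List.map R (cartesianProductWith f (List.tabulate g) ys) ≡ concat (List.tabulate (λ i → List.map (R ∘ f (g i)) ys))
cartesian-blocks {m = zero}  f R g ys = refl
cartesian-blocks {m = suc m} f R g ys =
  trans (map-++ R (List.map (f (g zero)) ys) _) (cong₂ _++_ (sym (map-∘ ys)) (cartesian-blocks f R (g ∘ suc) ys))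

relation-blocks : ∀ {n r} (R : Vec (Fin n) (suc r) → Bool) →
  encodeRelation R ≡ concat (List.tabulate (λ d → encodeRelation (R ∘ (d ∷_))))
relation-blocks {n} {r} R = cartesian-blocks _∷_ R id (tuples n r)

length-relation : ∀ {n r} (R : Vec (Fin n) r → Bool) → length (encodeRelation R) ≡ n ^ r
length-relation {r = zero}  R = refl
length-relation {r = suc r} R = trans (cong length (relation-blocks R)) (length-blocks _ _ (λ d → length-relation (R ∘ (d ∷_))))

-- The rank of a tuple in lexicographic order, as the value of its digits in base n.
horner : ∀ {n r} → Vec (Fin n) r → ℕ
horner []                     = 0
horner {n} {suc r} (d ∷ ds) = toℕ d * n ^ r + horner ds

horner< : ∀ {n r} (ds : Vec (Fin n) r) → horner ds < n ^ r
horner< []                     = s≤s z≤n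
horner< {n} {suc r} (d ∷ ds) = begin-strict
  toℕ d * n ^ r + horner ds   <⟨ +-monoʳ-< (toℕ d * n ^ r) (horner< ds) ⟩
  toℕ d * n ^ r + n ^ r       ≡⟨ +-comm _ (n ^ r) ⟩
  suc (toℕ d) * n ^ r         ≤⟨ *-monoˡ-≤ (n ^ r) (toℕ<n d) ⟩
  n * n ^ r                   ∎
  where open ≤-Reasoning

bitAt-relation : ∀ {n r} (R : Vec (Fin n) r → Bool) ds → bitAt (encodeRelation R) (horner ds) ≡ R ds ∷ []
bitAt-relation R []       = refl
bitAt-relation {n} {suc r} R (d ∷ ds) = trans (cong (λ xs → bitAt xs (toℕ d * n ^ r + horner ds)) (relation-blocks R))
  (trans (bitAt-blocks _ (n ^ r) (λ d → length-relation (R ∘ (d ∷_))) d (horner ds) (horner< ds)) (bitAt-relation (R ∘ (d ∷_)) ds))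

bitOfValue : ∀ {n k} → (Vec (Fin n) k → Fin n) → Fin ⌈log₂ n ⌉ → Vec (Fin n) k → Bool
bitOfValue f m as = Vec.lookup (encodeElement (f as)) m

function-blocks : ∀ {n k} (f : Vec (Fin n) k → Fin n) →
  encodeFunction f ≡ concat (List.tabulate (λ m → encodeRelation (bitOfValue f m)))
function-blocks f = cong concat (map-tabulate id (λ m → encodeRelation (bitOfValue f m)))

length-function : ∀ {n k} (f : Vec (Fin n) k → Fin n) → length (encodeFunction f) ≡ ⌈log₂ n ⌉ * n ^ k
length-function f = trans (cong length (function-blocks f)) (length-blocks _ _ (λ m → length-relation (bitOfValue f m)))

bitAt-function : ∀ {n k} (f : Vec (Fin n) k → Fin n) m ds →
  bitAt (encodeFunction f) (toℕ m * n ^ k + horner ds) ≡ bitOfValue f m ds ∷ []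
bitAt-function {n} {k} f m ds = trans (cong (λ xs → bitAt xs (toℕ m * n ^ k + horner ds)) (function-blocks f))
  (trans (bitAt-blocks _ (n ^ k) (λ m → length-relation (bitOfValue f m)) m (horner ds) (horner< ds)) (bitAt-relation (bitOfValue f m) ds))

Relations Functions : ℕ → List ℕ → Set
Relations n = All (λ r → Vec (Fin n) r → Bool)
Functions n = All (λ k → Vec (Fin n) k → Fin n)

relationsCode : ∀ {n rs} → Relations n rs → List Bool
relationsCode Rs = concat (All.reduce encodeRelation Rs)

functionsCode : ∀ {n ks} → Functions n ks → List Bool
functionsCode Fs = concat (All.reduce encodeFunction Fs)

sumPowers : List ℕ → ℕ → ℕ
sumPowers []       n = 0
sumPowers (r ∷ rs) n = n ^ r + sumPowers rs n

-- The length of what precedes the segment of a relation. For functions it has to be multiplied by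
-- `⌈log₂ n ⌉`.
offset : ∀ {rs r} → rs ∋ r → ℕ → ℕ
offset here               n = 0
offset (there {r′ = r′} p) n = n ^ r′ + offset p n

length-relationsCode : ∀ {n rs} (Rs : Relations n rs) → length (relationsCode Rs) ≡ sumPowers rs n
length-relationsCode []       = refl
length-relationsCode (R ∷ Rs) = trans (length-++ (encodeRelation R)) (cong₂ _+_ (length-relation R) (length-relationsCode Rs))

length-functionsCode : ∀ {n ks} (Fs : Functions n ks) → length (functionsCode Fs) ≡ ⌈log₂ n ⌉ * sumPowers ks n
length-functionsCode {n} []       = sym (*-zeroʳ ⌈log₂ n ⌉)
length-functionsCode {n} {k ∷ ks} (f ∷ Fs) = trans (length-++ (encodeFunction f))
  (trans (cong₂ _+_ (length-function f) (length-functionsCode Fs)) (sym (*-distribˡ-+ ⌈log₂ n ⌉ (n ^ k) (sumPowers ks n))))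

bitAt-relations : ∀ {n rs r} (Rs : Relations n rs) (p : rs ∋ r) ys ds →
  bitAt (relationsCode Rs ++ ys) (offset p n + horner ds) ≡ lookupAll Rs p ds ∷ []
bitAt-relations (R ∷ Rs) here ys ds = trans (cong (λ xs → bitAt xs (horner ds)) (++-assoc (encodeRelation R) (relationsCode Rs) ys))
  (trans (bitAt-++ˡ (encodeRelation R) _ (subst (horner ds <_) (sym (length-relation R)) (horner< ds))) (bitAt-relation R ds))
bitAt-relations {n} {r′ ∷ rs} (R ∷ Rs) (there p) ys ds =
  trans (cong₂ bitAt (++-assoc (encodeRelation R) (relationsCode Rs) ys)
      (trans (+-assoc (n ^ r′) (offset p n) (horner ds)) (cong (_+ (offset p n + horner ds)) (sym (length-relation R)))))
    (trans (bitAt-++ʳ (encodeRelation R) _ (offset p n + horner ds)) (bitAt-relations Rs p ys ds))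

bitAt-functions : ∀ {n ks k} (Fs : Functions n ks) (p : ks ∋ k) m ds →
  bitAt (functionsCode Fs) (⌈log₂ n ⌉ * offset p n + (toℕ m * n ^ k + horner ds)) ≡ bitOfValue (lookupAll Fs p) m ds ∷ []
bitAt-functions {n} {k = k} (f ∷ Fs) here m ds rewrite *-zeroʳ ⌈log₂ n ⌉ =
  trans (bitAt-++ˡ (encodeFunction f) _ (bitAt-single (encodeFunction f) _ (bitAt-function f m ds))) (bitAt-function f m ds)
bitAt-functions {n} {k′ ∷ ks} {k} (f ∷ Fs) (there p) m ds =
  trans (cong (bitAt (encodeFunction f ++ functionsCode Fs))
      (trans (cong (_+ (toℕ m * n ^ k + horner ds)) (*-distribˡ-+ ⌈log₂ n ⌉ (n ^ k′) (offset p n)))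
        (trans (+-assoc (⌈log₂ n ⌉ * n ^ k′) _ _) (cong (_+ _) (sym (length-function f))))))
    (trans (bitAt-++ʳ (encodeFunction f) _ _) (bitAt-functions Fs p m ds))

_++ᴬ_ : ∀ {Q : ℕ → Set} {xs ys} → All Q xs → All Q ys → All Q (xs ++ ys)
[]       ++ᴬ qs = qs
(p ∷ ps) ++ᴬ qs = p ∷ (ps ++ᴬ qs)

reduce-++ᴬ : ∀ {Q : ℕ → Set} {X : Set} (f : ∀ {r} → Q r → X) {xs ys} (ps : All Q xs) (qs : All Q ys) →
  All.reduce f (ps ++ᴬ qs) ≡ All.reduce f ps ++ All.reduce f qs
reduce-++ᴬ f []       qs = refl
reduce-++ᴬ f (p ∷ ps) qs = cong (f p ∷_) (reduce-++ᴬ f ps qs)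

nullary : ∀ {Q : ℕ → Set} {q} → (Fin q → Q 0) → All Q (replicate q 0)
nullary {q = zero}  f = []
nullary {q = suc q} f = f zero ∷ nullary (f ∘ suc)

atNullary : ∀ {q} ks → Fin q → (replicate q 0 ++ ks) ∋ 0
atNullary ks zero    = here
atNullary ks (suc c) = there (atNullary ks c)

afterNullary : ∀ q {ks k} → ks ∋ k → (replicate q 0 ++ ks) ∋ k
afterNullary zero    p = p
afterNullary (suc q) p = there (afterNullary q p)

lookupAll-atNullary : ∀ {Q : ℕ → Set} {q ks} (f : Fin q → Q 0) (qs : All Q ks) c → lookupAll (nullary f ++ᴬ qs) (atNullary ks c) ≡ f c
lookupAll-atNullary f qs zero    = refl
lookupAll-atNullary f qs (suc c) = lookupAll-atNullary (f ∘ suc) qs c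

lookupAll-afterNullary : ∀ {Q : ℕ → Set} {q ks k} (f : Fin q → Q 0) (qs : All Q ks) (p : ks ∋ k) →
  lookupAll (nullary f ++ᴬ qs) (afterNullary q p) ≡ lookupAll qs p
lookupAll-afterNullary {q = zero}  f qs p = refl
lookupAll-afterNullary {q = suc q} f qs p = lookupAll-afterNullary (f ∘ suc) qs p

vec-blocks : ∀ {l} (v : Vec Bool l) → Vec.toList v ≡ concat (List.tabulate (λ m → Vec.lookup v m ∷ []))
vec-blocks []       = refl
vec-blocks (b ∷ v) = cong (b ∷_) (vec-blocks v)

-- A relation of arity 0 takes a single bit, so the encoding of a nullary function is the list of
-- the bits of its value.
constants-code : ∀ {n q} (cs : Vec (Fin n) q) →
  concatMap (Vec.toList ∘ encodeElement) (Vec.toList cs) ≡ functionsCode {n} (nullary (λ c _ → Vec.lookup cs c))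
constants-code []       = refl
constants-code (c ∷ cs) = cong₂ _++_ (trans (vec-blocks (encodeElement c)) (sym (function-blocks (λ (_ : Vec _ 0) → c)))) (constants-code cs)

module _ {σ : Vocabulary} where

  -- Constants are encoded like functions of arity 0.
  allFunArities : List ℕ
  allFunArities = replicate (#constants σ) 0 ++ funArities σ

  allFunctions : (A : Structure σ) → Functions (size A) allFunArities
  allFunctions A = nullary (λ c _ → Vec.lookup (constants A) c) ++ᴬ functions A

  bin≡ : ∀ A → bin A ≡ relationsCode (relations A) ++ functionsCode (allFunctions A)
  bin≡ A = cong (relationsCode (relations A) ++_)
    (trans (cong (_++ functionsCode (functions A)) (constants-code (constants A)))
      (trans (concat-++ (All.reduce encodeFunction (nullary (λ c _ → Vec.lookup (constants A) c))) _)
        (sym (cong concat (reduce-++ᴬ encodeFunction (nullary (λ c _ → Vec.lookup (constants A) c)) (functions A))))))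

  -- The logarithm is a separate argument: the search for it evaluates the formula at `l` and
  -- `2 ^ l`, the search for the size at the true logarithm and a candidate size.
  codeLength : ℕ → ℕ → ℕ
  codeLength l n = sumPowers (relArities σ) n + l * sumPowers allFunArities n

  length-bin : ∀ A → length (bin A) ≡ codeLength ⌈log₂ size A ⌉ (size A)
  length-bin A = trans (cong length (bin≡ A)) (trans (length-++ (relationsCode (relations A)))
    (cong₂ _+_ (length-relationsCode (relations A)) (length-functionsCode (allFunctions A))))

sumPowers-mono : ∀ rs {m n} → m ≤ n → sumPowers rs m ≤ sumPowers rs n
sumPowers-mono []       h = z≤n
sumPowers-mono (r ∷ rs) h = +-mono-≤ (^-monoˡ-≤ r h) (sumPowers-mono rs h)

sumPowers-strict : ∀ {rs} → Any (0 <_) rs → ∀ {m n} → m < n → sumPowers rs m < sumPowers rs n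
sumPowers-strict (here {suc r} {rs} _) m<n = +-mono-<-≤ (^-monoˡ-< (suc r) m<n) (sumPowers-mono rs (<⇒≤ m<n))
sumPowers-strict (there {r} {rs} p)    m<n = +-mono-≤-< (^-monoˡ-≤ r (<⇒≤ m<n)) (sumPowers-strict p m<n)

≤sumPowers : ∀ {rs} → Any (0 <_) rs → ∀ n → .{{NonZero n}} → n ≤ sumPowers rs n
≤sumPowers (here {suc r} {rs} _) n = ≤-trans (≤-reflexive (sym (*-identityʳ n))) (≤-trans (*-monoʳ-≤ n (m^n>0 n r)) (m≤m+n _ _))
≤sumPowers (there {r} {rs} p)    n = ≤-trans (≤sumPowers p n) (m≤n+m _ _)

module _ {σ : Vocabulary} where

  codeLength-mono : ∀ {l l′ m n} → l ≤ l′ → m ≤ n → codeLength {σ} l m ≤ codeLength {σ} l′ n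
  codeLength-mono l≤ m≤ = +-mono-≤ (sumPowers-mono (relArities σ) m≤) (*-mono-≤ l≤ (sumPowers-mono (allFunArities {σ}) m≤))

  positive : HasPositiveArity σ → Any (0 <_) (relArities σ) ⊎ Any (0 <_) (allFunArities {σ})
  positive h with ++⁻ (relArities σ) h
  ... | inj₁ p = inj₁ p
  ... | inj₂ p = inj₂ (++⁺ʳ (replicate (#constants σ) 0) p)

  -- If the symbol of positive arity is a function symbol, the sum that grows is multiplied by the
  -- logarithm; hence the condition that the larger logarithm is positive.
  codeLength-strict : HasPositiveArity σ → ∀ {l l′ m n} → 0 < l′ → l ≤ l′ → m < n → codeLength {σ} l m < codeLength {σ} l′ n
  codeLength-strict h {l} {l′} {m} {n} 0<l′ l≤ m<n with positive h
  ... | inj₁ p = +-mono-<-≤ (sumPowers-strict p m<n) (*-mono-≤ l≤ (sumPowers-mono (allFunArities {σ}) (<⇒≤ m<n)))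
  ... | inj₂ p = +-mono-≤-< (sumPowers-mono (relArities σ) (<⇒≤ m<n))
    (≤-<-trans (*-monoˡ-≤ (sumPowers (allFunArities {σ}) m) l≤) (*-monoʳ-< l′ {{>-nonZero 0<l′}} (sumPowers-strict p m<n)))

  ≤codeLength : HasPositiveArity σ → ∀ {l n} → 0 < l → .{{NonZero n}} → n ≤ codeLength {σ} l n
  ≤codeLength h {suc l} {n} _ with positive h
  ... | inj₁ p = ≤-trans (≤sumPowers p n) (m≤m+n _ _)
  ... | inj₂ p = ≤-trans (≤sumPowers p n) (≤-trans (m≤m+n _ (l * _)) (m≤n+m _ (sumPowers (relArities σ) n)))

-- Tuples of numbers, and numerals without leading zeros

elements-toℕ : ∀ {n r} (ds : Vec (Fin n) r) → elements n (Vec.map toℕ ds) ≡ just ds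
elements-toℕ []       = refl
elements-toℕ {n} (d ∷ ds) with toℕ d <? n
... | no ¬p = contradiction (toℕ<n d) ¬p
... | yes p rewrite elements-toℕ ds = cong (λ d → just (d ∷ ds)) (fromℕ<-toℕ d p)

elements-just : ∀ {n r} (ms : Vec ℕ r) {ds : Vec (Fin n) r} → elements n ms ≡ just ds → Vec.map toℕ ds ≡ ms
elements-just []       refl = refl
elements-just {n} (m ∷ ms) eq with m <? n
... | yes p with elements n ms in eqs
elements-just {n} (m ∷ ms) refl | yes p | just ds = cong₂ _∷_ (toℕ-fromℕ< p) (elements-just ms eqs)

fromBits-∷ : ∀ b xs → fromBits (b ∷ xs) ≡ bitℕ b * 2 ^ length xs + fromBits xs
fromBits-∷ b xs = trans (cong fromBits (sym (reverse-involutive (b ∷ xs)))) (trans (fromBits-reverse (reverse (b ∷ xs)))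
  (trans (val←-∷ b xs) (trans (+-comm (val← xs) (bitℕ b * 2 ^ length xs)) (cong (bitℕ b * 2 ^ length xs +_)
    (trans (sym (fromBits-reverse (reverse xs))) (cong fromBits (reverse-involutive xs)))))))

length-toBits : ∀ l m → length (Vec.toList (toBits l m)) ≡ l
length-toBits zero    m = refl
length-toBits (suc l) m = cong suc (length-toBits l m)

toBits-suc : ∀ l b m → Vec.toList (toBits (suc l) (bitℕ b + 2 * m)) ≡ Vec.toList (toBits l m) ++ b ∷ []
toBits-suc zero    b m = cong (_∷ []) (lowest-double b m)
toBits-suc (suc l) b m = cong₂ _∷_ (cong (testBit l) (half-double b m)) (toBits-suc l b m)

binary : ∀ m → ∃[ b ] ∃[ h ] m ≡ bitℕ b + 2 * h
binary zero = false , 0 , refl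
binary (suc m) with binary m
... | false , h , refl = true , h , refl
... | true  , h , refl = false , suc h , cong suc (sym (+-suc h (h + 0)))

fromBits-toBits : ∀ l m → m < 2 ^ l → fromBits (Vec.toList (toBits l m)) ≡ m
fromBits-toBits zero    zero _ = refl
fromBits-toBits zero    (suc m) (s≤s ())
fromBits-toBits (suc l) m m< with binary m
... | b , h , refl = trans (cong fromBits (toBits-suc l b h))
  (trans (foldl-++ (λ m b → 2 * m + bitℕ b) 0 (Vec.toList (toBits l h)) (b ∷ []))
    (trans (cong (λ v → 2 * v + bitℕ b) (fromBits-toBits l h (h< b h m<))) (+-comm (2 * h) (bitℕ b))))
  where
  h< : ∀ b h → bitℕ b + 2 * h < 2 * 2 ^ l → h < 2 ^ l
  h< b h lt = *-cancelˡ-< 2 h (2 ^ l) (≤-<-trans (m≤n+m (2 * h) (bitℕ b)) lt)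

<2^⌊log₂⌋ : ∀ m → m < 2 ^ suc ⌊log₂ m ⌋
<2^⌊log₂⌋ m = ≰⇒> λ le → <-irrefl refl (≤-trans (≤-reflexive (sym (⌊log₂[2^n]⌋≡n (suc ⌊log₂ m ⌋)))) (⌊log₂⌋-mono-≤ le))

fromBits-numeral : ∀ m → fromBits (numeral m) ≡ m
fromBits-numeral m = fromBits-toBits (suc ⌊log₂ m ⌋) m (<2^⌊log₂⌋ m)

-- What `strip` computes, by `eval-strip`.
normal : List Bool → List Bool
normal xs = let w = stripped xs [] in if nonempty w then reverse w else false ∷ []

stripped-started : ∀ xs o os → stripped xs (o ∷ os) ≡ xs ʳ++ (o ∷ os)
stripped-started []       o os = refl
stripped-started (x ∷ xs) o os = stripped-started xs x (o ∷ os)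

normal-true : ∀ xs → normal (true ∷ xs) ≡ true ∷ xs
normal-true xs rewrite stripped-started xs true [] = trans (if-nonempty (xs ʳ++ true ∷ [])
    (trans (cong nonempty (trans (ʳ++-defn xs) refl)) (nonempty-∷ʳ (reverse xs)))) (trans (cong reverse (ʳ++-defn xs)) (trans (reverse-++ (reverse xs) (true ∷ [])) (cong (true ∷_) (reverse-involutive xs))))
  where
  if-nonempty : ∀ w → nonempty w ≡ true → (if nonempty w then reverse w else false ∷ []) ≡ reverse w
  if-nonempty w eq rewrite eq = refl
  nonempty-∷ʳ : ∀ ys → nonempty (ys ++ true ∷ []) ≡ true
  nonempty-∷ʳ []       = refl
  nonempty-∷ʳ (_ ∷ _) = refl

2^⌊log₂⌋≤ : ∀ m → 0 < m → 2 ^ ⌊log₂ m ⌋ ≤ m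
2^⌊log₂⌋≤ = <-rec _ λ where
    (suc zero)    rec _ → s≤s z≤n
    (suc (suc m)) rec _ → ≤-trans (≤-reflexive (cong (2 ^_) (sym (m+[n∸m]≡n {1} {⌊log₂ 2 + m ⌋} (⌊log₂⌋-mono-≤ {2} {2 + m} (s≤s (s≤s z≤n)))))))
      (≤-trans (≤-reflexive (cong (λ k → 2 ^ suc k) (sym (⌊log₂⌊n/2⌋⌋≡⌊log₂n⌋∸1 (2 + m)))))
        (≤-trans (*-monoʳ-≤ 2 (rec (s≤s (s≤s (⌊n/2⌋≤n m))) (s≤s z≤n)))
          (≤-trans (≤-reflexive (cong (⌊ 2 + m /2⌋ +_) (+-identityʳ _)))
            (≤-trans (+-monoʳ-≤ ⌊ 2 + m /2⌋ (⌊n/2⌋≤⌈n/2⌉ (2 + m))) (≤-reflexive (⌊n/2⌋+⌈n/2⌉≡n (2 + m)))))))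

-- The leading bit of toBits (suc l) m is true exactly for m ≥ 2 ^ l.
normal-toBits : ∀ l m → m < 2 ^ l → normal (Vec.toList (toBits l m)) ≡ numeral m
normal-toBits zero zero    _ = refl
normal-toBits zero (suc m) (s≤s ())
normal-toBits (suc l) m m< with testBit l m in eq
... | true  = trans (normal-true _) (cong₂ _∷_ (trans (sym eq) (cong (λ l → testBit l m) l≡)) (cong (λ l → Vec.toList (toBits l m)) l≡))
  where
  high : m ≡ 1 * 2 ^ l + fromBits (Vec.toList (toBits l m))
  high = trans (sym (fromBits-toBits (suc l) m m<)) (trans (fromBits-∷ (testBit l m) (Vec.toList (toBits l m)))
    (cong₂ (λ b k → bitℕ b * 2 ^ k + fromBits (Vec.toList (toBits l m))) eq (length-toBits l m)))
  2^l≤m : 2 ^ l ≤ m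
  2^l≤m = ≤-trans (≤-trans (≤-reflexive (sym (*-identityˡ (2 ^ l)))) (m≤m+n _ _)) (≤-reflexive (sym high))
  l≡ : l ≡ ⌊log₂ m ⌋
  l≡ = ≤-antisym (≤-trans (≤-reflexive (sym (⌊log₂[2^n]⌋≡n l))) (⌊log₂⌋-mono-≤ 2^l≤m))
    (s≤s⁻¹ (≰⇒> λ le → <⇒≱ m< (≤-trans (^-monoʳ-≤ 2 le) (2^⌊log₂⌋≤ m (≤-trans (m^n>0 2 l) 2^l≤m)))))
... | false = normal-toBits l m (subst (_< 2 ^ l) (sym low)
  (subst (λ k → fromBits (Vec.toList (toBits l m)) < 2 ^ k) (length-toBits l m) (fromBits< (Vec.toList (toBits l m)))))
  where
  low : m ≡ fromBits (Vec.toList (toBits l m))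
  low = trans (sym (fromBits-toBits (suc l) m m<)) (trans (fromBits-∷ (testBit l m) (Vec.toList (toBits l m)))
    (cong (λ b → bitℕ b * 2 ^ length (Vec.toList (toBits l m)) + fromBits (Vec.toList (toBits l m))) eq))
  fromBits< : ∀ xs → fromBits xs < 2 ^ length xs
  fromBits< xs = subst (_< 2 ^ length xs) (trans (sym (fromBits-reverse (reverse xs))) (cong fromBits (reverse-involutive xs)))
    (subst (λ k → val (reverse xs) < 2 ^ k) (length-reverse xs) (val< (reverse xs)))

-- Tapes as data of the language

finite-× : ∀ {X Y} → Finite X → Finite Y → Finite (X × Y)
finite-× (m , f) (n , g) = m * n , ↔-trans (f ×-↔ g) (↔-sym *↔×)

headBit-drop-isBit : ∀ cs p → headBit (List.drop p (List.map isBit cs)) ≡ isBit (symbolAt cs p)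
headBit-drop-isBit []       p       = cong headBit (drop-[] p)
headBit-drop-isBit (c ∷ cs) zero    = refl
headBit-drop-isBit (c ∷ cs) (suc p) = headBit-drop-isBit cs p

headBit-drop-bitOf : ∀ cs p → headBit (List.drop p (List.map bitOf cs)) ≡ bitOf (symbolAt cs p)
headBit-drop-bitOf []       p       = cong headBit (drop-[] p)
headBit-drop-bitOf (c ∷ cs) zero    = refl
headBit-drop-bitOf (c ∷ cs) (suc p) = headBit-drop-bitOf cs p

setAt-isBit : ∀ cs p s → setAt (List.map isBit cs) p (isBit s) ≡ List.map isBit (writeAt cs p s)
setAt-isBit []       zero    s = refl
setAt-isBit []       (suc p) s = cong (false ∷_) (setAt-isBit [] p s)
setAt-isBit (c ∷ cs) zero    s = refl
setAt-isBit (c ∷ cs) (suc p) s = cong (isBit c ∷_) (setAt-isBit cs p s)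

setAt-bitOf : ∀ cs p s → setAt (List.map bitOf cs) p (bitOf s) ≡ List.map bitOf (writeAt cs p s)
setAt-bitOf []       zero    s = refl
setAt-bitOf []       (suc p) s = cong (false ∷_) (setAt-bitOf [] p s)
setAt-bitOf (c ∷ cs) zero    s = refl
setAt-bitOf (c ∷ cs) (suc p) s = cong (bitOf c ∷_) (setAt-bitOf cs p s)

unary : ℕ → List Bool
unary n = replicate n true

module TapeSimulation (Op : Set) (arity : Op → ℕ) where

  open Language Op arity
  open Arithmetic Op arity

  constant : ∀ {k} → List Bool → Exp k
  constant []       = nil
  constant (b ∷ bs) = cons b (constant bs)

  eval-constant : ∀ S {k} bs (ρ : Env k) → eval S (constant bs) ρ ≡ bs
  eval-constant S []       ρ = refl
  eval-constant S (b ∷ bs) ρ = cong (b ∷_) (eval-constant S bs ρ)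

  -- Branching on finite data, in continuation-passing style.

  caseList : ∀ {X : Set} {k} → (Maybe Bool → X) → Exp k → (X → Exp k) → Exp k
  caseList f e K = test e (K ∘ f)

  caseFin : ∀ m {k} → Exp k → (Fin m → Exp k) → Exp k
  caseFin zero    e K = nil
  caseFin (suc m) e K = test e (maybe′ (λ _ → caseFin m (tail e) (K ∘ suc)) (K zero))

  eval-caseFin : ∀ S {m k} (e : Exp k) K ρ (i : Fin m) → eval S e ρ ≡ unary (toℕ i) → eval S (caseFin m e K) ρ ≡ eval S (K i) ρ
  eval-caseFin S e K ρ zero    eq rewrite eq = refl
  eval-caseFin S {suc m} e K ρ (suc i) eq = trans (step (eval S e ρ) eq) (eval-caseFin S (tail e) (K ∘ suc) ρ i (cong (List.drop 1) eq))
    where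
    branches : Maybe Bool → Exp _
    branches = maybe′ (λ _ → caseFin m (tail e) (K ∘ suc)) (K zero)
    step : ∀ xs → xs ≡ true ∷ unary (toℕ i) → eval S (branches (List.head xs)) ρ ≡ eval S (caseFin m (tail e) (K ∘ suc)) ρ
    step (_ ∷ _) refl = refl

  -- The growth condition of a program concerns all environments, also those that encode no
  -- configuration. So this and the analogous lemmas bound every branch.
  length-caseFin : ∀ S {m k} (e : Exp k) K ρ {M} → (∀ i → length (eval S (K i) ρ) ≤ M) → length (eval S (caseFin m e K) ρ) ≤ M
  length-caseFin S {zero}  e K ρ h = z≤n
  length-caseFin S {suc m} e K ρ h with eval S e ρ
  ... | []    = h zero
  ... | _ ∷ _ = length-caseFin S {m} (tail e) (K ∘ suc) ρ (h ∘ suc)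

  -- There are three symbols but two bits, so a tape takes two lists, one marking the nonblank cells
  -- and one with their bits, and a third for the head position in unary. One step lengthens the
  -- longest of them by at most one.
  record TapeVars (k : ℕ) : Set where
    constructor tapeVars
    field flagsᵛ bitsᵛ posᵛ : Exp k
  open TapeVars public

  record Encodes (S : Semantics) {k} (ρ : Env k) (tv : TapeVars k) (t : Tape) : Set where
    constructor encodes
    field
      flags≡ : eval S (flagsᵛ tv) ρ ≡ List.map isBit (cells t)
      bits≡  : eval S (bitsᵛ tv) ρ ≡ List.map bitOf (cells t)
      pos≡   : eval S (posᵛ tv) ρ ≡ unary (pos t)
  open Encodes public

  caseScan : ∀ {k} → TapeVars k → (Symbol → Exp k) → Exp k
  caseScan tv K = test (dropᴱ (posᵛ tv) (flagsᵛ tv)) λ f →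
    if fromHead f then (test (dropᴱ (posᵛ tv) (bitsᵛ tv)) λ b → K (bit (fromHead b))) else K blank

  eval-caseScan : ∀ S {k} tv K (ρ : Env k) t → Encodes S ρ tv t → eval S (caseScan tv K) ρ ≡ eval S (K (scan t)) ρ
  eval-caseScan S tv K ρ t (encodes f≡ b≡ p≡) = trans (cong (λ f → eval S (branch f) ρ) flag≡) chosen
    where
    b′ : Bool
    b′ = fromHead (List.head (eval S (dropᴱ (posᵛ tv) (bitsᵛ tv)) ρ))
    branch : Bool → Exp _
    branch f = if f then (test (dropᴱ (posᵛ tv) (bitsᵛ tv)) λ b → K (bit (fromHead b))) else K blank
    p : length (eval S (posᵛ tv) ρ) ≡ pos t
    p = trans (cong length p≡) (length-replicate (pos t))
    flag≡ : fromHead (List.head (eval S (dropᴱ (posᵛ tv) (flagsᵛ tv)) ρ)) ≡ isBit (scan t)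
    flag≡ = trans (fromHead-head (eval S (dropᴱ (posᵛ tv) (flagsᵛ tv)) ρ))
      (trans (cong headBit (trans (eval-drop S (posᵛ tv) (flagsᵛ tv) ρ) (cong₂ List.drop p f≡))) (headBit-drop-isBit (cells t) (pos t)))
    bit≡ : b′ ≡ bitOf (scan t)
    bit≡ = trans (fromHead-head (eval S (dropᴱ (posᵛ tv) (bitsᵛ tv)) ρ))
      (trans (cong headBit (trans (eval-drop S (posᵛ tv) (bitsᵛ tv) ρ) (cong₂ List.drop p b≡))) (headBit-drop-bitOf (cells t) (pos t)))
    chosen : eval S (branch (isBit (scan t))) ρ ≡ eval S (K (scan t)) ρ
    chosen with scan t | bit≡
    ... | bit b | eq = cong (λ b → eval S (K (bit b)) ρ) eq
    ... | blank | _  = refl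

  length-caseScan : ∀ S {k} tv K (ρ : Env k) {M} → (∀ s → length (eval S (K s) ρ) ≤ M) → length (eval S (caseScan tv K) ρ) ≤ M
  length-caseScan S tv K ρ h with fromHead (List.head (eval S (dropᴱ (posᵛ tv) (flagsᵛ tv)) ρ))
  ... | true  = h _
  ... | false = h blank

  caseVec : ∀ {X I : Set} {k} → (I → (X → Exp k) → Exp k) → ∀ {j} → (Fin j → I) → (Vec X j → Exp k) → Exp k
  caseVec one {zero}  is K = K []
  caseVec one {suc j} is K = one (is zero) λ x → caseVec one (is ∘ suc) λ xs → K (x ∷ xs)

  eval-caseVec : ∀ S {X I : Set} {k} (one : I → (X → Exp k) → Exp k) {j} (is : Fin j → I) K (ρ : Env k) xs →
    (∀ i K → eval S (one (is i) K) ρ ≡ eval S (K (Vec.lookup xs i)) ρ) → eval S (caseVec one is K) ρ ≡ eval S (K xs) ρ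
  eval-caseVec S one {zero}  is K ρ []       h = refl
  eval-caseVec S one {suc j} is K ρ (x ∷ xs) h = trans (h zero _) (eval-caseVec S one (is ∘ suc) _ ρ xs (h ∘ suc))

  length-caseVec : ∀ S {X I : Set} {k} (one : I → (X → Exp k) → Exp k) {j} (is : Fin j → I) K (ρ : Env k) {M} →
    (∀ i K → (∀ x → length (eval S (K x) ρ) ≤ M) → length (eval S (one i K) ρ) ≤ M) →
    (∀ xs → length (eval S (K xs) ρ) ≤ M) → length (eval S (caseVec one is K) ρ) ≤ M
  length-caseVec S one {zero}  is K ρ g h = h []
  length-caseVec S one {suc j} is K ρ g h = g (is zero) _ λ x → length-caseVec S one (is ∘ suc) _ ρ g (λ xs → h (x ∷ xs))

  caseAll : ∀ {Q : ℕ → Set} {k} rs → (∀ {r} → rs ∋ r → (Q r → Exp k) → Exp k) → (All Q rs → Exp k) → Exp k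
  caseAll []       one K = K []
  caseAll (r ∷ rs) one K = one here λ x → caseAll rs (λ p → one (there p)) λ xs → K (x ∷ xs)

  eval-caseAll : ∀ S {Q : ℕ → Set} {k} rs (one : ∀ {r} → rs ∋ r → (Q r → Exp k) → Exp k) K (ρ : Env k) xs →
    (∀ {r} (p : rs ∋ r) K → eval S (one p K) ρ ≡ eval S (K (lookupAll xs p)) ρ) → eval S (caseAll rs one K) ρ ≡ eval S (K xs) ρ
  eval-caseAll S []       one K ρ []       h = refl
  eval-caseAll S (r ∷ rs) one K ρ (x ∷ xs) h = trans (h here _) (eval-caseAll S rs (λ p → one (there p)) _ ρ xs (λ p → h (there p)))

  length-caseAll : ∀ S {Q : ℕ → Set} {k} rs (one : ∀ {r} → rs ∋ r → (Q r → Exp k) → Exp k) K (ρ : Env k) {M} →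
    (∀ {r} (p : rs ∋ r) K → (∀ x → length (eval S (K x) ρ) ≤ M) → length (eval S (one p K) ρ) ≤ M) →
    (∀ xs → length (eval S (K xs) ρ) ≤ M) → length (eval S (caseAll rs one K) ρ) ≤ M
  length-caseAll S []       one K ρ g h = h []
  length-caseAll S (r ∷ rs) one K ρ g h = g here _ λ x → length-caseAll S rs (λ p → one (there p)) _ ρ (λ p → g (there p)) (λ xs → h (x ∷ xs))

  moveᴱ : ∀ {k} → Move → Exp k → Exp k
  moveᴱ left  e = tail e
  moveᴱ right e = cons true e
  moveᴱ stay  e = e

  eval-move : ∀ S {k} d (e : Exp k) ρ p → eval S e ρ ≡ unary p → eval S (moveᴱ d e) ρ ≡ unary (moveHead d p)
  eval-move S left  e ρ zero    eq rewrite eq = refl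
  eval-move S left  e ρ (suc p) eq rewrite eq = refl
  eval-move S right e ρ p       eq rewrite eq = refl
  eval-move S stay  e ρ p       eq = eq

  length-move : ∀ S {k} d (e : Exp k) ρ {N} → length (eval S e ρ) ≤ N → length (eval S (moveᴱ d e) ρ) ≤ suc N
  length-move S left  e ρ h = ≤-trans (drop1≤ (eval S e ρ)) (m≤n⇒m≤1+n h)
  length-move S right e ρ h = s≤s h
  length-move S stay  e ρ h = m≤n⇒m≤1+n h

  component : ∀ {k} → TapeVars k → Fin 3 → Exp k
  component tv 0F = flagsᵛ tv
  component tv 1F = bitsᵛ tv
  component tv 2F = posᵛ tv

  written : ∀ {k} → TapeVars k → Symbol × Move → Fin 3 → Exp k
  written tv (s , d) 0F = set (flagsᵛ tv) (posᵛ tv) (isBit s)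
  written tv (s , d) 1F = set (bitsᵛ tv) (posᵛ tv) (bitOf s)
  written tv (s , d) 2F = moveᴱ d (posᵛ tv)

  tapeCode : Tape → Fin 3 → List Bool
  tapeCode t 0F = List.map isBit (cells t)
  tapeCode t 1F = List.map bitOf (cells t)
  tapeCode t 2F = unary (pos t)

  eval-written : ∀ S {k} tv (ρ : Env k) t a → Encodes S ρ tv t → ∀ c → eval S (written tv a c) ρ ≡ tapeCode (writeMove t a) c
  eval-written S tv ρ t (s , d) (encodes f≡ b≡ p≡) 0F = trans (eval-set S (flagsᵛ tv) (posᵛ tv) (isBit s) ρ)
    (trans (cong₂ (λ xs p → setAt xs p (isBit s)) f≡ (trans (cong length p≡) (length-replicate (pos t)))) (setAt-isBit (cells t) (pos t) s))
  eval-written S tv ρ t (s , d) (encodes f≡ b≡ p≡) 1F = trans (eval-set S (bitsᵛ tv) (posᵛ tv) (bitOf s) ρ)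
    (trans (cong₂ (λ xs p → setAt xs p (bitOf s)) b≡ (trans (cong length p≡) (length-replicate (pos t)))) (setAt-bitOf (cells t) (pos t) s))
  eval-written S tv ρ t (s , d) (encodes f≡ b≡ p≡) 2F = eval-move S d (posᵛ tv) ρ (pos t) p≡

  length-written : ∀ S {k} tv (ρ : Env k) a N → (∀ c → length (eval S (component tv c) ρ) ≤ N) → ∀ c → length (eval S (written tv a c) ρ) ≤ suc N
  length-written S tv ρ (s , d) N h 0F = ≤-trans (≤-reflexive (trans (cong length (eval-set S (flagsᵛ tv) (posᵛ tv) (isBit s) ρ)) (length-setAt (eval S (flagsᵛ tv) ρ) (length (eval S (posᵛ tv) ρ)) (isBit s))))
    (⊔-lub (m≤n⇒m≤1+n (h 0F)) (s≤s (h 2F)))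
  length-written S tv ρ (s , d) N h 1F = ≤-trans (≤-reflexive (trans (cong length (eval-set S (bitsᵛ tv) (posᵛ tv) (bitOf s) ρ)) (length-setAt (eval S (bitsᵛ tv) ρ) (length (eval S (posᵛ tv) ρ)) (bitOf s))))
    (⊔-lub (m≤n⇒m≤1+n (h 1F)) (s≤s (h 2F)))
  length-written S tv ρ (s , d) N h 2F = length-move S d (posᵛ tv) ρ (h 2F)

-- Decomposition of positions in base n

horner-surjective : ∀ n r j → j < n ^ r → ∃[ ds ] horner {n} {r} ds ≡ j
horner-surjective n    zero    zero _ = [] , refl
horner-surjective n    zero    (suc j) (s≤s ())
horner-surjective zero (suc r) j ()
horner-surjective n@(suc _) (suc r) j j< =
  let ds , eq = horner-surjective n r (j % n ^ r) (m%n<n j (n ^ r))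
      d< = m<n*o⇒m/o<n {j} {n} {n ^ r} j<
  in fromℕ< d< ∷ ds ,
     trans (cong₂ (λ d h → d * n ^ r + h) (toℕ-fromℕ< d<) eq)
       (trans (+-comm (j / n ^ r * n ^ r) (j % n ^ r)) (sym (m≡m%n+[m/n]*n j (n ^ r))))
  where instance _ = m^n≢0 n r

-- This exhibits the quotient as the largest `c` with `c * w` not above the dividend, so that
-- division becomes a binary search.
quotient-test : ∀ {w h} c d → h < w → not (d * w + h <ᵇ c * w) ≡ (c <ᵇ suc d)
quotient-test {w} {h} c d h<w with c <ᵇ suc d in eq
... | true  = cong not (<ᵇ-false {d * w + h} {c * w} (≤-trans (*-monoˡ-≤ w (s≤s⁻¹ (<ᵇ-true⁻¹ {c} {suc d} eq))) (m≤m+n _ h)))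
... | false = cong not (<ᵇ-true {d * w + h} {c * w} (≤-trans (+-monoʳ-< (d * w) h<w)
    (≤-trans (≤-reflexive (+-comm (d * w) w)) (*-monoˡ-≤ w (<ᵇ-false⁻¹ {c} {suc d} eq)))))

<ᵇ-+ˡ : ∀ o {x y} → (o + x <ᵇ o + y) ≡ (x <ᵇ y)
<ᵇ-+ˡ zero    = refl
<ᵇ-+ˡ (suc o) = <ᵇ-+ˡ o

module Division (Op : Set) (arity : Op → ℕ) where

  open Language Op arity
  open Arithmetic Op arity

  -- Parameters: offset, weight, index.
  fits : Exp 4
  fits = ifᴱ (lt (var (suc 2F)) (add (var 1F) (mul (var 0F) (var 2F)))) nil (cons true nil)

  open Search fits

  module _ {k} (sizeᴱ lenᴱ index : Exp k) where

    digit : Exp k → Exp k → Exp k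
    digit off w = search lenᴱ (off ∷ᴱ w ∷ᴱ index ∷ᴱ []ᴱ)

    -- The index stays fixed and what has been accounted for is added to the offset, which avoids
    -- subtraction.
    next-offset : ∀ r → Exp k → Exp k
    next-offset r off = add off (mul (digit off (power sizeᴱ r)) (power sizeᴱ r))

    digits : ∀ r → Exp k → Fin r → Exp k
    digits (suc r) off zero    = digit off (power sizeᴱ r)
    digits (suc r) off (suc x) = digits r (next-offset r off) x

    module _ (S : Semantics) (ρ : Env k) (n : ℕ) (n≡ : val (eval S sizeᴱ ρ) ≡ n) (n≤ : n ≤ 2 ^ length (eval S lenᴱ ρ)) where

      val-digit : ∀ off w d h → val (eval S index ρ) ≡ val (eval S off ρ) + (d * val (eval S w ρ) + h) →
        h < val (eval S w ρ) → d < n → val (eval S (digit off w) ρ) ≡ d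
      val-digit off w d h i≡ h< d< = val-search S π d test≡ lenᴱ (off ∷ᴱ w ∷ᴱ index ∷ᴱ []ᴱ) ρ
          (λ { zero → refl ; (suc zero) → refl ; (suc (suc zero)) → refl })
          (≤-trans d< (≤-trans n≤ (^-monoʳ-≤ 2 (n≤1+n (length (eval S lenᴱ ρ))))))
        where
        π : Env 3
        π i = eval S ((off ∷ᴱ w ∷ᴱ index ∷ᴱ []ᴱ) i) ρ
        W = val (eval S w ρ)
        O = val (eval S off ρ)
        test≡ : ∀ ρ′ → (∀ i → ρ′ (suc i) ≡ π i) → 1 ≤ val (ρ′ 0F) → nonempty (eval S fits ρ′) ≡ (val (ρ′ 0F) <ᵇ suc d)
        test≡ ρ′ h′ _ = trans (cong nonempty (eval-if S cond nil (cons true nil) ρ′))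
          (trans (negated (nonempty (eval S cond ρ′)))
            (trans (cong not (trans (nonempty-lt S (var (suc 2F)) (add (var 1F) (mul (var 0F) (var 2F))) ρ′)
                (trans (cong₂ _<ᵇ_ (trans (cong val (h′ 2F)) i≡)
                    (trans (val-add S (var 1F) (mul (var 0F) (var 2F)) ρ′)
                      (cong₂ _+_ (cong val (h′ 0F)) (trans (val-mul S (var 0F) (var 2F) ρ′) (cong (λ z → val (ρ′ 0F) * val z) (h′ 1F))))))
                  (<ᵇ-+ˡ O))))
              (quotient-test (val (ρ′ 0F)) d h<)))
          where
          cond = lt (var (suc 2F)) (add (var 1F) (mul (var 0F) (var 2F)))
          negated : ∀ b → nonempty (if b then [] else true ∷ []) ≡ not b
          negated true  = refl
          negated false = refl

      val-sizePower : ∀ r → val (eval S (power sizeᴱ r) ρ) ≡ n ^ r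
      val-sizePower r = trans (val-power S sizeᴱ r ρ) (cong (_^ r) n≡)

      val-digits : ∀ {r} off (ds : Vec (Fin n) r) → val (eval S index ρ) ≡ val (eval S off ρ) + horner ds →
        ∀ x → val (eval S (digits r off x) ρ) ≡ toℕ (Vec.lookup ds x)
      val-digits {suc r} off (d ∷ ds) i≡ = λ { zero → first ; (suc x) → val-digits (next-offset r off) ds rest≡ x }
        where
        P = val-sizePower r
        first : val (eval S (digit off (power sizeᴱ r)) ρ) ≡ toℕ d
        first = val-digit off (power sizeᴱ r) (toℕ d) (horner ds)
          (trans i≡ (cong (λ p → val (eval S off ρ) + (toℕ d * p + horner ds)) (sym P)))
          (subst (horner ds <_) (sym P) (horner< ds)) (toℕ<n d)
        rest≡ : val (eval S index ρ) ≡ val (eval S (next-offset r off) ρ) + horner ds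
        rest≡ = trans i≡ (trans (sym (+-assoc (val (eval S off ρ)) (toℕ d * n ^ r) (horner ds)))
          (cong (_+ horner ds) (sym (trans (val-add S off (mul (digit off (power sizeᴱ r)) (power sizeᴱ r)) ρ)
            (cong (val (eval S off ρ) +_) (trans (val-mul S (digit off (power sizeᴱ r)) (power sizeᴱ r) ρ) (cong₂ _*_ first P)))))))

-- The bits of the encoding, computed from the structure

module ReadInput (σ : Vocabulary) {k : ℕ} (index : Language.Exp (Query σ) (queryArity σ) k) where

  open Language (Query σ) (queryArity σ)
  open Arithmetic (Query σ) (queryArity σ)
  open Division (Query σ) (queryArity σ)

  sizeᴱ lenᴱ : Exp k
  sizeᴱ = ask (constantOf zero) (λ ())
  lenᴱ  = log sizeᴱ

  Caller : ℕ → Set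
  Caller r = (Fin r → Exp k) → Exp k

  digitsFrom : ∀ r → Exp k → Fin r → Exp k
  digitsFrom = digits sizeᴱ lenᴱ index

  -- State: offset, list of bits, weight, index. As long as the next offset
  -- does not exceed the index, passes to it and drops a bit.
  skipCond : Exp 4
  skipCond = lt (var (suc 2F)) (add (var 0F) (var 2F))

  skipBody : Bool → Fin 4 → Exp 4
  skipBody _ 0F       = ifᴱ skipCond (var 0F) (add (var 0F) (var 2F))
  skipBody _ 1F       = ifᴱ skipCond (var 1F) (tail (var 1F))
  skipBody _ 2F       = var 2F
  skipBody _ (suc 2F) = var (suc 2F)

  skipGrowth : ∃[ c ] ∀ (S : Semantics) b (ρ : Env 4) N → Bounded N ρ → ∀ i → length (eval S (skipBody b i) ρ) ≤ c + N
  skipGrowth = 1 , λ where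
    S b ρ N h 0F → length-if S skipCond (var 0F) (add (var 0F) (var 2F)) ρ (m≤n⇒m≤1+n (h 0F)) (length-add S (var 0F) (var 2F) ρ (h 0F) (h 2F))
    S b ρ N h 1F → length-if S skipCond (var 1F) (tail (var 1F)) ρ (m≤n⇒m≤1+n (h 1F)) (≤-trans (drop1≤ (ρ 1F)) (m≤n⇒m≤1+n (h 1F)))
    S b ρ N h 2F → m≤n⇒m≤1+n (h 2F)
    S b ρ N h (suc 2F) → m≤n⇒m≤1+n (h (suc 2F))

  skipped : Exp k → Exp k → Exp k → Fin 4 → Exp k
  skipped off bs w i = loop lenᴱ (off ∷ᴱ bs ∷ᴱ w ∷ᴱ index ∷ᴱ []ᴱ) skipBody skipGrowth (var i)

  -- The skipping loop is run twice. With an empty list it gives the offset from which the arguments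
  -- are decoded; with the bits of the value at these arguments, it drops one bit per relation
  -- passed, and the bit asked for is then the first.
  valueBit : ∀ r → Caller r → Exp k → Exp k
  valueBit r f off = test (skipped off (bits lenᴱ v) w 1F) (maybe′ (λ b → cons b nil) nil)
    where
    w = power sizeᴱ r
    v = f (digitsFrom r (skipped off nil w 0F))

  readFunctions : ∀ {ks} → All Caller ks → Exp k → Exp k
  -- The index is past the end of the encoding; the empty list stands for `◁`.
  readFunctions []               off = nil
  readFunctions (_∷_ {x = r} f fs) off =
    ifᴱ (lt index (add off (scale lenᴱ (power sizeᴱ r)))) (valueBit r f off)
      (readFunctions fs (add off (scale lenᴱ (power sizeᴱ r))))

  readRelations : ∀ {rs} → All Caller rs → (Exp k → Exp k) → Exp k → Exp k
  readRelations []                 then off = then off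
  readRelations (_∷_ {x = r} a as) then off =
    ifᴱ (lt index (add off (power sizeᴱ r))) (a (digitsFrom r off)) (readRelations as then (add off (power sizeᴱ r)))

  relationCallers : All Caller (relArities σ)
  relationCallers = tabulateAll _ (λ p → ask (relationOf p))

  functionCallers : All Caller (allFunArities {σ})
  functionCallers = nullary (λ c → ask (constantOf (suc c)) ∘ const (λ ())) ++ᴬ tabulateAll _ (λ p → ask (functionOf p))

  readInput : Exp k
  readInput = readRelations relationCallers (readFunctions functionCallers) nil

  module _ (A : Structure σ) (ρ : Env k) where

    S : Semantics
    S o xs = reverse (daStreams σ A o xs)

    n ℓ : ℕ
    n = size A
    ℓ = ⌈log₂ n ⌉

    val-numeral : ∀ m → val (reverse (numeral m)) ≡ m
    val-numeral m = trans (sym (fromBits-reverse (reverse (numeral m)))) (trans (cong fromBits (reverse-involutive (numeral m))) (fromBits-numeral m))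

    val-size : val (eval S sizeᴱ ρ) ≡ n
    val-size = val-numeral n

    length-len : length (eval S lenᴱ ρ) ≡ ℓ
    length-len = trans (length-log S sizeᴱ ρ) (cong ⌈log₂_⌉ val-size)

    n≤ : n ≤ 2 ^ length (eval S lenᴱ ρ)
    n≤ = subst (λ l → n ≤ 2 ^ l) (sym length-len) (≤2^⌈log₂⌉ n)

    val-weight : ∀ r → val (eval S (power sizeᴱ r) ρ) ≡ n ^ r
    val-weight = val-sizePower sizeᴱ lenᴱ index S ρ n val-size n≤

    I : ℕ
    I = val (eval S index ρ)

    Represents : ∀ {r} → (Fin r → Exp k) → Vec (Fin n) r → Set
    Represents es ds = ∀ x → val (eval S (es x) ρ) ≡ toℕ (Vec.lookup ds x)

    digitsFrom-represent : ∀ {r} off (ds : Vec (Fin n) r) → I ≡ val (eval S off ρ) + horner ds → Represents (digitsFrom r off) ds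
    digitsFrom-represent = val-digits sizeᴱ lenᴱ index S ρ n val-size n≤

    arguments≡ : ∀ {r} (es : Fin r → Exp k) ds → Represents es ds →
      elements n (Vec.map (argument σ) (Vec.tabulate (λ x → eval S (es x) ρ))) ≡ just ds
    arguments≡ es ds rep = trans (cong (elements n) {Vec.map (argument σ) args} {Vec.map toℕ ds} (vec-ext λ x →
        trans (lookup-map x (argument σ) args) (trans (cong (argument σ) (lookup∘tabulate (λ x → eval S (es x) ρ) x))
          (trans (fromBits-reverse (eval S (es x) ρ)) (trans (rep x) (sym (lookup-map x toℕ ds)))))))
      (elements-toℕ ds)
      where args = Vec.tabulate (λ x → eval S (es x) ρ)

    relationCaller-ok : ∀ {r} (p : relArities σ ∋ r) es ds → Represents es ds →
      eval S (lookupAll relationCallers p es) ρ ≡ lookupAll (relations A) p ds ∷ []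
    relationCaller-ok p es ds rep rewrite lookupAll-tabulate {Caller} (relArities σ) (λ p → ask (relationOf p)) p
      | arguments≡ es ds rep = refl

    functionCaller-ok : ∀ {r} (p : funArities σ ∋ r) es ds → Represents es ds →
      val (eval S (lookupAll (tabulateAll {Caller} (funArities σ) (λ p → ask (functionOf p))) p es) ρ) ≡ toℕ (lookupAll (functions A) p ds)
    functionCaller-ok p es ds rep rewrite lookupAll-tabulate {Caller} (funArities σ) (λ p → ask (functionOf p)) p
      | arguments≡ es ds rep = val-numeral _

    GoodCaller : ∀ {r} → Caller r → (Vec (Fin n) r → Fin n) → Set
    GoodCaller f F = ∀ es ds → Represents es ds → val (eval S (f es) ρ) ≡ toℕ (F ds)

    data GoodCallers : ∀ {ks} → All Caller ks → Functions n ks → Set where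
      []  : GoodCallers [] []
      _∷_ : ∀ {r ks f F} {fs : All Caller ks} {Fs : Functions n ks} → GoodCaller {r} f F → GoodCallers fs Fs → GoodCallers (f ∷ fs) (F ∷ Fs)

    good-lookup : ∀ {ks} (fs : All Caller ks) (Fs : Functions n ks) → (∀ {r} (p : ks ∋ r) → GoodCaller (lookupAll fs p) (lookupAll Fs p)) → GoodCallers fs Fs
    good-lookup []       []       h = []
    good-lookup (f ∷ fs) (F ∷ Fs) h = h here ∷ good-lookup fs Fs (λ p → h (there p))

    good-nullary : ∀ {q} (cs : Vec (Fin n) q) (fs : Fin q → Caller 0) →
      (∀ c es → val (eval S (fs c es) ρ) ≡ toℕ (Vec.lookup cs c)) → ∀ {ks} {gs : All Caller ks} {Gs} → GoodCallers gs Gs →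
      GoodCallers (nullary fs ++ᴬ gs) (nullary (λ c _ → Vec.lookup cs c) ++ᴬ Gs)
    good-nullary []       fs h g = g
    good-nullary (c ∷ cs) fs h g = (λ { es [] _ → h zero es }) ∷ good-nullary cs (fs ∘ suc) (h ∘ suc) g

    functionCallers-good : GoodCallers functionCallers (allFunctions A)
    functionCallers-good = good-nullary (constants A) _
      (λ c es → trans (val-numeral _) (lookup-map c toℕ (constants A)))
      (good-lookup _ (functions A) functionCaller-ok)

    -- `m` counts the passes that still move on. Once it is zero, the index lies below the next
    -- offset and the state no longer changes.
    skip-loop : ∀ ts (st : Env 4) O m h → val (st 0F) ≡ O → I ≡ O + (m * val (st 2F) + h) → st (suc 2F) ≡ eval S index ρ →
      h < val (st 2F) → m ≤ length ts →
      let st′ = iterate (λ b st i → eval S (skipBody b i) st) ts st in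
      val (st′ 0F) ≡ O + m * val (st 2F) × st′ 1F ≡ List.drop m (st 1F)
    skip-loop [] st O zero h off≡ I≡ i≡ h< m≤ = trans off≡ (sym (+-identityʳ O)) , refl
    skip-loop (t ∷ ts) st O zero h off≡ I≡ i≡ h< m≤ =
      let v , d = skip-loop ts st′ O 0 h (trans (cong val off′) off≡) I≡ i≡ h< z≤n in v , trans d bits′
      where
      st′ : Env 4
      st′ i = eval S (skipBody t i) st
      cond : nonempty (eval S skipCond st) ≡ true
      cond = trans (nonempty-lt S (var (suc 2F)) (add (var 0F) (var 2F)) st)
        (trans (cong₂ _<ᵇ_ (trans (cong val i≡) I≡) (trans (val-add S (var 0F) (var 2F) st) (cong (_+ val (st 2F)) off≡)))
          (trans (<ᵇ-+ˡ O) (<ᵇ-true h<)))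
      off′ : st′ 0F ≡ st 0F
      off′ = eval-if-true S skipCond (var 0F) (add (var 0F) (var 2F)) st cond
      bits′ : st′ 1F ≡ st 1F
      bits′ = eval-if-true S skipCond (var 1F) (tail (var 1F)) st cond
    skip-loop (t ∷ ts) st O (suc m) h off≡ I≡ i≡ h< (s≤s m≤) =
      let v , d = skip-loop ts st′ (O + W) m h off′ I≡′ i≡ h< m≤ in
      trans v (+-assoc O W (m * W)) , trans d (trans (cong (List.drop m) bits′) (drop-drop1 m (st 1F)))
      where
      W = val (st 2F)
      st′ : Env 4
      st′ i = eval S (skipBody t i) st
      I≡′ : I ≡ O + W + (m * W + h)
      I≡′ = trans I≡ (trans (cong (O +_) (+-assoc W (m * W) h)) (sym (+-assoc O W (m * W + h))))
      cond : nonempty (eval S skipCond st) ≡ false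
      cond = trans (nonempty-lt S (var (suc 2F)) (add (var 0F) (var 2F)) st)
        (trans (cong₂ _<ᵇ_ (trans (cong val i≡) I≡′) (trans (val-add S (var 0F) (var 2F) st) (cong (_+ W) off≡)))
          (<ᵇ-false (m≤m+n (O + W) _)))
      off′ : val (st′ 0F) ≡ O + W
      off′ = trans (cong val (eval-if-false S skipCond (var 0F) (add (var 0F) (var 2F)) st cond))
        (trans (val-add S (var 0F) (var 2F) st) (cong (_+ W) off≡))
      bits′ : st′ 1F ≡ List.drop 1 (st 1F)
      bits′ = eval-if-false S skipCond (var 1F) (tail (var 1F)) st cond

    skipped-ok : ∀ off bs r m h → I ≡ val (eval S off ρ) + (m * n ^ r + h) → h < n ^ r → m ≤ ℓ →
      val (eval S (skipped off bs (power sizeᴱ r) 0F) ρ) ≡ val (eval S off ρ) + m * n ^ r ×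
      eval S (skipped off bs (power sizeᴱ r) 1F) ρ ≡ List.drop m (eval S bs ρ)
    skipped-ok off bs r m h I≡ h< m≤ =
      let v , d = skip-loop (eval S lenᴱ ρ) (λ i → eval S ((off ∷ᴱ bs ∷ᴱ power sizeᴱ r ∷ᴱ index ∷ᴱ []ᴱ) i) ρ) (val (eval S off ρ)) m h refl
            (trans I≡ (cong (λ w → val (eval S off ρ) + (m * w + h)) (sym (val-weight r)))) refl
            (subst (h <_) (sym (val-weight r)) h<) (subst (m ≤_) (sym length-len) m≤)
      in trans v (cong (λ w → val (eval S off ρ) + m * w) (val-weight r)) , d

    valueBit-ok : ∀ {r} (f : Caller r) F → GoodCaller f F → ∀ off m ds →
      I ≡ val (eval S off ρ) + (toℕ m * n ^ r + horner ds) → eval S (valueBit r f off) ρ ≡ bitOfValue F m ds ∷ []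
    valueBit-ok {r} f F good off m ds I≡ = trans (first (eval S (skipped off (bits lenᴱ v) w 1F) ρ)) (trans (cong (λ xs → bitAt xs 0) bits≡) (bitAt-drop (toBits ℓ (toℕ (F ds))) m))
      where
      w = power sizeᴱ r
      v = f (digitsFrom r (skipped off nil w 0F))
      first : ∀ xs → eval S (maybe′ (λ b → cons b nil) nil (List.head xs)) ρ ≡ bitAt xs 0
      first []      = refl
      first (_ ∷ _) = refl
      off′≡ : I ≡ val (eval S (skipped off nil w 0F) ρ) + horner ds
      off′≡ = trans I≡ (trans (sym (+-assoc (val (eval S off ρ)) _ (horner ds)))
        (cong (_+ horner ds) (sym (proj₁ (skipped-ok off nil r (toℕ m) (horner ds) I≡ (horner< ds) (<⇒≤ (toℕ<n m)))))))
      value≡ : val (eval S v ρ) ≡ toℕ (F ds)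
      value≡ = good _ ds (digitsFrom-represent (skipped off nil w 0F) ds off′≡)
      bits≡ : eval S (skipped off (bits lenᴱ v) w 1F) ρ ≡ List.drop (toℕ m) (Vec.toList (toBits ℓ (toℕ (F ds))))
      bits≡ = trans (proj₂ (skipped-ok off (bits lenᴱ v) r (toℕ m) (horner ds) I≡ (horner< ds) (<⇒≤ (toℕ<n m))))
        (cong (List.drop (toℕ m)) (trans (eval-bits S lenᴱ v ρ) (cong₂ (λ l x → Vec.toList (toBits l x)) length-len value≡)))
      bitAt-drop : ∀ {l} (xs : Vec Bool l) m → bitAt (List.drop (toℕ m) (Vec.toList xs)) 0 ≡ Vec.lookup xs m ∷ []
      bitAt-drop (x ∷ xs) zero    = refl
      bitAt-drop (x ∷ xs) (suc m) = bitAt-drop xs m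

    -- The relative position `j` occurs in the invariant but is not computed: either the index lies
    -- in the first segment, or the length of the segment is added to the offset.
    segment : ∀ off len L t f xs ys j → val (eval S len ρ) ≡ L → length xs ≡ L → I ≡ val (eval S off ρ) + j →
      (j < L → eval S t ρ ≡ bitAt xs j) →
      (∀ j′ → I ≡ val (eval S (add off len) ρ) + j′ → eval S f ρ ≡ bitAt ys j′) →
      eval S (ifᴱ (lt index (add off len)) t f) ρ ≡ bitAt (xs ++ ys) j
    segment off len L t f xs ys j len≡ xs≡ I≡ inside outside with j <ᵇ L in eq
    ... | true  = trans (eval-if-true S (lt index (add off len)) t f ρ cond)
        (trans (inside (<ᵇ-true⁻¹ eq)) (sym (bitAt-++ˡ xs ys (subst (j <_) (sym xs≡) (<ᵇ-true⁻¹ eq)))))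
      where
      cond : nonempty (eval S (lt index (add off len)) ρ) ≡ true
      cond = trans (nonempty-lt S index (add off len) ρ)
        (trans (cong₂ _<ᵇ_ I≡ (trans (val-add S off len ρ) (cong (val (eval S off ρ) +_) len≡))) (trans (<ᵇ-+ˡ (val (eval S off ρ))) eq))
    ... | false = trans (eval-if-false S (lt index (add off len)) t f ρ cond)
        (trans (outside (j ∸ L) I≡′) (trans (sym (bitAt-++ʳ xs ys (j ∸ L))) (cong (bitAt (xs ++ ys)) (trans (cong (_+ (j ∸ L)) xs≡) (m+[n∸m]≡n L≤j)))))
      where
      L≤j : L ≤ j
      L≤j = <ᵇ-false⁻¹ eq
      cond : nonempty (eval S (lt index (add off len)) ρ) ≡ false
      cond = trans (nonempty-lt S index (add off len) ρ)
        (trans (cong₂ _<ᵇ_ I≡ (trans (val-add S off len ρ) (cong (val (eval S off ρ) +_) len≡))) (trans (<ᵇ-+ˡ (val (eval S off ρ))) eq))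
      I≡′ : I ≡ val (eval S (add off len) ρ) + (j ∸ L)
      I≡′ = trans I≡ (trans (cong (val (eval S off ρ) +_) (sym (m+[n∸m]≡n L≤j)))
        (trans (sym (+-assoc (val (eval S off ρ)) L (j ∸ L))) (cong (_+ (j ∸ L)) (sym (trans (val-add S off len ρ) (cong (val (eval S off ρ) +_) len≡))))))

    readFunctions-ok : ∀ {ks} {fs : All Caller ks} {Fs} → GoodCallers fs Fs → ∀ off j → I ≡ val (eval S off ρ) + j →
      eval S (readFunctions fs off) ρ ≡ bitAt (functionsCode Fs) j
    readFunctions-ok [] off j I≡ = refl
    readFunctions-ok (_∷_ {r} {f = f} {F} {fs} {Fs} g gs) off j I≡ =
      segment off (scale lenᴱ (power sizeᴱ r)) (ℓ * n ^ r) _ _ (encodeFunction F) (functionsCode Fs) j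
        (trans (val-scale S lenᴱ (power sizeᴱ r) ρ) (cong₂ _*_ length-len (val-weight r))) (length-function F) I≡ inside
        (λ j′ → readFunctions-ok gs (add off (scale lenᴱ (power sizeᴱ r))) j′)
      where
      inside : j < ℓ * n ^ r → eval S (valueBit r f off) ρ ≡ bitAt (encodeFunction F) j
      inside j< = trans (valueBit-ok f F g off m ds (trans I≡ (cong (val (eval S off ρ) +_) (sym split))))
          (trans (sym (bitAt-function F m ds)) (cong (bitAt (encodeFunction F)) split))
        where
        instance _ = m^n≢0 n r
        q< = m<n*o⇒m/o<n {j} {ℓ} {n ^ r} j<
        m = fromℕ< q<
        found = horner-surjective n r (j % n ^ r) (m%n<n j (n ^ r))
        ds = proj₁ found
        split : toℕ m * n ^ r + horner ds ≡ j
        split = trans (cong₂ (λ d h → d * n ^ r + h) (toℕ-fromℕ< q<) (proj₂ found))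
          (trans (+-comm (j / n ^ r * n ^ r) (j % n ^ r)) (sym (m≡m%n+[m/n]*n j (n ^ r))))

    readRelations-ok : ∀ {rs} (as : All Caller rs) (Rs : Relations n rs) →
      (∀ {r} (p : rs ∋ r) es ds → Represents es ds → eval S (lookupAll as p es) ρ ≡ lookupAll Rs p ds ∷ []) →
      ∀ then ys → (∀ off j → I ≡ val (eval S off ρ) + j → eval S (then off) ρ ≡ bitAt ys j) →
      ∀ off j → I ≡ val (eval S off ρ) + j → eval S (readRelations as then off) ρ ≡ bitAt (relationsCode Rs ++ ys) j
    readRelations-ok [] [] good then ys h off j I≡ = h off j I≡
    readRelations-ok (_∷_ {x = r} a as) (R ∷ Rs) good then ys h off j I≡ =
      trans (segment off (power sizeᴱ r) (n ^ r) _ _ (encodeRelation R) (relationsCode Rs ++ ys) j (val-weight r) (length-relation R) I≡ inside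
          (λ j′ → readRelations-ok as Rs (λ p → good (there p)) then ys h (add off (power sizeᴱ r)) j′))
        (cong (λ xs → bitAt xs j) (sym (++-assoc (encodeRelation R) (relationsCode Rs) ys)))
      where
      inside : j < n ^ r → eval S (a (digitsFrom r off)) ρ ≡ bitAt (encodeRelation R) j
      inside j< = let ds , eq = horner-surjective n r j j< in
        trans (good here (digitsFrom r off) ds (digitsFrom-represent off ds (trans I≡ (cong (val (eval S off ρ) +_) (sym eq)))))
          (trans (sym (bitAt-relation R ds)) (cong (bitAt (encodeRelation R)) eq))

    eval-readInput : eval S readInput ρ ≡ bitAt (bin A) I
    eval-readInput = trans (readRelations-ok relationCallers (relations A) relationCaller-ok (readFunctions functionCallers)
        (functionsCode (allFunctions A)) (readFunctions-ok functionCallers-good) nil I refl)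
      (cong (λ xs → bitAt xs I) (sym (bin≡ A)))

-- Simulation of random-access machines

module SimulateRA (σ : Vocabulary) (M : RandomAccessTM) where

  open Signature (daSignature σ)
  open Language Op arity
  open Commands (daSignature σ) using (Program; Runs; done; more)
  open Arithmetic Op arity
  open TapeSimulation Op arity
  module M = RandomAccessTM M

  #tapes : ℕ
  #tapes = suc M.#work

  finite-Var : Finite (⊤ ⊎ (Fin #tapes × Fin 3))
  finite-Var = finite-⊎ finite-⊤ (finite-× (finite-Fin #tapes) (finite-Fin 3))

  #vars : ℕ
  #vars = proj₁ finite-Var

  open Inverse (proj₂ finite-Var) using (to; from; strictlyInverseʳ)

  stateVar : Exp #vars
  stateVar = var (to (inj₁ tt))

  tapeVar : Fin #tapes → TapeVars #vars
  tapeVar i = tapeVars (v 0F) (v 1F) (v 2F)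
    where
    v : Fin 3 → Exp #vars
    v c = var (to (inj₂ (i , c)))

  #states : ℕ
  #states = proj₁ M.finite

  stateFin : M.State → Fin #states
  stateFin = Inverse.to (proj₂ M.finite)

  finState : Fin #states → M.State
  finState = Inverse.from (proj₂ M.finite)

  stateCode : M.State → List Bool
  stateCode q = unary (toℕ (stateFin q))

  index : Exp #vars
  index = number (flagsᵛ (tapeVar zero)) (bitsᵛ (tapeVar zero))

  open ReadInput σ index

  inputSymbol : Maybe Bool → InputSymbol
  inputSymbol = maybe′ (symbol ∘ bit) ◁

  Step : Set
  Step = Maybe (M.State × Vec (Symbol × Move) #tapes)

  caseState : (M.State → Exp #vars) → Exp #vars
  caseState K = caseFin #states stateVar (K ∘ finState)

  module _ (K : M.State → Step → Exp #vars) where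

    -- The transition function is not evaluated by the expression. It is applied at each leaf of a
    -- finite decision tree, while the expression is built.
    caseTapes : M.State → InputSymbol → Exp #vars
    caseTapes q z = caseVec caseScan tapeVar λ v → K q (M.δ q z v)

    caseInput : M.State → Exp #vars
    caseInput q = caseList inputSymbol readInput (caseTapes q)

    caseStep : Exp #vars
    caseStep = caseState caseInput

  initially : ⊤ ⊎ (Fin #tapes × Fin 3) → Exp 0
  initially (inj₁ _)           = constant (stateCode M.q₀)
  initially (inj₂ (zero , c))  = constant (tapeCode (tapeOf (false ∷ [])) c)
  initially (inj₂ (suc _ , c)) = constant (tapeCode blankTape c)

  afterwards : ⊤ ⊎ (Fin #tapes × Fin 3) → Step → Exp #vars
  -- A default value: without a transition, `goOn` is empty and the program stops.
  afterwards γ              nothing            = var (to γ)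
  afterwards (inj₁ _)       (just (q′ , acts)) = constant (stateCode q′)
  afterwards (inj₂ (i , c)) (just (q′ , acts)) = written (tapeVar i) (Vec.lookup acts i) c

  updated : ⊤ ⊎ (Fin #tapes × Fin 3) → Exp #vars
  updated γ = caseStep λ _ → afterwards γ

  -- Stops the iteration exactly where an `Outcome` ends, so that iterations and steps correspond
  -- one to one.
  running : M.State → Step → Bool
  running q st = not (M.final q) ∧ is-just st

  goOn acceptance : Exp #vars
  goOn       = caseStep λ q st → flagᴱ (running q st)
  acceptance = caseState λ q → flagᴱ (M.final q)

  length-caseStep : ∀ S ρ K {B} → (∀ q st → length (eval S (K q st) ρ) ≤ B) → length (eval S (caseStep K) ρ) ≤ B
  length-caseStep S ρ K h = length-caseFin S stateVar (caseInput K ∘ finState) ρ λ i →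
    length-caseVec S caseScan tapeVar (λ v → K (finState i) (M.δ (finState i) (inputSymbol (List.head (eval S readInput ρ))) v)) ρ
      (λ tv K → length-caseScan S tv K ρ) λ v → h (finState i) _

  length-stateCode : ∀ q → length (stateCode q) ≤ #states
  length-stateCode q = ≤-trans (≤-reflexive (length-replicate (toℕ (stateFin q)))) (<⇒≤ (toℕ<n (stateFin q)))

  -- A new state is a constant of length at most `#states`; the lists of a tape exceed the old bound
  -- by at most one.
  length-afterwards : ∀ S ρ N → Bounded N ρ → ∀ γ st → length (eval S (afterwards γ st) ρ) ≤ suc #states + N
  length-afterwards S ρ N h γ nothing = ≤-trans (h (to γ)) (m≤n+m N (suc #states))
  length-afterwards S ρ N h (inj₁ _) (just (q , _)) = ≤-trans (≤-reflexive (cong length (eval-constant S (stateCode q) ρ)))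
    (≤-trans (length-stateCode q) (≤-trans (n≤1+n _) (m≤m+n (suc #states) N)))
  length-afterwards S ρ N h (inj₂ (i , c)) (just (_ , acts)) =
    ≤-trans (length-written S (tapeVar i) ρ (Vec.lookup acts i) N (λ { 0F → h _ ; 1F → h _ ; 2F → h _ }) c) (s≤s (m≤n+m N #states))

  program : Program
  program = record
    { init     = initially ∘ from
    ; update   = updated ∘ from
    ; growth   = suc #states , λ S ρ N h i → length-caseStep S ρ (λ _ → afterwards (from i)) (λ q → length-afterwards S ρ N h (from i))
    ; continue = goOn
    ; verdict  = acceptance
    }

  initBound : ℕ
  -- The state, and the single cell 0 on the initial address-tape.
  initBound = #states + 1

  module _ (A : Structure σ) where

    comp : Computation
    comp = M.computation (bin A)

    open Computation comp using (Config; step; accepting; initial)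

    SA : Semantics
    SA o xs = reverse (daStreams σ A o xs)

    code : Config → ⊤ ⊎ (Fin #tapes × Fin 3) → List Bool
    code (mkConfig q ts) (inj₁ _)       = stateCode q
    code (mkConfig q ts) (inj₂ (i , c)) = tapeCode (Vec.lookup ts i) c

    Holds : Env #vars → Config → Set
    Holds ρ c = ∀ γ → ρ (to γ) ≡ code c γ

    module _ (ρ : Env #vars) (q : M.State) (ts : Vec Tape #tapes) (h : Holds ρ (mkConfig q ts)) where

      tapes-encoded : ∀ i → Encodes SA ρ (tapeVar i) (Vec.lookup ts i)
      tapes-encoded i = encodes (h (inj₂ (i , 0F))) (h (inj₂ (i , 1F))) (h (inj₂ (i , 2F)))

      inputSymbol-bitAt : ∀ xs i → inputSymbol (List.head (bitAt xs i)) ≡ inputAt xs i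
      inputSymbol-bitAt []       i       = refl
      inputSymbol-bitAt (b ∷ xs) zero    = refl
      inputSymbol-bitAt (b ∷ xs) (suc i) = inputSymbol-bitAt xs i

      head-lookup : ∀ {X : Set} {j} (xs : Vec X (suc j)) → Vec.lookup xs zero ≡ Vec.head xs
      head-lookup (x ∷ xs) = refl

      input≡ : inputSymbol (List.head (eval SA readInput ρ)) ≡ inputAt (bin A) (numberOn (Vec.head ts))
      input≡ = trans (cong (inputSymbol ∘ List.head) (eval-readInput A ρ)) (trans (inputSymbol-bitAt (bin A) _)
        (cong (inputAt (bin A)) (trans (eval-number SA (flagsᵛ (tapeVar zero)) (bitsᵛ (tapeVar zero)) ρ (cells (Vec.lookup ts zero)) (h (inj₂ (zero , 0F))) (h (inj₂ (zero , 1F))))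
          (cong numberOn (head-lookup ts)))))

      eval-caseState : ∀ K → eval SA (caseState K) ρ ≡ eval SA (K q) ρ
      eval-caseState K = trans (eval-caseFin SA stateVar (K ∘ finState) ρ (stateFin q) (h (inj₁ tt)))
        (cong (λ q → eval SA (K q) ρ) (Inverse.strictlyInverseʳ (proj₂ M.finite) q))

      next : Step
      next = M.δ q (inputAt (bin A) (numberOn (Vec.head ts))) (Vec.map scan ts)

      eval-caseStep : ∀ K → eval SA (caseStep K) ρ ≡ eval SA (K q next) ρ
      eval-caseStep K = trans (eval-caseState (caseInput K)) (trans (cong (λ z → eval SA (caseTapes K q z) ρ) input≡)
        (eval-caseVec SA caseScan tapeVar (λ v → K q (M.δ q (inputAt (bin A) (numberOn (Vec.head ts))) v)) ρ (Vec.map scan ts) λ i K →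
          trans (eval-caseScan SA (tapeVar i) K ρ (Vec.lookup ts i) (tapes-encoded i)) (cong (λ s → eval SA (K s) ρ) (sym (lookup-map i scan ts)))))

      eval-goOn : eval SA goOn ρ ≡ flagList (running q next)
      eval-goOn = trans (eval-caseStep (λ q st → flagᴱ (running q st))) (eval-flag SA (running q next) ρ)

      eval-acceptance : nonempty (eval SA acceptance ρ) ≡ M.final q
      eval-acceptance = trans (cong nonempty (trans (eval-caseState (λ q → flagᴱ (M.final q))) (eval-flag SA (M.final q) ρ))) (nonempty-flagList (M.final q))

    eval-updated : ∀ ρ q ts → Holds ρ (mkConfig q ts) → ∀ {c′} → step (mkConfig q ts) ≡ just c′ → Holds (evals SA (updated ∘ from) ρ) c′
    eval-updated ρ q ts h {c′} st≡ γ = trans (cong (λ γ → eval SA (updated γ) ρ) (strictlyInverseʳ γ))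
        (trans (eval-caseStep ρ q ts h (λ _ → afterwards γ)) (go γ (next ρ q ts h) st≡))
      where
      go : ∀ γ nx → (nx >>= λ (q′ , acts) → just (mkConfig q′ (Vec.zipWith writeMove ts acts))) ≡ just c′ → eval SA (afterwards γ nx) ρ ≡ code c′ γ
      go (inj₁ _)       (just (q′ , acts)) refl = eval-constant SA (stateCode q′) ρ
      go (inj₂ (i , c)) (just (q′ , acts)) refl = trans (eval-written SA (tapeVar i) ρ (Vec.lookup ts i) (Vec.lookup acts i) (tapes-encoded ρ q ts h i) c)
        (cong (λ t → tapeCode t c) (sym (lookup-zipWith writeMove i ts acts)))

    simulate : ∀ {c t b} → Outcome comp c t b → ∀ ρ → Holds ρ c → ∃[ ρ′ ] Runs program SA ρ t ρ′ × nonempty (eval SA acceptance ρ′) ≡ b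
    simulate {mkConfig q ts} (accepts acc) ρ h = ρ ,
      done (trans (eval-goOn ρ q ts h) (cong (λ f → flagList (not f ∧ is-just (next ρ q ts h))) acc)) ,
      trans (eval-acceptance ρ q ts h) acc
    simulate {mkConfig q ts} (rejects rej stuck) ρ h = ρ ,
      done (trans (eval-goOn ρ q ts h) (cong₂ (λ f j → flagList (not f ∧ j)) rej (halted (next ρ q ts h) stuck))) ,
      trans (eval-acceptance ρ q ts h) rej
      where
      halted : ∀ nx → (nx >>= λ (q′ , acts) → just (mkConfig q′ (Vec.zipWith writeMove ts acts))) ≡ nothing → is-just nx ≡ false
      halted nothing  _ = refl
      halted (just _) ()
    simulate {mkConfig q ts} (steps rej st o) ρ h =
      let ρ′ , runs , v = simulate o (evals SA (updated ∘ from) ρ) (eval-updated ρ q ts h st) in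
      ρ′ , more (trans (eval-goOn ρ q ts h) (cong₂ (λ f j → flagList (not f ∧ j)) rej (moves (next ρ q ts h) st))) runs , v
      where
      moves : ∀ nx {c′} → (nx >>= λ (q′ , acts) → just (mkConfig q′ (Vec.zipWith writeMove ts acts))) ≡ just c′ → is-just nx ≡ true
      moves (just _) _ = refl

    initial-holds : Holds (evals SA (initially ∘ from) (λ ())) initial
    initial-holds γ = trans (cong (λ γ → eval SA (initially γ) (λ ())) (strictlyInverseʳ γ)) (go γ)
      where
      go : ∀ γ → eval SA (initially γ) (λ ()) ≡ code initial γ
      go (inj₁ _)           = eval-constant SA (stateCode M.q₀) (λ ())
      go (inj₂ (zero , c))  = eval-constant SA (tapeCode (tapeOf (false ∷ [])) c) (λ ())
      go (inj₂ (suc i , c)) = trans (eval-constant SA (tapeCode blankTape c) (λ ()))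
        (cong (λ t → tapeCode t c) (sym (lookup-replicate i blankTape)))

    initial-bounded : Bounded initBound (evals SA (initially ∘ from) (λ ()))
    initial-bounded i with from i
    ... | inj₁ _ = ≤-trans (≤-reflexive (cong length (eval-constant SA (stateCode M.q₀) (λ ())))) (≤-trans (length-stateCode M.q₀) (m≤m+n #states 1))
    ... | inj₂ (zero , 0F)  = m≤n+m 1 #states
    ... | inj₂ (zero , 1F)  = m≤n+m 1 #states
    ... | inj₂ (zero , 2F)  = z≤n
    ... | inj₂ (suc _ , 0F) = z≤n
    ... | inj₂ (suc _ , 1F) = z≤n
    ... | inj₂ (suc _ , 2F) = z≤n

lookupConst : ∀ {X : Set} {rs} → All (const X) rs → Ix (const ⊤) rs → X
lookupConst (x ∷ xs) (inj₁ _)  = x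
lookupConst (x ∷ xs) (inj₂ ix) = lookupConst xs ix

lookupConst-sub : ∀ {X : Set} {rs r} (xs : All (const X) rs) (p : rs ∋ r) → lookupConst xs (sub p tt) ≡ lookupAll xs p
lookupConst-sub (x ∷ xs) here      = refl
lookupConst-sub (x ∷ xs) (there p) = lookupConst-sub xs p

lookupConst-zipWith : ∀ {P Q R : Set} (f : P → Q → R) {rs} (xs : All (const P) rs) (ys : All (const Q) rs) ix →
  lookupConst (All.zipWith (uncurry f) (xs , ys)) ix ≡ f (lookupConst xs ix) (lookupConst ys ix)
lookupConst-zipWith f (x ∷ xs) (y ∷ ys) (inj₁ _)  = refl
lookupConst-zipWith f (x ∷ xs) (y ∷ ys) (inj₂ ix) = lookupConst-zipWith f xs ys ix

lookupConst-universal : ∀ {X : Set} (x : X) rs ix → lookupConst (All.universal (λ _ → x) rs) ix ≡ x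
lookupConst-universal x (r ∷ rs) (inj₁ _)  = refl
lookupConst-universal x (r ∷ rs) (inj₂ ix) = lookupConst-universal x rs ix

symbolFrom : Maybe Bool → Symbol
symbolFrom = maybe′ bit blank

symbolFrom-at : ∀ xs p → symbolFrom (List.head (List.drop p xs)) ≡ symbolAt (List.map bit xs) p
symbolFrom-at []       zero    = refl
symbolFrom-at []       (suc p) = refl
symbolFrom-at (x ∷ xs) zero    = refl
symbolFrom-at (x ∷ xs) (suc p) = symbolFrom-at xs p

-- The structure, recovered from its encoding

module ReadStructure (σ : Vocabulary) where

  open Signature raSignature
  open Language Op arity
  open Arithmetic Op arity

  readᴱ : ∀ {k} → Exp k → Exp k
  readᴱ e = ask tt (λ _ → e)

  sumPowersᴱ : ∀ {k} → List ℕ → Exp k → Exp k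
  sumPowersᴱ []       v = nil
  sumPowersᴱ (r ∷ rs) v = add (power v r) (sumPowersᴱ rs v)

  codeLengthᴱ : ∀ {k} → Exp k → Exp k → Exp k
  codeLengthᴱ l v = add (sumPowersᴱ (relArities σ) v) (scale l (sumPowersᴱ (allFunArities {σ}) v))

  -- A number c < size A is recognised by its encoding being too short.
  smaller : Exp 2
  smaller = readᴱ (codeLengthᴱ (var 1F) (var 0F))

  open Search smaller

  -- The size of the domain, given ⌈log₂ size ⌉ in unary, and a test whether a
  -- unary number is less than ⌈log₂ size ⌉.
  foundSize tooShort : ∀ {k} → Exp k → Exp k
  foundSize lenᴱ = add (search lenᴱ (lenᴱ ∷ᴱ []ᴱ)) (cons true nil)
  tooShort lenᴱ = readᴱ (codeLengthᴱ lenᴱ (exp₂ lenᴱ))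

  module Access {k : ℕ} (lenᴱ sizeᴱ : Exp k) where

    hornerᴱ : ∀ r → (Fin r → Exp k) → Exp k
    hornerᴱ zero    es = nil
    hornerᴱ (suc r) es = add (mul (es zero) (power sizeᴱ r)) (hornerᴱ r (es ∘ suc))

    offsetᴱ : ∀ {rs r} → rs ∋ r → Exp k
    offsetᴱ here                = nil
    offsetᴱ (there {r′ = r′} p) = add (power sizeᴱ r′) (offsetᴱ p)

    -- An argument outside the domain must not enter the computation of an address, which might then
    -- hit a bit that belongs to something else.
    guard : ∀ r → (Fin r → Exp k) → Exp k → Exp k → Exp k
    guard zero    es t f = t
    guard (suc r) es t f = ifᴱ (lt (es zero) sizeᴱ) (guard r (es ∘ suc) t f) f

    relationᴱ : ∀ {r} → relArities σ ∋ r → (Fin r → Exp k) → Exp k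
    relationᴱ {r} p es = guard r es (readᴱ (add (offsetᴱ p) (hornerᴱ r es))) nil

    -- State: address, bits read so far, distance of consecutive bits.
    collectBody : Bool → Fin 3 → Exp 3
    collectBody _ 0F = add (var 0F) (var 2F)
    collectBody _ 1F = test (readᴱ (var 0F)) λ b → cons (fromHead b) (var 1F)
    collectBody _ 2F = var 2F

    -- A function is encoded as one relation per bit of the value, so the bits of one value lie at a
    -- constant distance `w`, the length of such a relation.
    collect : Exp k → Exp k → Exp k
    collect a w = loop lenᴱ (a ∷ᴱ nil ∷ᴱ w ∷ᴱ []ᴱ) collectBody
      (1 , λ { S b ρ N h 0F → length-add S (var 0F) (var 2F) ρ (h 0F) (h 2F)
             ; S b ρ N h 1F → s≤s (h 1F) ; S b ρ N h 2F → m≤n⇒m≤1+n (h 2F) }) (var 1F)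

    functionAddress : ∀ {r} → allFunArities {σ} ∋ r → (Fin r → Exp k) → Exp k
    functionAddress {r} p es = add (sumPowersᴱ (relArities σ) sizeᴱ) (add (scale lenᴱ (offsetᴱ p)) (hornerᴱ r es))

    fetch : ∀ {r} → allFunArities {σ} ∋ r → (Fin r → Exp k) → Exp k
    fetch {r} p es = strip (rev (collect (functionAddress p es) (power sizeᴱ r)))

    valueᴱ : ∀ {r} → funArities σ ∋ r → (Fin r → Exp k) → Exp k
    valueᴱ {r} p es = guard r es (fetch (afterNullary (#constants σ) p) es) nil

    constantᴱ : Fin (suc (#constants σ)) → Exp k
    -- One bit more than ⌈log n⌉, because the size may be the power of two itself.
    constantᴱ zero    = strip (bits (cons true lenᴱ) sizeᴱ)
    constantᴱ (suc c) = fetch (atNullary (funArities σ) c) (λ ())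

  module _ (A : Structure σ) where

    open Structure A using () renaming (size to n)

    L : ℕ
    L = ⌈log₂ n ⌉

    SA : Semantics
    SA o xs = reverse (raStreams (bin A) o xs)

    eval-read : ∀ {k} (e : Exp k) ρ → eval SA (readᴱ e) ρ ≡ bitAt (bin A) (val (eval SA e ρ))
    eval-read e ρ = trans (reverse-short (inputAt (bin A) (fromBits (reverse (eval SA e ρ)))))
      (trans (inputBits-inputAt (bin A) _) (cong (bitAt (bin A)) (fromBits-reverse (eval SA e ρ))))
      where
      reverse-short : ∀ s → reverse (inputBits s) ≡ inputBits s
      reverse-short (symbol (bit _)) = refl
      reverse-short (symbol blank)   = refl
      reverse-short ◁                = refl

    -- A single query compares a number with the length of the input, although that length is not
    -- known.
    nonempty-read : ∀ {k} (e : Exp k) ρ → nonempty (eval SA (readᴱ e) ρ) ≡ (val (eval SA e ρ) <ᵇ codeLength {σ} L n)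
    nonempty-read e ρ = trans (cong nonempty (eval-read e ρ)) (trans (nonempty-bitAt (bin A) (val (eval SA e ρ))) (cong (val (eval SA e ρ) <ᵇ_) (length-bin A)))

    val-sumPowers : ∀ {k} rs (v : Exp k) ρ → val (eval SA (sumPowersᴱ rs v) ρ) ≡ sumPowers rs (val (eval SA v ρ))
    val-sumPowers []       v ρ = refl
    val-sumPowers (r ∷ rs) v ρ = trans (val-add SA (power v r) (sumPowersᴱ rs v) ρ) (cong₂ _+_ (val-power SA v r ρ) (val-sumPowers rs v ρ))

    val-codeLength : ∀ {k} (l v : Exp k) ρ → val (eval SA (codeLengthᴱ l v) ρ) ≡ codeLength {σ} (length (eval SA l ρ)) (val (eval SA v ρ))
    val-codeLength l v ρ = trans (val-add SA (sumPowersᴱ (relArities σ) v) (scale l (sumPowersᴱ (allFunArities {σ}) v)) ρ)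
      (cong₂ _+_ (val-sumPowers (relArities σ) v ρ) (trans (val-scale SA l (sumPowersᴱ (allFunArities {σ}) v) ρ) (cong (length (eval SA l ρ) *_) (val-sumPowers (allFunArities {σ}) v ρ))))

    module _ (pos-arity : HasPositiveArity σ) where

      -- For l < L the size exceeds 2 ^ l, so strict monotonicity applies; otherwise the size is at
      -- most 2 ^ L, hence at most 2 ^ l.
      searching-test : ∀ l → (codeLength {σ} l (2 ^ l) <ᵇ codeLength {σ} L n) ≡ (l <ᵇ L)
      searching-test l with l <ᵇ L in eq
      ... | true  = <ᵇ-true (codeLength-strict {σ} pos-arity (≤-trans (s≤s z≤n) l<L) (<⇒≤ l<L) (≰⇒> λ n≤ → <⇒≱ l<L (⌈log₂⌉≤ n≤)))
        where
        l<L : l < L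
        l<L = <ᵇ-true⁻¹ {l} {L} eq
      ... | false = <ᵇ-false (codeLength-mono {σ} L≤l (≤-trans (≤2^⌈log₂⌉ n) (^-monoʳ-≤ 2 L≤l)))
        where
        L≤l : L ≤ l
        L≤l = <ᵇ-false⁻¹ {l} {L} eq

      -- From 1 ≤ c < n follows n ≥ 2, so the logarithm is positive, as `codeLength-strict` demands.
      smaller-test : ∀ c → 1 ≤ c → (codeLength {σ} L c <ᵇ codeLength {σ} L n) ≡ (c <ᵇ n)
      smaller-test c 1≤c with c <ᵇ n in eq
      ... | true  = <ᵇ-true (codeLength-strict {σ} pos-arity (<⌈log₂⌉ {n} {0} (≤-trans (s≤s 1≤c) c<n)) ≤-refl c<n)
        where
        c<n : c < n
        c<n = <ᵇ-true⁻¹ {c} {n} eq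
      ... | false = <ᵇ-false (codeLength-mono {σ} {L} {L} ≤-refl (<ᵇ-false⁻¹ {c} {n} eq))

      -- The largest candidate that passes the test is the predecessor of the size; hence the 1
      -- added in `foundSize`.
      val-found : ∀ {k} (lenᴱ : Exp k) ρ → length (eval SA lenᴱ ρ) ≡ L → val (eval SA (foundSize lenᴱ) ρ) ≡ n
      val-found lenᴱ ρ len≡ = trans (val-add SA (search lenᴱ (lenᴱ ∷ᴱ []ᴱ)) (cons true nil) ρ)
        (trans (cong (_+ 1) (val-search SA (λ _ → eval SA lenᴱ ρ) (pred n) holds lenᴱ (lenᴱ ∷ᴱ []ᴱ) ρ (λ { zero → refl }) bound))
          (trans (+-comm (pred n) 1) n≡))
        where
        n≡ : suc (pred n) ≡ n
        n≡ = suc-pred n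
        holds : ∀ ρ′ → (∀ (i : Fin 1) → ρ′ (suc i) ≡ eval SA lenᴱ ρ) → 1 ≤ val (ρ′ 0F) → nonempty (eval SA smaller ρ′) ≡ (val (ρ′ 0F) <ᵇ suc (pred n))
        holds ρ′ h 1≤ = trans (nonempty-read (codeLengthᴱ (var 1F) (var 0F)) ρ′)
          (trans (cong (_<ᵇ codeLength {σ} L n) (trans (val-codeLength (var 1F) (var 0F) ρ′)
              (cong (λ l → codeLength {σ} l (val (ρ′ 0F))) (trans (cong length (h zero)) len≡))))
            (trans (smaller-test (val (ρ′ 0F)) 1≤) (cong (val (ρ′ 0F) <ᵇ_) (sym n≡))))
        bound : pred n < 2 ^ suc (length (eval SA lenᴱ ρ))
        bound = subst (λ l → pred n < 2 ^ suc l) (sym len≡)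
          (≤-trans (≤-reflexive n≡) (≤-trans (≤2^⌈log₂⌉ n) (^-monoʳ-≤ 2 (n≤1+n L))))

      eval-searching : ∀ {k} (lenᴱ : Exp k) ρ → nonempty (eval SA (tooShort lenᴱ) ρ) ≡ (length (eval SA lenᴱ ρ) <ᵇ L)
      eval-searching lenᴱ ρ = trans (nonempty-read (codeLengthᴱ lenᴱ (exp₂ lenᴱ)) ρ)
        (trans (cong (_<ᵇ codeLength {σ} L n) (trans (val-codeLength lenᴱ (exp₂ lenᴱ) ρ) (cong (codeLength {σ} (length (eval SA lenᴱ ρ))) (val-exp₂ SA lenᴱ ρ))))
          (searching-test (length (eval SA lenᴱ ρ))))

    module Ready {k} (lenᴱ sizeᴱ : Exp k) (ρ : Env k) (len≡ : length (eval SA lenᴱ ρ) ≡ L) (val-size : val (eval SA sizeᴱ ρ) ≡ n) where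

      open Access lenᴱ sizeᴱ

      val-sizePower : ∀ r → val (eval SA (power sizeᴱ r) ρ) ≡ n ^ r
      val-sizePower r = trans (val-power SA sizeᴱ r ρ) (cong (_^ r) val-size)

      numbers : ∀ {r} → (Fin r → Exp k) → Vec ℕ r
      numbers es = Vec.tabulate (λ x → val (eval SA (es x) ρ))

      val-horner : ∀ {r} (es : Fin r → Exp k) (ds : Vec (Fin n) r) → Vec.map toℕ ds ≡ numbers es → val (eval SA (hornerᴱ r es) ρ) ≡ horner ds
      val-horner {zero}  es []       eq = refl
      val-horner {suc r} es (d ∷ ds) eq = trans (val-add SA (mul (es zero) (power sizeᴱ r)) (hornerᴱ r (es ∘ suc)) ρ)
        (cong₂ _+_ (trans (val-mul SA (es zero) (power sizeᴱ r) ρ) (cong₂ _*_ (sym (cong Vec.head eq)) (val-sizePower r)))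
          (val-horner (es ∘ suc) ds (cong Vec.tail eq)))

      val-offset : ∀ {rs r} (p : rs ∋ r) → val (eval SA (offsetᴱ p) ρ) ≡ offset p n
      val-offset here                = refl
      val-offset (there {r′ = r′} p) = trans (val-add SA (power sizeᴱ r′) (offsetᴱ p) ρ) (cong₂ _+_ (val-sizePower r′) (val-offset p))

      guard-just : ∀ {r} (es : Fin r → Exp k) t f {ds} → elements n (numbers es) ≡ just ds → eval SA (guard r es t f) ρ ≡ eval SA t ρ
      guard-just {zero}  es t f eq = refl
      guard-just {suc r} es t f eq with val (eval SA (es zero) ρ) <? n
      ... | yes p with elements n (numbers (es ∘ suc)) in eqs
      ...   | just ds = trans (eval-if-true SA (lt (es zero) sizeᴱ) (guard r (es ∘ suc) t f) f ρ
          (trans (nonempty-lt SA (es zero) sizeᴱ ρ) (trans (cong (val (eval SA (es zero) ρ) <ᵇ_) val-size) (<ᵇ-true p))))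
        (guard-just (es ∘ suc) t f eqs)

      guard-nothing : ∀ {r} (es : Fin r → Exp k) t f → elements n (numbers es) ≡ nothing → eval SA (guard r es t f) ρ ≡ eval SA f ρ
      guard-nothing {suc r} es t f eq with val (eval SA (es zero) ρ) <? n
      ... | no ¬p = eval-if-false SA (lt (es zero) sizeᴱ) (guard r (es ∘ suc) t f) f ρ
          (trans (nonempty-lt SA (es zero) sizeᴱ ρ) (trans (cong (val (eval SA (es zero) ρ) <ᵇ_) val-size) (<ᵇ-false (≮⇒≥ ¬p))))
      ... | yes p with elements n (numbers (es ∘ suc)) in eqs
      ...   | nothing = trans (eval-if-true SA (lt (es zero) sizeᴱ) (guard r (es ∘ suc) t f) f ρ
          (trans (nonempty-lt SA (es zero) sizeᴱ ρ) (trans (cong (val (eval SA (es zero) ρ) <ᵇ_) val-size) (<ᵇ-true p))))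
        (guard-nothing (es ∘ suc) t f eqs)

      eval-collect : ∀ a w (bs : Vec Bool L) →
        (∀ m → bitAt (bin A) (val (eval SA a ρ) + toℕ m * val (eval SA w ρ)) ≡ Vec.lookup bs m ∷ []) →
        eval SA (collect a w) ρ ≡ reverse (Vec.toList bs)
      eval-collect a w bs h = go (eval SA lenᴱ ρ) bs _ len≡ λ m → h m
        where
        go : ∀ ts {l} (bs : Vec Bool l) (st : Env 3) → length ts ≡ l →
          (∀ m → bitAt (bin A) (val (st 0F) + toℕ m * val (st 2F)) ≡ Vec.lookup bs m ∷ []) →
          iterate (λ b st i → eval SA (collectBody b i) st) ts st 1F ≡ Vec.toList bs ʳ++ st 1F
        go []       []       st len h = refl
        go (t ∷ ts) (b ∷ bs) st len h = trans (go ts bs _ (suc-injective len) h′) (cong (Vec.toList bs ʳ++_) bit≡)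
          where
          bit≡ : fromHead (List.head (eval SA (readᴱ (var 0F)) st)) ∷ st 1F ≡ b ∷ st 1F
          bit≡ = cong (_∷ st 1F) (cong (fromHead ∘ List.head) (trans (eval-read (var 0F) st) (trans (cong (bitAt (bin A)) (sym (+-identityʳ (val (st 0F))))) (h zero))))
          h′ : ∀ m → bitAt (bin A) (val (eval SA (add (var 0F) (var 2F)) st) + toℕ m * val (st 2F)) ≡ Vec.lookup bs m ∷ []
          h′ m = trans (cong (bitAt (bin A)) (trans (cong (_+ toℕ m * val (st 2F)) (val-add SA (var 0F) (var 2F) st)) (+-assoc (val (st 0F)) (val (st 2F)) _))) (h (suc m))

      val-functionAddress : ∀ {r} (p : allFunArities {σ} ∋ r) es ds → Vec.map toℕ ds ≡ numbers es →
        val (eval SA (functionAddress p es) ρ) ≡ sumPowers (relArities σ) n + (L * offset p n + horner ds)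
      val-functionAddress {r} p es ds eq = trans (val-add SA (sumPowersᴱ (relArities σ) sizeᴱ) (add (scale lenᴱ (offsetᴱ p)) (hornerᴱ r es)) ρ)
        (cong₂ _+_ (trans (val-sumPowers (relArities σ) sizeᴱ ρ) (cong (sumPowers (relArities σ)) val-size))
          (trans (val-add SA (scale lenᴱ (offsetᴱ p)) (hornerᴱ r es) ρ)
            (cong₂ _+_ (trans (val-scale SA lenᴱ (offsetᴱ p) ρ) (cong₂ _*_ len≡ (val-offset p))) (val-horner es ds eq))))

      eval-fetch : ∀ {r} (p : allFunArities {σ} ∋ r) es ds → Vec.map toℕ ds ≡ numbers es →
        eval SA (fetch p es) ρ ≡ numeral (toℕ (lookupAll (allFunctions A) p ds))
      eval-fetch {r} p es ds eq = trans (eval-strip SA (rev (collect a w)) ρ)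
        (trans (cong normal (trans (eval-rev SA (collect a w) ρ) (trans (cong reverse (eval-collect a w (encodeElement v) at-m)) (reverse-involutive (Vec.toList (encodeElement v))))))
          (normal-toBits L (toℕ v) (≤-trans (toℕ<n v) (≤2^⌈log₂⌉ n))))
        where
        a = functionAddress p es
        w = power sizeᴱ r
        F = lookupAll (allFunctions A) p
        v = F ds
        R# = sumPowers (relArities σ) n
        arith : ∀ r o h m → r + (o + h) + m ≡ r + (o + (m + h))
        arith = solve-∀
        at-m : ∀ m → bitAt (bin A) (val (eval SA a ρ) + toℕ m * val (eval SA w ρ)) ≡ Vec.lookup (encodeElement v) m ∷ []
        at-m m = trans (cong₂ bitAt (bin≡ A)
            (trans (cong₂ (λ x y → x + toℕ m * y) (val-functionAddress p es ds eq) (val-sizePower r))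
              (trans (arith R# (L * offset p n) (horner ds) (toℕ m * n ^ r)) (cong (_+ (L * offset p n + (toℕ m * n ^ r + horner ds))) (sym (length-relationsCode (relations A)))))))
          (trans (bitAt-++ʳ (relationsCode (relations A)) _ (L * offset p n + (toℕ m * n ^ r + horner ds))) (bitAt-functions (allFunctions A) p m ds))

      eval-relation : ∀ {r} (p : relArities σ ∋ r) (es : Fin r → Exp k) →
        fromHead (List.head (eval SA (relationᴱ p es) ρ)) ≡ maybe′ (lookupAll (relations A) p) false (elements n (numbers es))
      eval-relation {r} p es = go (elements n (numbers es)) refl
        where
        target = readᴱ (add (offsetᴱ p) (hornerᴱ r es))
        go : ∀ m → elements n (numbers es) ≡ m → fromHead (List.head (eval SA (relationᴱ p es) ρ)) ≡ maybe′ (lookupAll (relations A) p) false m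
        go nothing   eq = cong (fromHead ∘ List.head) (guard-nothing es target nil eq)
        go (just ds) eq = trans (cong (fromHead ∘ List.head) (guard-just es target nil eq))
          (cong (fromHead ∘ List.head) (trans (eval-read (add (offsetᴱ p) (hornerᴱ r es)) ρ)
            (trans (cong₂ bitAt (bin≡ A) (trans (val-add SA (offsetᴱ p) (hornerᴱ r es) ρ) (cong₂ _+_ (val-offset p) (val-horner es ds (elements-just (numbers es) eq)))))
              (bitAt-relations (relations A) p (functionsCode (allFunctions A)) ds))))

      eval-value : ∀ {r} (p : funArities σ ∋ r) (es : Fin r → Exp k) →
        eval SA (valueᴱ p es) ρ ≡ maybe′ (λ as → numeral (toℕ (lookupAll (functions A) p as))) [] (elements n (numbers es))
      eval-value {r} p es = go (elements n (numbers es)) refl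
        where
        target = fetch (afterNullary (#constants σ) p) es
        go : ∀ m → elements n (numbers es) ≡ m → eval SA (valueᴱ p es) ρ ≡ maybe′ (λ as → numeral (toℕ (lookupAll (functions A) p as))) [] m
        go nothing   eq = guard-nothing es target nil eq
        go (just ds) eq = trans (guard-just es target nil eq)
          (trans (eval-fetch (afterNullary (#constants σ) p) es ds (elements-just (numbers es) eq))
            (cong (λ F → numeral (toℕ (F ds))) (lookupAll-afterNullary (λ c _ → Vec.lookup (constants A) c) (functions A) p)))

      eval-constant-value : ∀ c → eval SA (constantᴱ c) ρ ≡ numeral (Vec.lookup (constantValues σ A) c)
      eval-constant-value zero = trans (eval-strip SA (bits (cons true lenᴱ) sizeᴱ) ρ)
        (trans (cong normal (trans (eval-bits SA (cons true lenᴱ) sizeᴱ ρ) (cong₂ (λ l v → Vec.toList (toBits (suc l) v)) len≡ val-size)))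
          (normal-toBits (suc L) n (≤-<-trans (≤2^⌈log₂⌉ n) (^-monoʳ-< 2 (s≤s (s≤s z≤n)) (n<1+n L)))))
      eval-constant-value (suc c) = trans (eval-fetch (atNullary (funArities σ) c) (λ ()) [] refl)
        (cong numeral (trans (cong (λ F → toℕ (F [])) (lookupAll-atNullary (λ c _ → Vec.lookup (constants A) c) (functions A) c))
          (sym (lookup-map c toℕ (constants A)))))

-- Simulation of direct-access machines

module SimulateDA (σ : Vocabulary) (pos-arity : HasPositiveArity σ) (M : DirectAccessTM σ) where

  open Signature raSignature
  open Language Op arity
  open Commands raSignature using (Program; Runs; done; more)
  open Arithmetic Op arity
  open TapeSimulation Op arity
  open ReadStructure σ
  module M = DirectAccessTM M

  TapeIx : Set
  TapeIx = Ix Fin (relArities σ) ⊎ Ix Fin (funArities σ) ⊎ Fin M.#work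

  -- Of a read-only tape only the head position is stored; its contents are recomputed from the
  -- input and the address-tapes whenever a cell is scanned. `startedV` records whether a step has
  -- been made, since the value-tapes are blank before.
  Var : Set
  Var = (⊤ ⊎ ⊤ ⊎ ⊤) ⊎ (TapeIx × Fin 3) ⊎ Mirror σ

  pattern lenV         = inj₁ (inj₁ tt)
  pattern stateV       = inj₁ (inj₂ (inj₁ tt))
  pattern startedV     = inj₁ (inj₂ (inj₂ tt))
  pattern tapeV ix c   = inj₂ (inj₁ (ix , c))
  pattern positionV x  = inj₂ (inj₂ x)

  finite-Var : Finite Var
  finite-Var = finite-⊎ (finite-⊎ finite-⊤ (finite-⊎ finite-⊤ finite-⊤))
    (finite-⊎ (finite-× (finite-⊎ (finite-Ix finite-Fin _) (finite-⊎ (finite-Ix finite-Fin _) (finite-Fin M.#work))) (finite-Fin 3)) (finite-Mirror σ))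

  #vars : ℕ
  #vars = proj₁ finite-Var

  open Inverse (proj₂ finite-Var) using (to; from; strictlyInverseʳ)

  variable′ : Var → Exp #vars
  variable′ γ = var (to γ)

  tapeVar : TapeIx → TapeVars #vars
  tapeVar ix = tapeVars (variable′ (tapeV ix 0F)) (variable′ (tapeV ix 1F)) (variable′ (tapeV ix 2F))

  #states : ℕ
  #states = proj₁ M.finite

  stateFin : M.State → Fin #states
  stateFin = Inverse.to (proj₂ M.finite)

  finState : Fin #states → M.State
  finState = Inverse.from (proj₂ M.finite)

  stateCode : M.State → List Bool
  stateCode q = unary (toℕ (stateFin q))

  lenᴱ searching : Exp #vars
  lenᴱ      = variable′ lenV
  searching = tooShort lenᴱ

  open Access lenᴱ (foundSize lenᴱ)

  numberᴱ : TapeIx → Exp #vars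
  numberᴱ ix = number (flagsᵛ (tapeVar ix)) (bitsᵛ (tapeVar ix))

  relNumber : ∀ {r} → relArities σ ∋ r → Fin r → Exp #vars
  relNumber p x = numberᴱ (inj₁ (sub p x))

  funNumber : ∀ {k} → funArities σ ∋ k → Fin k → Exp #vars
  funNumber p x = numberᴱ (inj₂ (inj₁ (sub p x)))

  caseCell : Exp #vars → Mirror σ → (Symbol → Exp #vars) → Exp #vars
  caseCell e x K = caseList symbolFrom (dropᴱ (variable′ (positionV x)) e) K

  relTapes : ∀ {r} → relArities σ ∋ r → (Vec Symbol r → Exp #vars) → Exp #vars
  relTapes p = caseVec caseScan (λ x → tapeVar (inj₁ (sub p x)))

  funTapes : ∀ {k} → funArities σ ∋ k → (Vec Symbol k → Exp #vars) → Exp #vars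
  funTapes p = caseVec caseScan (λ x → tapeVar (inj₂ (inj₁ (sub p x))))

  valueTape : ∀ {k} → funArities σ ∋ k → (Symbol → Exp #vars) → Exp #vars
  valueTape p K = ifᴱ (variable′ startedV) (caseCell (valueᴱ p (funNumber p)) (inj₁ (sub p tt)) K) (K blank)

  constTape : Fin (suc (#constants σ)) → (Symbol → Exp #vars) → Exp #vars
  constTape c = caseCell (constantᴱ c) (inj₂ c)

  answerᴱ : ∀ {r} → relArities σ ∋ r → (Bool → Exp #vars) → Exp #vars
  answerᴱ p = caseList fromHead (relationᴱ p (relNumber p))

  Step : Set
  Step = Maybe (M.State × Action σ M.#work)

  caseState : (M.State → Exp #vars) → Exp #vars
  caseState K = caseFin #states (variable′ stateV) (K ∘ finState)

  module _ (K : Scanned σ M.#work → All (const Bool) (relArities σ) → Exp #vars) where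

    -- The stages are named in order to serve as explicit continuations in the lemmas on `caseAll`
    -- and `caseVec`.
    case₆ : All (Vec Symbol) (relArities σ) → All (Vec Symbol) (funArities σ) → All (const Symbol) (funArities σ) →
      Vec Symbol (suc (#constants σ)) → Vec Symbol M.#work → Exp #vars
    case₆ ras fas vs cs ws = caseAll (relArities σ) answerᴱ (K (mkTapes ras fas vs cs ws))

    case₅ : All (Vec Symbol) (relArities σ) → All (Vec Symbol) (funArities σ) → All (const Symbol) (funArities σ) →
      Vec Symbol (suc (#constants σ)) → Exp #vars
    case₅ ras fas vs cs = caseVec caseScan (λ i → tapeVar (inj₂ (inj₂ i))) (case₆ ras fas vs cs)

    case₄ : All (Vec Symbol) (relArities σ) → All (Vec Symbol) (funArities σ) → All (const Symbol) (funArities σ) → Exp #vars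
    case₄ ras fas vs = caseVec constTape id (case₅ ras fas vs)

    case₃ : All (Vec Symbol) (relArities σ) → All (Vec Symbol) (funArities σ) → Exp #vars
    case₃ ras fas = caseAll (funArities σ) valueTape (case₄ ras fas)

    case₂ : All (Vec Symbol) (relArities σ) → Exp #vars
    case₂ ras = caseAll (funArities σ) funTapes (case₃ ras)

    caseScanned : Exp #vars
    caseScanned = caseAll (relArities σ) relTapes case₂

  caseStep : (M.State → Step → Exp #vars) → Exp #vars
  caseStep K = caseState λ q → caseScanned λ sc as → K q (M.δ q sc as)

  cell : ∀ {X V C : Set} → Tapes σ M.#work X V C X → TapeIx → X
  cell ts (inj₁ ix)        = lookupIx (Tapes.relAddress ts) ix
  cell ts (inj₂ (inj₁ ix)) = lookupIx (Tapes.funAddress ts) ix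
  cell ts (inj₂ (inj₂ i))  = Vec.lookup (Tapes.work ts) i

  readOnly : ∀ {X Y : Set} → Tapes σ M.#work X Y Y X → Mirror σ → Y
  readOnly ts (inj₁ ix) = lookupConst (Tapes.values ts) ix
  readOnly ts (inj₂ c)  = Vec.lookup (Tapes.consts ts) c

  initially : Var → Exp 0
  initially lenV          = nil
  initially stateV        = constant (stateCode M.q₀)
  initially startedV      = nil
  initially (tapeV ix c)  = nil
  initially (positionV x) = nil

  afterwards : Var → Step → Exp #vars
  afterwards γ             nothing            = variable′ γ
  afterwards lenV          (just (q′ , acts)) = lenᴱ
  afterwards stateV        (just (q′ , acts)) = constant (stateCode q′)
  afterwards startedV      (just (q′ , acts)) = cons true nil
  afterwards (tapeV ix c)  (just (q′ , acts)) = written (tapeVar ix) (cell acts ix) c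
  afterwards (positionV x) (just (q′ , acts)) = moveᴱ (readOnly acts x) (variable′ (positionV x))

  lengthened : Var → Exp #vars
  lengthened lenV                = cons true lenᴱ
  lengthened γ@(inj₁ (inj₂ _))   = variable′ γ
  lengthened γ@(inj₂ _)          = variable′ γ

  stepped : Var → Exp #vars
  stepped γ = caseStep (λ _ → afterwards γ)

  -- While the candidate for ⌈log n⌉ is too small, an iteration lengthens it and leaves the
  -- configuration alone; afterwards each iteration simulates one step.
  updated : Var → Exp #vars
  updated γ = ifᴱ searching (lengthened γ) (stepped γ)

  running : M.State → Step → Bool
  running q st = not (M.final q) ∧ is-just st

  goOnStep goOn acceptance : Exp #vars
  goOnStep   = caseStep λ q st → flagᴱ (running q st)
  goOn       = ifᴱ searching (cons true nil) goOnStep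
  acceptance = caseState λ q → flagᴱ (M.final q)

  length-valueTape : ∀ S ρ {k} (p : funArities σ ∋ k) K {B} → (∀ s → length (eval S (K s) ρ) ≤ B) → length (eval S (valueTape p K) ρ) ≤ B
  length-valueTape S ρ p K h = length-if S (variable′ startedV) (caseCell (valueᴱ p (funNumber p)) (inj₁ (sub p tt)) K) (K blank) ρ (h _) (h blank)

  length-caseStep : ∀ S ρ K {B} → (∀ q st → length (eval S (K q st) ρ) ≤ B) → length (eval S (caseStep K) ρ) ≤ B
  length-caseStep S ρ K h = length-caseFin S (variable′ stateV) ((λ q → caseScanned (K′ q)) ∘ finState) ρ λ i → let k = K′ (finState i) in
    length-caseAll S (relArities σ) relTapes (case₂ k) ρ (λ p K → scans (λ x → tapeVar (inj₁ (sub p x))) K) λ ras →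
    length-caseAll S (funArities σ) funTapes (case₃ k ras) ρ (λ p K → scans (λ x → tapeVar (inj₂ (inj₁ (sub p x)))) K) λ fas →
    length-caseAll S (funArities σ) valueTape (case₄ k ras fas) ρ (λ p K → length-valueTape S ρ p K) λ vs →
    length-caseVec S constTape id (case₅ k ras fas vs) ρ (λ c K h → h _) λ cs →
    length-caseVec S caseScan (λ i → tapeVar (inj₂ (inj₂ i))) (case₆ k ras fas vs cs) ρ (λ tv K → length-caseScan S tv K ρ) λ ws →
    length-caseAll S (relArities σ) answerᴱ (k (mkTapes ras fas vs cs ws)) ρ (λ p K h → h _) λ as → h (finState i) _
    where
    K′ : M.State → Scanned σ M.#work → All (const Bool) (relArities σ) → Exp #vars
    K′ q sc as = K q (M.δ q sc as)
    scans : ∀ {j} (tvs : Fin j → TapeVars #vars) K {B} → (∀ ss → length (eval S (K ss) ρ) ≤ B) → length (eval S (caseVec caseScan tvs K) ρ) ≤ B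
    scans tvs K = length-caseVec S caseScan tvs K ρ (λ tv K → length-caseScan S tv K ρ)

  length-stateCode : ∀ q → length (stateCode q) ≤ #states
  length-stateCode q = ≤-trans (≤-reflexive (length-replicate (toℕ (stateFin q)))) (<⇒≤ (toℕ<n (stateFin q)))

  length-afterwards : ∀ S ρ N → Bounded N ρ → ∀ γ st → length (eval S (afterwards γ st) ρ) ≤ suc #states + N
  length-afterwards S ρ N h γ nothing = ≤-trans (h (to γ)) (m≤n+m N (suc #states))
  length-afterwards S ρ N h lenV (just _) = ≤-trans (h (to lenV)) (m≤n+m N (suc #states))
  length-afterwards S ρ N h stateV (just (q , _)) = ≤-trans (≤-reflexive (cong length (eval-constant S (stateCode q) ρ)))
    (≤-trans (length-stateCode q) (≤-trans (n≤1+n _) (m≤m+n (suc #states) N)))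
  length-afterwards S ρ N h startedV (just _) = s≤s z≤n
  length-afterwards S ρ N h (tapeV ix c) (just (_ , acts)) =
    ≤-trans (length-written S (tapeVar ix) ρ (cell acts ix) N (λ { 0F → h _ ; 1F → h _ ; 2F → h _ }) c) (s≤s (m≤n+m N #states))
  length-afterwards S ρ N h (positionV x) (just (_ , acts)) =
    ≤-trans (length-move S (readOnly acts x) (variable′ (positionV x)) ρ (h _)) (s≤s (m≤n+m N #states))

  length-lengthened : ∀ S ρ N → Bounded N ρ → ∀ γ → length (eval S (lengthened γ) ρ) ≤ suc #states + N
  length-lengthened S ρ N h lenV            = s≤s (≤-trans (h _) (m≤n+m N #states))
  length-lengthened S ρ N h (inj₁ (inj₂ _)) = ≤-trans (h _) (m≤n+m N (suc #states))
  length-lengthened S ρ N h (inj₂ _)        = ≤-trans (h _) (m≤n+m N (suc #states))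

  program : Program
  program = record
    { init     = initially ∘ from
    ; update   = updated ∘ from
    ; growth   = suc #states , λ S ρ N h i → length-if S searching (lengthened (from i)) (stepped (from i)) ρ
        (length-lengthened S ρ N h (from i))
        (length-caseStep S ρ (λ _ → afterwards (from i)) (λ q → length-afterwards S ρ N h (from i)))
    ; continue = goOn
    ; verdict  = acceptance
    }

  module _ (A : Structure σ) where

    open Structure A using () renaming (size to n)

    comp : Computation
    comp = M.computation A

    open Computation comp using (Config; step; accepting; initial)

    -- The length `l` is a parameter so that the invariant also covers the search phase, during
    -- which `c` does not change. `b` decides between the initial blanks and the updated contents of
    -- the value-tapes.
    record Holds (ρ : Env #vars) (l : ℕ) (b : Bool) (c : Config) : Set where
      field
        len≡       : length (ρ (to lenV)) ≡ l
        started≡   : nonempty (ρ (to startedV)) ≡ b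
        state≡     : ρ (to stateV) ≡ stateCode (state c)
        tapes≡     : ∀ ix k → ρ (to (tapeV ix k)) ≡ tapeCode (cell (tapes c) ix) k
        positions≡ : ∀ x → ρ (to (positionV x)) ≡ unary (pos (readOnly (tapes c) x))
        valueCells : ∀ {k} (p : funArities σ ∋ k) → cells (lookupAll (Tapes.values (tapes c)) p) ≡
          (if b then value (lookupAll (functions A) p) (lookupAll (Tapes.funAddress (tapes c)) p) else [])
        constCells : ∀ k → cells (Vec.lookup (Tapes.consts (tapes c)) k) ≡ List.map bit (numeral (Vec.lookup (constantValues σ A) k))
    open Holds

    module Stepping (ρ : Env #vars) (b : Bool) (q : M.State) (ts : Contents σ M.#work) (h : Holds ρ (L A) b (mkConfig q ts)) where

      open Ready A lenᴱ (foundSize lenᴱ) ρ (h .len≡) (val-found A pos-arity lenᴱ ρ (h .len≡))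

      encoded : ∀ ix → Encodes (SA A) ρ (tapeVar ix) (cell ts ix)
      encoded ix = encodes (h .tapes≡ ix 0F) (h .tapes≡ ix 1F) (h .tapes≡ ix 2F)

      val-number : ∀ ix → val (eval (SA A) (numberᴱ ix) ρ) ≡ numberOn (cell ts ix)
      val-number ix = eval-number (SA A) (flagsᵛ (tapeVar ix)) (bitsᵛ (tapeVar ix)) ρ (cells (cell ts ix)) (h .tapes≡ ix 0F) (h .tapes≡ ix 1F)

      relNumbers : ∀ {r} (p : relArities σ ∋ r) → numbers (relNumber p) ≡ Vec.map numberOn (lookupAll (Tapes.relAddress ts) p)
      relNumbers p = vec-ext λ x → trans (lookup∘tabulate (λ x → val (eval (SA A) (relNumber p x) ρ)) x)
        (trans (val-number (inj₁ (sub p x))) (trans (cong numberOn (lookupIx-sub (Tapes.relAddress ts) p x)) (sym (lookup-map x numberOn (lookupAll (Tapes.relAddress ts) p)))))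

      funNumbers : ∀ {r} (p : funArities σ ∋ r) → numbers (funNumber p) ≡ Vec.map numberOn (lookupAll (Tapes.funAddress ts) p)
      funNumbers p = vec-ext λ x → trans (lookup∘tabulate (λ x → val (eval (SA A) (funNumber p x) ρ)) x)
        (trans (val-number (inj₂ (inj₁ (sub p x)))) (trans (cong numberOn (lookupIx-sub (Tapes.funAddress ts) p x)) (sym (lookup-map x numberOn (lookupAll (Tapes.funAddress ts) p)))))

      eval-caseCell : ∀ e x K t xs → eval (SA A) e ρ ≡ xs → cells t ≡ List.map bit xs → readOnly ts x ≡ t →
        eval (SA A) (caseCell e x K) ρ ≡ eval (SA A) (K (scan t)) ρ
      eval-caseCell e x K t xs e≡ cells≡ t≡ = cong (λ s → eval (SA A) (K s) ρ)
        (trans (cong (symbolFrom ∘ List.head) (trans (eval-drop (SA A) (variable′ (positionV x)) e ρ)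
            (cong₂ List.drop (trans (cong length (h .positions≡ x)) (trans (length-replicate (pos (readOnly ts x))) (cong pos t≡))) e≡)))
          (trans (symbolFrom-at xs (pos t)) (cong (λ cs → symbolAt cs (pos t)) (sym cells≡))))

      eval-answer : ∀ {r} (p : relArities σ ∋ r) K → eval (SA A) (answerᴱ p K) ρ ≡
        eval (SA A) (K (lookupAll (M.answerQueries A (Tapes.relAddress ts)) p)) ρ
      eval-answer p K = cong (λ z → eval (SA A) (K z) ρ) (trans (eval-relation p (relNumber p))
        (trans (cong (λ ns → maybe′ (lookupAll (relations A) p) false (elements n ns)) (relNumbers p))
          (sym (lookupAll-zipWith (uncurry query) (relations A) (Tapes.relAddress ts) p))))

      eval-constTape : ∀ c K → eval (SA A) (constTape c K) ρ ≡ eval (SA A) (K (Vec.lookup (Vec.map scan (Tapes.consts ts)) c)) ρ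
      eval-constTape c K = trans (eval-caseCell (constantᴱ c) (inj₂ c) K (Vec.lookup (Tapes.consts ts) c) _ (eval-constant-value c) (h .constCells c) refl)
        (cong (λ s → eval (SA A) (K s) ρ) (sym (lookup-map c scan (Tapes.consts ts))))

      value≡ : ∀ {r} (p : funArities σ ∋ r) → value (lookupAll (functions A) p) (lookupAll (Tapes.funAddress ts) p) ≡
        List.map bit (maybe′ (λ as → numeral (toℕ (lookupAll (functions A) p as))) [] (elements n (numbers (funNumber p))))
      value≡ p = trans (go (elements n (Vec.map numberOn (lookupAll (Tapes.funAddress ts) p))))
        (cong (λ ns → List.map bit (maybe′ (λ as → numeral (toℕ (lookupAll (functions A) p as))) [] (elements n ns))) (sym (funNumbers p)))
        where
        go : ∀ as → maybe′ (λ as → List.map bit (numeral (toℕ (lookupAll (functions A) p as)))) [] as ≡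
          List.map bit (maybe′ (λ as → numeral (toℕ (lookupAll (functions A) p as))) [] as)
        go (just _) = refl
        go nothing  = refl

      eval-valueTape : ∀ {r} (p : funArities σ ∋ r) K → eval (SA A) (valueTape p K) ρ ≡
        eval (SA A) (K (lookupAll (All.map scan (Tapes.values ts)) p)) ρ
      eval-valueTape p K = trans (go b refl) (cong (λ s → eval (SA A) (K s) ρ) (sym (lookupAll-map scan (Tapes.values ts) p)))
        where
        t = lookupAll (Tapes.values ts) p
        C = caseCell (valueᴱ p (funNumber p)) (inj₁ (sub p tt)) K
        go : ∀ b′ → b ≡ b′ → eval (SA A) (valueTape p K) ρ ≡ eval (SA A) (K (scan t)) ρ
        go false eq = trans (eval-if-false (SA A) (variable′ startedV) C (K blank) ρ (trans (h .started≡) eq))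
          (cong (λ cs → eval (SA A) (K (symbolAt cs (pos t))) ρ) (sym (trans (h .valueCells p) (cong (λ b → if b then value (lookupAll (functions A) p) (lookupAll (Tapes.funAddress ts) p) else []) eq))))
        go true  eq = trans (eval-if-true (SA A) (variable′ startedV) C (K blank) ρ (trans (h .started≡) eq))
          (eval-caseCell (valueᴱ p (funNumber p)) (inj₁ (sub p tt)) K t _ (eval-value p (funNumber p))
            (trans (h .valueCells p) (trans (cong (λ b → if b then value (lookupAll (functions A) p) (lookupAll (Tapes.funAddress ts) p) else []) eq) (value≡ p)))
            (lookupConst-sub (Tapes.values ts) p))

      eval-scans : ∀ {j} (ixs : Fin j → TapeIx) (vs : Vec Tape j) K → (∀ i → cell ts (ixs i) ≡ Vec.lookup vs i) →
        eval (SA A) (caseVec caseScan (tapeVar ∘ ixs) K) ρ ≡ eval (SA A) (K (Vec.map scan vs)) ρ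
      eval-scans ixs vs K eq = eval-caseVec (SA A) caseScan (tapeVar ∘ ixs) K ρ (Vec.map scan vs) λ i K →
        trans (eval-caseScan (SA A) (tapeVar (ixs i)) K ρ (cell ts (ixs i)) (encoded (ixs i)))
          (cong (λ s → eval (SA A) (K s) ρ) (trans (cong scan (eq i)) (sym (lookup-map i scan vs))))

      scanned : Scanned σ M.#work
      scanned = M.scanAll ts

      answers′ : All (const Bool) (relArities σ)
      answers′ = M.answerQueries A (Tapes.relAddress ts)

      eval-caseScanned : ∀ K → eval (SA A) (caseScanned K) ρ ≡ eval (SA A) (K scanned answers′) ρ
      eval-caseScanned K =
        trans (eval-caseAll (SA A) (relArities σ) relTapes (case₂ K) ρ ras λ p K →
            trans (eval-scans (λ x → inj₁ (sub p x)) (lookupAll (Tapes.relAddress ts) p) K (λ x → lookupIx-sub (Tapes.relAddress ts) p x))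
              (cong (λ z → eval (SA A) (K z) ρ) (sym (lookupAll-map (Vec.map scan) (Tapes.relAddress ts) p))))
          (trans (eval-caseAll (SA A) (funArities σ) funTapes (case₃ K ras) ρ fas λ p K →
            trans (eval-scans (λ x → inj₂ (inj₁ (sub p x))) (lookupAll (Tapes.funAddress ts) p) K (λ x → lookupIx-sub (Tapes.funAddress ts) p x))
              (cong (λ z → eval (SA A) (K z) ρ) (sym (lookupAll-map (Vec.map scan) (Tapes.funAddress ts) p))))
          (trans (eval-caseAll (SA A) (funArities σ) valueTape (case₄ K ras fas) ρ vs eval-valueTape)
          (trans (eval-caseVec (SA A) constTape id (case₅ K ras fas vs) ρ cs eval-constTape)
          (trans (eval-scans (λ i → inj₂ (inj₂ i)) (Tapes.work ts) (case₆ K ras fas vs cs) (λ _ → refl))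
            (eval-caseAll (SA A) (relArities σ) answerᴱ (K scanned) ρ answers′ eval-answer)))))
        where
        ras = All.map (Vec.map scan) (Tapes.relAddress ts)
        fas = All.map (Vec.map scan) (Tapes.funAddress ts)
        vs  = All.map scan (Tapes.values ts)
        cs  = Vec.map scan (Tapes.consts ts)

      eval-caseState : ∀ K → eval (SA A) (caseState K) ρ ≡ eval (SA A) (K q) ρ
      eval-caseState K = trans (eval-caseFin (SA A) (variable′ stateV) (K ∘ finState) ρ (stateFin q) (h .state≡))
        (cong (λ q → eval (SA A) (K q) ρ) (Inverse.strictlyInverseʳ (proj₂ M.finite) q))

      next : Step
      next = M.δ q scanned answers′

      eval-caseStep : ∀ K → eval (SA A) (caseStep K) ρ ≡ eval (SA A) (K q next) ρ
      eval-caseStep K = trans (eval-caseState (λ q → caseScanned λ sc as → K q (M.δ q sc as))) (eval-caseScanned (λ sc as → K q (M.δ q sc as)))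

      not-searching : nonempty (eval (SA A) searching ρ) ≡ false
      not-searching = trans (eval-searching A pos-arity lenᴱ ρ) (<ᵇ-false (≤-reflexive (sym (h .len≡))))

      eval-goOn : eval (SA A) goOn ρ ≡ flagList (running q next)
      eval-goOn = trans (eval-if-false (SA A) searching (cons true nil) goOnStep ρ not-searching)
        (trans (eval-caseStep (λ q st → flagᴱ (running q st))) (eval-flag (SA A) (running q next) ρ))

      eval-acceptance : nonempty (eval (SA A) acceptance ρ) ≡ M.final q
      eval-acceptance = trans (cong nonempty (trans (eval-caseState (λ q → flagᴱ (M.final q))) (eval-flag (SA A) (M.final q) ρ))) (nonempty-flagList (M.final q))

      ρ⁺ : Env #vars
      ρ⁺ = evals (SA A) (updated ∘ from) ρ

      eval-updated : ∀ γ → ρ⁺ (to γ) ≡ eval (SA A) (afterwards γ next) ρ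
      eval-updated γ = trans (cong (λ γ → eval (SA A) (updated γ) ρ) (strictlyInverseʳ γ))
        (trans (eval-if-false (SA A) searching (lengthened γ) (stepped γ) ρ not-searching) (eval-caseStep (λ _ → afterwards γ)))

      module _ (q′ : M.State) (acts : Action σ M.#work) (next≡ : next ≡ just (q′ , acts)) where

        ts′ : Contents σ M.#work
        ts′ = M.updateValues A (M.actAll ts acts)

        after : ∀ γ → ρ⁺ (to γ) ≡ eval (SA A) (afterwards γ (just (q′ , acts))) ρ
        after γ = trans (eval-updated γ) (cong (λ st → eval (SA A) (afterwards γ st) ρ) next≡)

        cell-after : ∀ ix → cell ts′ ix ≡ writeMove (cell ts ix) (cell acts ix)
        cell-after (inj₁ ix)        = lookupIx-zipWith writeMove (Tapes.relAddress ts) (Tapes.relAddress acts) ix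
        cell-after (inj₂ (inj₁ ix)) = lookupIx-zipWith writeMove (Tapes.funAddress ts) (Tapes.funAddress acts) ix
        cell-after (inj₂ (inj₂ i))  = lookup-zipWith writeMove i (Tapes.work ts) (Tapes.work acts)

        newCells : All (const (List Symbol)) (funArities σ)
        newCells = All.zipWith (uncurry value) (functions A , Tapes.funAddress ts′)

        moved : All (const Tape) (funArities σ)
        moved = All.zipWith (uncurry moveOn) (Tapes.values ts , Tapes.values acts)

        position-after : ∀ x → pos (readOnly ts′ x) ≡ moveHead (readOnly acts x) (pos (readOnly ts x))
        position-after (inj₁ ix) = trans (cong pos (lookupConst-zipWith (λ v xs → mkTape xs (pos v)) moved newCells ix))
          (cong pos (lookupConst-zipWith moveOn (Tapes.values ts) (Tapes.values acts) ix))
        position-after (inj₂ c)  = cong pos (lookup-zipWith moveOn c (Tapes.consts ts) (Tapes.consts acts))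

        holds-after : Holds ρ⁺ (L A) true (mkConfig q′ ts′)
        holds-after .len≡ = trans (cong length (after lenV)) (h .len≡)
        holds-after .started≡ = cong nonempty (after startedV)
        holds-after .state≡ = trans (after stateV) (eval-constant (SA A) (stateCode q′) ρ)
        holds-after .tapes≡ ix k = trans (after (tapeV ix k)) (trans (eval-written (SA A) (tapeVar ix) ρ (cell ts ix) (cell acts ix) (encoded ix) k)
          (cong (λ t → tapeCode t k) (sym (cell-after ix))))
        holds-after .positions≡ x = trans (after (positionV x)) (trans (eval-move (SA A) (readOnly acts x) (variable′ (positionV x)) ρ _ (h .positions≡ x))
          (cong unary (sym (position-after x))))
        holds-after .valueCells p = trans (cong cells (lookupAll-zipWith (λ (v , xs) → mkTape xs (pos v)) moved newCells p))
          (lookupAll-zipWith (uncurry value) (functions A) (Tapes.funAddress ts′) p)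
        holds-after .constCells c = trans (cong cells (lookup-zipWith moveOn c (Tapes.consts ts) (Tapes.consts acts))) (h .constCells c)

    simulate : ∀ {c t b} → Outcome comp c t b → ∀ ρ started → Holds ρ (L A) started c →
      ∃[ ρ′ ] Runs program (SA A) ρ t ρ′ × nonempty (eval (SA A) acceptance ρ′) ≡ b
    simulate {mkConfig q ts} (accepts acc) ρ started h = ρ ,
      done (trans eval-goOn (cong (λ f → flagList (not f ∧ is-just next)) acc)) , trans eval-acceptance acc
      where open Stepping ρ started q ts h
    simulate {mkConfig q ts} (rejects rej stuck) ρ started h = ρ ,
      done (trans eval-goOn (cong₂ (λ f j → flagList (not f ∧ j)) rej (halted next stuck))) , trans eval-acceptance rej
      where
      open Stepping ρ started q ts h
      halted : ∀ nx → (nx >>= λ (q′ , acts) → just (mkConfig q′ (M.updateValues A (M.actAll ts acts)))) ≡ nothing → is-just nx ≡ false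
      halted nothing  _ = refl
      halted (just _) ()
    simulate {mkConfig q ts} (steps rej st o) ρ started h = go next refl st o
      where
      open Stepping ρ started q ts h
      go : ∀ nx {c′ t b} → next ≡ nx → (nx >>= λ (q′ , acts) → just (mkConfig q′ (M.updateValues A (M.actAll ts acts)))) ≡ just c′ →
        Outcome comp c′ t b → ∃[ ρ′ ] Runs program (SA A) ρ (suc t) ρ′ × nonempty (eval (SA A) acceptance ρ′) ≡ b
      go (just (q′ , acts)) eq refl o =
        let ρ′ , runs , v = simulate o ρ⁺ true (holds-after q′ acts eq) in
        ρ′ , more (trans eval-goOn (cong₂ (λ f nx → flagList (not f ∧ is-just nx)) rej eq)) runs , v

    -- Each iteration increments the candidate for ⌈log₂ size A ⌉ until it is reached.
    search-phase : ∀ {c t b} → Outcome comp c t b → ∀ d l ρ started → d + l ≡ L A → Holds ρ l started c →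
      ∃[ ρ′ ] Runs program (SA A) ρ (d + t) ρ′ × nonempty (eval (SA A) acceptance ρ′) ≡ b
    search-phase o zero    l ρ started refl h = simulate o ρ started h
    search-phase {c} o (suc d) l ρ started eq h =
      let ρ′ , runs , v = search-phase o d (suc l) ρ⁺ started (trans (+-suc d l) eq) h⁺ in
      ρ′ , more (eval-if-true (SA A) searching (cons true nil) goOnStep ρ still) runs , v
      where
      ρ⁺ : Env #vars
      ρ⁺ = evals (SA A) (updated ∘ from) ρ
      still : nonempty (eval (SA A) searching ρ) ≡ true
      still = trans (eval-searching A pos-arity lenᴱ ρ) (<ᵇ-true (subst (_< L A) (sym (h .len≡)) (subst (l <_) eq (s≤s (m≤n+m l d)))))
      after : ∀ γ → ρ⁺ (to γ) ≡ eval (SA A) (lengthened γ) ρ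
      after γ = trans (cong (λ γ → eval (SA A) (updated γ) ρ) (strictlyInverseʳ γ))
        (eval-if-true (SA A) searching (lengthened γ) (stepped γ) ρ still)
      h⁺ : Holds ρ⁺ (suc l) started c
      h⁺ .len≡ = trans (cong length (after lenV)) (cong suc (h .len≡))
      h⁺ .started≡ = trans (cong nonempty (after startedV)) (h .started≡)
      h⁺ .state≡ = trans (after stateV) (h .state≡)
      h⁺ .tapes≡ ix k = trans (after (tapeV ix k)) (h .tapes≡ ix k)
      h⁺ .positions≡ x = trans (after (positionV x)) (h .positions≡ x)
      h⁺ .valueCells = h .valueCells
      h⁺ .constCells = h .constCells

    at-start : ∀ γ → evals (SA A) (initially ∘ from) (λ ()) (to γ) ≡ eval (SA A) (initially γ) (λ ())
    at-start γ = cong (λ γ → eval (SA A) (initially γ) (λ ())) (strictlyInverseʳ γ)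

    initial-cell : ∀ ix → cell (M.initialTapes A) ix ≡ blankTape
    initial-cell (inj₁ ix)        = lookupIx-blank blankTape (relArities σ) ix
    initial-cell (inj₂ (inj₁ ix)) = lookupIx-blank blankTape (funArities σ) ix
    initial-cell (inj₂ (inj₂ i))  = lookup-replicate i blankTape

    initial-position : ∀ x → pos (readOnly (M.initialTapes A) x) ≡ 0
    initial-position (inj₁ ix) = cong pos (lookupConst-universal blankTape (funArities σ) ix)
    initial-position (inj₂ c)  = cong pos (lookup-map c (tapeOf ∘ numeral) (constantValues σ A))

    initial-holds : Holds (evals (SA A) (initially ∘ from) (λ ())) 0 false initial
    initial-holds .len≡ = cong length (at-start lenV)
    initial-holds .started≡ = cong nonempty (at-start startedV)
    initial-holds .state≡ = trans (at-start stateV) (eval-constant (SA A) (stateCode M.q₀) (λ ()))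
    initial-holds .tapes≡ ix k = trans (at-start (tapeV ix k)) (trans (blanks k) (cong (λ t → tapeCode t k) (sym (initial-cell ix))))
      where
      blanks : ∀ k → [] ≡ tapeCode blankTape k
      blanks 0F = refl
      blanks 1F = refl
      blanks 2F = refl
    initial-holds .positions≡ x = trans (at-start (positionV x)) (cong unary (sym (initial-position x)))
    initial-holds .valueCells p = cong cells (lookupAll-universal (λ _ → blankTape) (funArities σ) p)
    initial-holds .constCells c = cong cells (lookup-map c (tapeOf ∘ numeral) (constantValues σ A))

    initial-bounded : Bounded #states (evals (SA A) (initially ∘ from) (λ ()))
    initial-bounded i = go (from i)
      where
      go : ∀ γ → length (eval (SA A) (initially γ) (λ ())) ≤ #states
      go lenV          = z≤n
      go stateV        = ≤-trans (≤-reflexive (cong length (eval-constant (SA A) (stateCode M.q₀) (λ ())))) (length-stateCode M.q₀)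
      go startedV      = z≤n
      go (tapeV _ _)   = z≤n
      go (positionV _) = z≤n

-- From exponents to polylogarithmic bounds

⌈log₂⌉≤id : ∀ n → ⌈log₂ n ⌉ ≤ n
⌈log₂⌉≤id n = ⌈log₂⌉≤ (n≤2^n n)
  where
  n≤2^n : ∀ n → n ≤ 2 ^ n
  n≤2^n n = unpow (Powers.const⊑ 2 ≤-refl n)

⌊log₂⌋≤⌈log₂⌉ : ∀ n → ⌊log₂ n ⌋ ≤ ⌈log₂ n ⌉
⌊log₂⌋≤⌈log₂⌉ n = ≤-trans (⌊log₂⌋-mono-≤ (≤2^⌈log₂⌉ n)) (≤-reflexive (⌊log₂[2^n]⌋≡n ⌈log₂ n ⌉))

power⊑ : ∀ {N x a} k → Pow≤ N x a → Pow≤ N (x ^ k) (a * k)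
power⊑ {N} {x} {a} k (pow x≤) = pow (≤-trans (^-monoˡ-≤ k x≤) (≤-reflexive (^-*-assoc N a k)))

-- The calculus of powers needs a base of at least 2, while a logarithm may be 1. So estimates are
-- made in base `suc l`, which is at most 2 l.
rebase : ∀ {l x a} → 1 ≤ l → Pow≤ (suc l) x a → x ≤ 2 ^ a * l ^ a
rebase {l} {x} {a} 1≤l (pow x≤) = ≤-trans x≤ (≤-trans (^-monoˡ-≤ a (≤-trans (+-monoˡ-≤ l 1≤l) (≤-reflexive (cong (l +_) (sym (+-identityʳ l))))))
  (≤-reflexive (^-distribʳ-* 2 l a)))
  where
  ^-distribʳ-* : ∀ m n o → (m * n) ^ o ≡ m ^ o * n ^ o
  ^-distribʳ-* m n zero    = refl
  ^-distribʳ-* m n (suc o) = trans (cong (m * n *_) (^-distribʳ-* m n o)) (arith m n (m ^ o) (n ^ o))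
    where
    arith : ∀ a b c d → a * b * (c * d) ≡ a * c * (b * d)
    arith = solve-∀

-- Bounds the data of a program that makes T iterations.
capacity : (g N₀ T extra : ℕ) → ℕ
capacity g N₀ T extra = (T * g + N₀) + (2 + (T + extra))

-- The exponent that the rules of `Powers` assign to `3 + capacity g N₀ T extra ^ d`, where `a` and
-- `b` are those of `T` and `extra`. The 3 is the overhead in `machine-path`.
simulationDeg : (g N₀ d a b : ℕ) → ℕ
simulationDeg g N₀ d a b = suc (3 + suc (suc (a + g + N₀) + suc (2 + suc (a + b))) * d)

simulation-time : ∀ {l} g N₀ d {T extra a b} → 1 ≤ l → Pow≤ (suc l) T a → Pow≤ (suc l) extra b →
  3 + capacity g N₀ T extra ^ d ≤ 2 ^ simulationDeg g N₀ d a b * l ^ simulationDeg g N₀ d a b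
simulation-time {l} g N₀ d 1≤l T⊑ e⊑ = rebase 1≤l
  (+⊑ (const⊑ 3) (power⊑ d (+⊑ (+⊑ (*⊑ T⊑ (const⊑ g)) (const⊑ N₀)) (+⊑ (const⊑ 2) (+⊑ T⊑ e⊑)))))
  where open Powers (suc l) (s≤s 1≤l)

module _ {ℓ} {σ : Vocabulary} (run : Structure σ → Computation) (measure : Structure σ → ℕ) (C : Pred (Structure σ) ℓ) where

  -- The form in which decidability is transferred: the verdict `b` and its relation to `C` stay,
  -- and only the outcome and its time are replaced.
  Decided : ℕ → ℕ → ℕ → Structure σ → Set ℓ
  Decided k c n₀ A = ∃[ t ] ∃[ b ] Outcome (run A) (Computation.initial (run A)) t b × (C A ⇔ T b) ×
    (n₀ ≤ measure A → t ≤ c * ⌈log₂ measure A ⌉ ^ k)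

  fromDecides : DecidesInPolylog run measure C → ∃[ k ] ∃[ c ] ∃[ n₀ ] ∀ A → Decided k c n₀ A
  fromDecides (correct , k , c , n₀ , bound) = k , c , n₀ , λ A →
    let t , t≤ , end = bound A
        t′ , b , t′≤ , o = outcome-begin (run A) end
        acc = accepts⇔ (run A) o
    in t′ , b , o ,
       mk⇔ (Equivalence.to acc ∘ Equivalence.from (correct A)) (Equivalence.to (correct A) ∘ Equivalence.from acc) ,
       (λ n₀≤ → ≤-trans t′≤ (t≤ n₀≤))

  toDecides : (∃[ k ] ∃[ c ] ∃[ n₀ ] ∀ A → Decided k c n₀ A) → DecidesInPolylog run measure C
  toDecides (k , c , n₀ , decided) = correct , k , c , n₀ , λ A →
      let t , b , o , _ , t≤ = decided A in t , t≤ , outcome-end (run A) o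
    where
    correct : ∀ A → Computation.Accepts (run A) ⇔ C A
    correct A = let t , b , o , CA⇔ , _ = decided A
                    acc = accepts⇔ (run A) o
      in mk⇔ (Equivalence.from CA⇔ ∘ Equivalence.to acc) (Equivalence.from acc ∘ Equivalence.to CA⇔)

module _ {σ : Vocabulary} (pos-arity : HasPositiveArity σ) where

  -- One half of the comparison of the two measures. A structure of size 1 can have the empty
  -- encoding, if there are only function symbols, as ⌈log 1⌉ = 0.
  size≤length-bin : ∀ (A : Structure σ) → 2 ≤ size A → size A ≤ length (bin A)
  size≤length-bin A 2≤n = ≤-trans (≤codeLength {σ} pos-arity (<⌈log₂⌉ {size A} {0} 2≤n)) (≤-reflexive (sym (length-bin A)))

  sumPowersDeg : List ℕ → ℕ
  sumPowersDeg []       = 0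
  sumPowersDeg (r ∷ rs) = suc (r + sumPowersDeg rs)

  binDeg : ℕ
  binDeg = suc (sumPowersDeg (relArities σ) + suc (sumPowersDeg (allFunArities {σ})))

  -- The other half: the length of the encoding is polynomial in the size, so its logarithm is
  -- larger by a constant factor at most.
  log-length-bin : ∀ (A : Structure σ) → 2 ≤ size A → ⌈log₂ length (bin A) ⌉ ≤ ⌈log₂ size A ⌉ * binDeg
  log-length-bin A 2≤n = ⌈log₂⌉≤ (≤-trans (≤-reflexive (length-bin A)) (≤-trans (unpow codeLength⊑)
      (≤-trans (^-monoˡ-≤ binDeg (≤2^⌈log₂⌉ n)) (≤-reflexive (^-*-assoc 2 ⌈log₂ n ⌉ binDeg)))))
    where
    n = size A
    open Powers n 2≤n
    sumPowers⊑ : ∀ rs → sumPowers rs n ⊑ sumPowersDeg rs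
    sumPowers⊑ []       = pow z≤n
    sumPowers⊑ (r ∷ rs) = +⊑ (pow {a = r} ≤-refl) (sumPowers⊑ rs)
    codeLength⊑ : codeLength {σ} ⌈log₂ n ⌉ n ⊑ binDeg
    codeLength⊑ = +⊑ (sumPowers⊑ (relArities σ)) (*⊑ (≤⊑ (⌈log₂⌉≤id n) base⊑) (sumPowers⊑ (allFunArities {σ})))

  module ToDirect (command : Commands.Cmd (daSignature σ)) (M : RandomAccessTM) (g N₀ d : ℕ)
    (execution : ∀ A {t b} → Outcome (RandomAccessTM.computation M (bin A)) (Computation.initial (RandomAccessTM.computation M (bin A))) t b →
      ∃[ u ] Commands.Exec (daSignature σ) (daStreams σ A) command (λ _ → []) u (capacity g N₀ t ⌈log₂ size A ⌉ ^ d) × nonempty (u (Commands.local 1)) ≡ b)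
    where

    open DirectAccess σ command using (machine; outcome)

    transfer : ∀ A {t b} → Outcome (RandomAccessTM.computation M (bin A)) (Computation.initial (RandomAccessTM.computation M (bin A))) t b →
      ∃[ t′ ] t′ ≤ 3 + capacity g N₀ t ⌈log₂ size A ⌉ ^ d ×
      Outcome (DirectAccessTM.computation machine A) (Computation.initial (DirectAccessTM.computation machine A)) t′ b
    transfer A o with execution A o
    ... | u , ex , refl = outcome A ex

    decides : ∀ {ℓ} (C : Pred (Structure σ) ℓ) → DecidesInPolylog (λ A → RandomAccessTM.computation M (bin A)) (λ A → length (bin A)) C →
      DecidesInPolylog (DirectAccessTM.computation machine) size C
    decides C dec = let k , c , n₀ , decided = fromDecides _ _ C dec in
      toDecides _ _ C (deg k c , 2 ^ deg k c , n₀ ⊔ 2 , λ A →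
        let t , b , o , C⇔ , t≤ = decided A
            t′ , t′≤ , o′ = transfer A o
        in t′ , b , o′ , C⇔ , λ n₀≤ → ≤-trans t′≤ (time k c n₀ A t≤ n₀≤))
      where
      a deg : ℕ → ℕ → ℕ
      -- The exponent of c (⌈log n⌉ binDeg) ^ k, to which the time of the simulated machine is
      -- estimated in terms of n.
      a k c = c + (1 + binDeg) * k
      deg k c = simulationDeg g N₀ d (a k c) 1
      time : ∀ k c n₀ A {t} → (n₀ ≤ length (bin A) → t ≤ c * ⌈log₂ length (bin A) ⌉ ^ k) → n₀ ⊔ 2 ≤ size A →
        3 + capacity g N₀ t ⌈log₂ size A ⌉ ^ d ≤ 2 ^ deg k c * ⌈log₂ size A ⌉ ^ deg k c
      time k c n₀ A t≤ n₀≤ = simulation-time g N₀ d 1≤L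
          (≤⊑ (t≤ (≤-trans (m≤m⊔n n₀ 2) (≤-trans n₀≤ (size≤length-bin A 2≤n))))
            (*⊑ (const⊑ c) (power⊑ k (≤⊑ (log-length-bin A 2≤n) (*⊑ L⊑ (const⊑ binDeg))))))
          L⊑
        where
        2≤n : 2 ≤ size A
        2≤n = ≤-trans (m≤n⊔m n₀ 2) n₀≤
        1≤L : 1 ≤ ⌈log₂ size A ⌉
        1≤L = <⌈log₂⌉ {size A} {0} 2≤n
        open Powers (suc ⌈log₂ size A ⌉) (s≤s 1≤L)
        L⊑ : ⌈log₂ size A ⌉ ⊑ 1
        L⊑ = ≤⊑ (n≤1+n _) base⊑

    polylog : ∀ {ℓ} (C : Pred (Structure σ) ℓ) → DecidesInPolylog (λ A → RandomAccessTM.computation M (bin A)) (λ A → length (bin A)) C → DirectAccessPolylog σ C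
    polylog C dec = machine , decides C dec

  module ToRandom (command : Commands.Cmd raSignature) (M : DirectAccessTM σ) (g N₀ d : ℕ)
    (execution : ∀ A {t b} → Outcome (DirectAccessTM.computation M A) (Computation.initial (DirectAccessTM.computation M A)) t b →
      ∃[ u ] Commands.Exec raSignature (raStreams (bin A)) command (λ _ → []) u (capacity g N₀ (⌈log₂ size A ⌉ + t) 0 ^ d) × nonempty (u (Commands.local 1)) ≡ b)
    where

    open RandomAccess command using (machine; outcome)

    transfer : ∀ A {t b} → Outcome (DirectAccessTM.computation M A) (Computation.initial (DirectAccessTM.computation M A)) t b →
      ∃[ t′ ] t′ ≤ 3 + capacity g N₀ (⌈log₂ size A ⌉ + t) 0 ^ d ×
      Outcome (RandomAccessTM.computation machine (bin A)) (Computation.initial (RandomAccessTM.computation machine (bin A))) t′ b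
    transfer A o with execution A o
    ... | u , ex , refl = outcome (bin A) ex

    decides : ∀ {ℓ} (C : Pred (Structure σ) ℓ) → DecidesInPolylog (DirectAccessTM.computation M) size C →
      DecidesInPolylog (λ A → RandomAccessTM.computation machine (bin A)) (λ A → length (bin A)) C
    decides C dec = let k , c , n₀ , decided = fromDecides _ _ C dec in
      -- By monotonicity of `codeLength`, an encoding beyond this threshold belongs to a structure
      -- of size at least `n₀ ⊔ 2`.
      toDecides _ _ C (deg k c , 2 ^ deg k c , suc (codeLength {σ} ⌈log₂ n₀ ⊔ 2 ⌉ (n₀ ⊔ 2)) , λ A →
        let t , b , o , C⇔ , t≤ = decided A
            t′ , t′≤ , o′ = transfer A o
        in t′ , b , o′ , C⇔ , λ n₀≤ → ≤-trans t′≤ (time k c n₀ A t≤ n₀≤))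
      where
      a deg : ℕ → ℕ → ℕ
      -- The exponent for the number of iterations: ⌈log n⌉ of them for the search, and c ⌈log n⌉ ^
      -- k for the steps.
      a k c = suc (1 + (c + 1 * k))
      deg k c = simulationDeg g N₀ d (a k c) 0
      time : ∀ k c n₀ A {t} → (n₀ ≤ size A → t ≤ c * ⌈log₂ size A ⌉ ^ k) →
        suc (codeLength {σ} ⌈log₂ n₀ ⊔ 2 ⌉ (n₀ ⊔ 2)) ≤ length (bin A) →
        3 + capacity g N₀ (⌈log₂ size A ⌉ + t) 0 ^ d ≤ 2 ^ deg k c * ⌈log₂ length (bin A) ⌉ ^ deg k c
      time k c n₀ A t≤ n₀≤ = simulation-time g N₀ d 1≤Λ
          (+⊑ L⊑ (≤⊑ (t≤ (≤-trans (m≤m⊔n n₀ 2) large)) (*⊑ (const⊑ c) (power⊑ k L⊑)))) (pow z≤n)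
        where
        large : n₀ ⊔ 2 ≤ size A
        large = ≮⇒≥ λ small → <⇒≱ n₀≤ (≤-trans (≤-reflexive (length-bin A)) (codeLength-mono {σ} (⌈log₂⌉-mono-≤ (<⇒≤ small)) (<⇒≤ small)))
        2≤n : 2 ≤ size A
        2≤n = ≤-trans (m≤n⊔m n₀ 2) large
        L≤Λ : ⌈log₂ size A ⌉ ≤ ⌈log₂ length (bin A) ⌉
        L≤Λ = ⌈log₂⌉-mono-≤ (size≤length-bin A 2≤n)
        1≤Λ : 1 ≤ ⌈log₂ length (bin A) ⌉
        1≤Λ = ≤-trans (<⌈log₂⌉ {size A} {0} 2≤n) L≤Λ
        open Powers (suc ⌈log₂ length (bin A) ⌉) (s≤s 1≤Λ)
        L⊑ : ⌈log₂ size A ⌉ ⊑ 1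
        L⊑ = ≤⊑ (m≤n⇒m≤1+n L≤Λ) base⊑

    polylog : ∀ {ℓ} (C : Pred (Structure σ) ℓ) → DecidesInPolylog (DirectAccessTM.computation M) size C → RandomAccessPolylog σ C
    polylog C dec = machine , decides C dec

  -- The two directions put together

  module RandomToDirect (M : RandomAccessTM) where

    open SimulateRA σ M using (program; initBound; initial-bounded; initial-holds; simulate; SA)
    open Commands (daSignature σ) using (runProgram; runProgram-exec; programDeg; Exec; local)
    open Commands.Program program using (growth; init)
    g : ℕ
    g = proj₁ growth

    -- The successor is due to the size itself, whose numeral has ⌈log n⌉ + 1 bits if n is a power
    -- of two.
    answers≤ : ∀ A o xs → length (SA A o xs) ≤ suc ⌈log₂ size A ⌉
    answers≤ A o xs = ≤-trans (≤-reflexive (length-reverse (daStreams σ A o xs))) (go o xs)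
      where
      length-numeral : ∀ m → m ≤ size A → length (numeral m) ≤ suc ⌈log₂ size A ⌉
      length-numeral m m≤ = ≤-trans (≤-reflexive (length-toBits (suc ⌊log₂ m ⌋) m))
        (s≤s (≤-trans (⌊log₂⌋-mono-≤ m≤) (⌊log₂⌋≤⌈log₂⌉ (size A))))
      go : ∀ o xs → length (daStreams σ A o xs) ≤ suc ⌈log₂ size A ⌉
      go (relationOf p) xs = s≤s z≤n
      go (functionOf p) xs with elements (size A) (Vec.map (argument σ) xs)
      ... | just as = length-numeral _ (<⇒≤ (toℕ<n (lookupAll (functions A) p as)))
      ... | nothing = z≤n
      go (constantOf zero)    xs = length-numeral (size A) ≤-refl
      go (constantOf (suc c)) xs = length-numeral _ (≤-trans (≤-reflexive (lookup-map c toℕ (constants A))) (<⇒≤ (toℕ<n (Vec.lookup (constants A) c))))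

    execution : ∀ A {t b} → Outcome (RandomAccessTM.computation M (bin A)) (Computation.initial (RandomAccessTM.computation M (bin A))) t b →
      ∃[ u ] Exec (daStreams σ A) (runProgram program) (λ _ → []) u (capacity g initBound t ⌈log₂ size A ⌉ ^ programDeg program) ×
      nonempty (u (local 1)) ≡ b
    execution A {t} {b} o =
      let ρ , runs , v = simulate A o (Language.evals _ _ (SA A) init (λ ())) (initial-holds A)
          u , ex , res = runProgram-exec program (daStreams σ A) (daSingle σ A) bounding {t} {ρ} runs initBound (initial-bounded A) (m≤m+n _ _)
            (≤-trans (≤-trans (m≤m+n t L) (m≤n+m _ 2)) (m≤n+m _ (t * g + initBound)))
      in u , ex , trans (cong nonempty res) v
      where
      L = ⌈log₂ size A ⌉
      bounding : Language.Bounding (Query σ) (queryArity σ) (SA A) (capacity g initBound t L)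
      bounding = record
        { 2≤N = ≤-trans (m≤m+n 2 (t + L)) (m≤n+m _ (t * g + initBound))
        ; answers = λ o xs → ≤-trans (answers≤ A o xs) (≤-trans (s≤s (≤-trans (m≤n+m L t) (n≤1+n _))) (m≤n+m _ (t * g + initBound))) }

    polylog : ∀ {ℓ} (C : Pred (Structure σ) ℓ) → DecidesInPolylog (λ A → RandomAccessTM.computation M (bin A)) (λ A → length (bin A)) C → DirectAccessPolylog σ C
    polylog = ToDirect.polylog (runProgram program) M g initBound (programDeg program) execution

  module DirectToRandom (M : DirectAccessTM σ) where

    open SimulateDA σ pos-arity M using (program; #states; initial-bounded; initial-holds; search-phase)
    open ReadStructure σ using (SA)
    open Commands raSignature using (runProgram; runProgram-exec; programDeg; Exec; local)
    open Commands.Program program using (growth; init)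
    g : ℕ
    g = proj₁ growth

    execution : ∀ A {t b} → Outcome (DirectAccessTM.computation M A) (Computation.initial (DirectAccessTM.computation M A)) t b →
      ∃[ u ] Exec (raStreams (bin A)) (runProgram program) (λ _ → []) u (capacity g #states (⌈log₂ size A ⌉ + t) 0 ^ programDeg program) ×
      nonempty (u (local 1)) ≡ b
    execution A {t} {b} o =
      let ρ , runs , v = search-phase A o ⌈log₂ size A ⌉ 0 (Language.evals _ _ (SA A) init (λ ())) false (+-identityʳ _) (initial-holds A)
          u , ex , res = runProgram-exec program (raStreams (bin A)) (raSingle (bin A)) bounding {T′} {ρ} runs #states (initial-bounded A) (m≤m+n _ _)
            (≤-trans (≤-trans (m≤m+n T′ 0) (m≤n+m _ 2)) (m≤n+m _ (T′ * g + #states)))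
      in u , ex , trans (cong nonempty res) v
      where
      T′ = ⌈log₂ size A ⌉ + t
      bounding : Language.Bounding ⊤ (λ _ → 1) (SA A) (capacity g #states T′ 0)
      bounding = record
        { 2≤N = ≤-trans (m≤m+n 2 (T′ + 0)) (m≤n+m _ (T′ * g + #states))
        ; answers = λ o xs → ≤-trans (≤-reflexive (length-reverse (raStreams (bin A) o xs)))
            (≤-trans (raSingle (bin A) o refl xs) (≤-trans (s≤s z≤n) (m≤n+m (2 + (T′ + 0)) (T′ * g + #states)))) }

    polylog : ∀ {ℓ} (C : Pred (Structure σ) ℓ) → DecidesInPolylog (DirectAccessTM.computation M) size C → RandomAccessPolylog σ C
    polylog = ToRandom.polylog (runProgram program) M g #states (programDeg program) execution

theorem1 : ∀ {ℓ} (σ : Vocabulary) → HasPositiveArity σ → (C : Pred (Structure σ) ℓ) → RandomAccessPolylog σ C ⇔ DirectAccessPolylog σ C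
theorem1 σ pos-arity C = mk⇔
  (λ (M , dec) → RandomToDirect.polylog pos-arity M C dec)
  (λ (M , dec) → DirectToRandom.polylog pos-arity M C dec)
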